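{- Let $\Gamma\in\mathscr G_3$ have coherent rank $8$. Then (for a suitable ordering of the vertices) the adjacency matrix of $\Gamma$ has the form $$\begin{bmatrix} O & M\\ M^\top & J-I\end{bmatrix},$$ where $M$ is the incidence matrix of a symmetric $2$-$(\lambda^3-\lambda+1,\lambda^2,\lambda)$ design for some $\lambda\in\mathbb N$.
   Context: All graphs are finite, undirected and simple; the eigenvalues of a graph are those of its adjacency matrix $A(\Gamma)$. $\mathscr G_3$ denotes the set of all connected graphs having precisely three distinct eigenvalues. $I$, $J$, $O$ denote the identity, all-ones and zero matrices of appropriate size. A coherent algebra on a finite set $X$ is a matrix algebra $\mathcal A\subset \operatorname{Mat}_X(\mathbb C)$ that contains $I$ and $J$, and is closed under transposition, ordinary matrix multiplication and entrywise multiplication. Each coherent algebra has a unique linear basis consisting of $\{0,1\}$-matrices whose sum is $J$; the number of these matrices is the rank of $\mathcal A$. The coherent closure $\mathcal W(\Gamma)$ of $\Gamma$ is the smallest coherent algebra containing $A(\Gamma)$, and the coherent rank of $\Gamma$ is the rank of $\mathcal W(\Gamma)$. A $2$-$(v,k,\lambda)$ design is a pair $(\mathcal P,\mathcal B)$ with $|\mathcal P|=v$ points and a family $\mathcal B$ of $k$-subsets of $\mathcal P$ (blocks) such that every pair of distinct points lies in precisely $\lambda$ blocks. It is symmetric if every two blocks intersect in a constant number of points (so the number of blocks equals $v$). The incidence matrix has rows indexed by points, columns indexed by blocks, and $(i,j)$-entry $1$ if $i\in j$ and $0$ otherwise. -}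

module Defs where

open import Algebra.Bundles using (CommutativeRing)
open import Algebra.Bundles.Raw using (RawRing)
import Algebra.Definitions.RawMonoid
import Algebra.Definitions.RawSemiring
open import Data.Bool.Base using (Bool; true; false; if_then_else_)
open import Data.Fin.Base using (Fin; splitAt; toℕ)
open import Data.Fin.Properties using (_≟_)
open import Data.Fin.Subset using (Subset; ∣_∣; _∩_)
open import Data.Fin.Subset.Properties using (_∈?_)
open import Data.Nat.Base using (ℕ)
import Data.Nat.Base as ℕ
open import Data.Product.Base using (Σ-syntax; ∃-syntax; _×_; _,_)
open import Data.Sum.Base using (_⊎_; inj₁; inj₂)
open import Data.Vec.Base using (tabulate)
open import Data.Vec.Functional using (Vector)
open import Function.Bundles using (_↔_; Inverse)
open import Level using (Level; _⊔_)
open import Relation.Binary.Construct.Closure.ReflexiveTransitive using (Star)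
open import Relation.Binary.Core using (Rel)
open import Relation.Binary.PropositionalEquality.Core using (_≡_; _≢_)
open import Relation.Binary.Structures using (IsStrictTotalOrder)
open import Relation.Nullary using (¬_; does)

------------------------------------------------------------------------
-- The scalars

-- The standard library has neither ℝ nor ℂ.  They are replaced by an
-- arbitrary real closed field R and its complexification R(i).  "Real
-- closed" is taken in the form: R is an ordered field and R(i) is
-- algebraically closed.  The real numbers are an instance (classically,
-- since the order is decidable), and so are the real algebraic numbers,
-- which contain all eigenvalues of all graphs.

record OrderedField (c ℓ₁ ℓ₂ : Level) : Set (Level.suc (c ⊔ ℓ₁ ⊔ ℓ₂)) where
  field
    commutativeRing : CommutativeRing c ℓ₁

  open CommutativeRing commutativeRing public

  infix 4 _<_
  field
    _<_                : Rel Carrier ℓ₂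
    isStrictTotalOrder : IsStrictTotalOrder _≈_ _<_
    0≉1                : ¬ (0# ≈ 1#)
    inverse            : ∀ x → ¬ (x ≈ 0#) → ∃[ y ] x * y ≈ 1#
    +-monoʳ-<          : ∀ x {y z} → y < z → x + y < x + z
    *-pos              : ∀ {x y} → 0# < x → 0# < y → 0# < x * y

  -- The pair (a , b) stands for a + b i.
  complexification : RawRing c ℓ₁
  complexification = record
    { Carrier = Carrier × Carrier
    ; _≈_     = λ { (a , b) (a′ , b′) → (a ≈ a′) × (b ≈ b′) }
    ; _+_     = λ { (a , b) (a′ , b′) → (a + a′) , (b + b′) }
    ; _*_     = λ { (a , b) (a′ , b′) →
                      (a * a′ - b * b′) , (a * b′ + b * a′) }
    ; -_      = λ { (a , b) → (- a) , (- b) }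
    ; 0#      = 0# , 0#
    ; 1#      = 1# , 0#
    }

module _ {c ℓ} (K : RawRing c ℓ) where
  open RawRing K
  open Algebra.Definitions.RawSemiring rawSemiring using (_^_; sum)

  -- Every monic polynomial of degree d + 1 has a root.
  AlgebraicallyClosed : Set (c ⊔ ℓ)
  AlgebraicallyClosed = ∀ d (a : Vector Carrier (ℕ.suc d)) →
    ∃[ z ] z ^ ℕ.suc d + sum (λ i → a i * z ^ toℕ i) ≈ 0#

record RealClosedField (c ℓ₁ ℓ₂ : Level) : Set (Level.suc (c ⊔ ℓ₁ ⊔ ℓ₂)) where
  field
    orderedField : OrderedField c ℓ₁ ℓ₂

  ℂ : RawRing c ℓ₁
  ℂ = OrderedField.complexification orderedField

  field
    algebraicallyClosed : AlgebraicallyClosed ℂ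

------------------------------------------------------------------------
-- Graphs and designs

record Graph (n : ℕ) : Set where
  field
    adjacent? : Fin n → Fin n → Bool
    symmetric : ∀ x y → adjacent? x y ≡ adjacent? y x
    loopless  : ∀ x → adjacent? x x ≡ false

  Adjacent : Fin n → Fin n → Set
  Adjacent x y = adjacent? x y ≡ true

  Connected : Set
  Connected = ∀ x y → Star Adjacent x y

-- 2-(v,k,λ) designs with b blocks; repeated blocks are not excluded.
record Design (v b k l : ℕ) : Set where
  field
    block     : Fin b → Subset v
    blockSize : ∀ j → ∣ block j ∣ ≡ k

  blocksThrough : Fin v → Subset b
  blocksThrough p = tabulate (λ j → does (p ∈? block j))

  field
    balanced : ∀ p q → p ≢ q → ∣ blocksThrough p ∩ blocksThrough q ∣ ≡ l

  -- The equation b ≡ v follows from constant intersections except in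
  -- degenerate cases (such as a single block), which it excludes.
  Symmetric : Set
  Symmetric = (b ≡ v) ×
    (∃[ m ] (∀ i j → i ≢ j → ∣ block i ∩ block j ∣ ≡ m))

------------------------------------------------------------------------
-- Matrices

module Matrices {c ℓ} (K : RawRing c ℓ) where
  open RawRing K
  open Algebra.Definitions.RawMonoid +-rawMonoid using (sum)

  Matrix : ℕ → ℕ → Set c
  Matrix m n = Fin m → Fin n → Carrier

  infix 4 _≈ᴹ_
  _≈ᴹ_ : ∀ {m n} → Rel (Matrix m n) ℓ
  M ≈ᴹ N = ∀ i j → M i j ≈ N i j

  I : ∀ {n} → Matrix n n
  I i j = if does (i ≟ j) then 1# else 0#

  J O : ∀ {m n} → Matrix m n
  J i j = 1#
  O i j = 0#

  infixl 6 _+ᴹ_ _-ᴹ_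
  infixl 7 _*ᴹ_ _∘ᴹ_ _•ᴹ_
  infix  8 _ᵀ

  _+ᴹ_ _-ᴹ_ _∘ᴹ_ : ∀ {m n} → Matrix m n → Matrix m n → Matrix m n
  (M +ᴹ N) i j = M i j + N i j
  (M -ᴹ N) i j = M i j + - N i j
  (M ∘ᴹ N) i j = M i j * N i j

  _•ᴹ_ : ∀ {m n} → Carrier → Matrix m n → Matrix m n
  (a •ᴹ M) i j = a * M i j

  _*ᴹ_ : ∀ {m n p} → Matrix m n → Matrix n p → Matrix m p
  (M *ᴹ N) i k = sum (λ j → M i j * N j k)

  _ᵀ : ∀ {m n} → Matrix m n → Matrix n m
  (M ᵀ) i j = M j i

  blockMatrix : ∀ {m n p q} → Matrix m p → Matrix m q →
                Matrix n p → Matrix n q → Matrix (m ℕ.+ n) (p ℕ.+ q)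
  blockMatrix {m} {n} {p} {q} A B C D i j with splitAt m i | splitAt p j
  ... | inj₁ i′ | inj₁ j′ = A i′ j′
  ... | inj₁ i′ | inj₂ j′ = B i′ j′
  ... | inj₂ i′ | inj₁ j′ = C i′ j′
  ... | inj₂ i′ | inj₂ j′ = D i′ j′

  linearCombination : ∀ {r m n} → Vector Carrier r →
                      Vector (Matrix m n) r → Matrix m n
  linearCombination a B i j = sum (λ k → a k * B k i j)

  adjacencyMatrix : ∀ {n} → Graph n → Matrix n n
  adjacencyMatrix Γ x y = if Graph.adjacent? Γ x y then 1# else 0#

  incidenceMatrix : ∀ {v b k l} → Design v b k l → Matrix v b
  incidenceMatrix D i j = if does (i ∈? Design.block D j) then 1# else 0#

  ----------------------------------------------------------------------
  -- Eigenvalues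

  IsEigenvalue : ∀ {n} → Matrix n n → Carrier → Set (c ⊔ ℓ)
  IsEigenvalue {n} M θ = Σ[ v ∈ Vector Carrier n ]
    ¬ (∀ i → v i ≈ 0#) × (∀ i → sum (λ j → M i j * v j) ≈ θ * v i)

  record PreciselyDistinctEigenvalues {n} (M : Matrix n n) (r : ℕ) :
         Set (c ⊔ ℓ) where
    field
      eigenvalue : Vector Carrier r
      isEigenvalue : ∀ i → IsEigenvalue M (eigenvalue i)
      distinct : ∀ i j → i ≢ j → ¬ (eigenvalue i ≈ eigenvalue j)
      exhaustive : ∀ θ → IsEigenvalue M θ → ∃[ i ] θ ≈ eigenvalue i

  𝒢₃ : ∀ {n} → Graph n → Set (c ⊔ ℓ)
  𝒢₃ Γ = Graph.Connected Γ × PreciselyDistinctEigenvalues (adjacencyMatrix Γ) 3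

  ----------------------------------------------------------------------
  -- Coherent algebras

  record IsCoherentAlgebra {n p} (𝒜 : Matrix n n → Set p) :
         Set (c ⊔ ℓ ⊔ p) where
    field
      respects-≈ : ∀ {M N} → M ≈ᴹ N → 𝒜 M → 𝒜 N
      +-closed   : ∀ {M N} → 𝒜 M → 𝒜 N → 𝒜 (M +ᴹ N)
      •-closed   : ∀ a {M} → 𝒜 M → 𝒜 (a •ᴹ M)
      *-closed   : ∀ {M N} → 𝒜 M → 𝒜 N → 𝒜 (M *ᴹ N)
      ∘-closed   : ∀ {M N} → 𝒜 M → 𝒜 N → 𝒜 (M ∘ᴹ N)
      ᵀ-closed   : ∀ {M} → 𝒜 M → 𝒜 (M ᵀ)
      I-member   : 𝒜 I
      J-member   : 𝒜 J

  -- The smallest coherent algebra containing A; see the two lemmas below.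
  data CoherentClosure {n} (A : Matrix n n) : Matrix n n → Set (c ⊔ ℓ) where
    generator : CoherentClosure A A
    resp      : ∀ {M N} → M ≈ᴹ N → CoherentClosure A M → CoherentClosure A N
    plus      : ∀ {M N} → CoherentClosure A M → CoherentClosure A N →
                CoherentClosure A (M +ᴹ N)
    scale     : ∀ a {M} → CoherentClosure A M → CoherentClosure A (a •ᴹ M)
    times     : ∀ {M N} → CoherentClosure A M → CoherentClosure A N →
                CoherentClosure A (M *ᴹ N)
    schur     : ∀ {M N} → CoherentClosure A M → CoherentClosure A N →
                CoherentClosure A (M ∘ᴹ N)
    transpose : ∀ {M} → CoherentClosure A M → CoherentClosure A (M ᵀ)
    identity  : CoherentClosure A I
    allOnes   : CoherentClosure A J

  closure-isCoherentAlgebra : ∀ {n} (A : Matrix n n) →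
                              IsCoherentAlgebra (CoherentClosure A)
  closure-isCoherentAlgebra A = record
    { respects-≈ = resp
    ; +-closed   = plus
    ; •-closed   = scale
    ; *-closed   = times
    ; ∘-closed   = schur
    ; ᵀ-closed   = transpose
    ; I-member   = identity
    ; J-member   = allOnes
    }

  closure-least : ∀ {n p} {A : Matrix n n} {𝒜 : Matrix n n → Set p} →
                  IsCoherentAlgebra 𝒜 → 𝒜 A →
                  ∀ {M} → CoherentClosure A M → 𝒜 M
  closure-least {A = A} {𝒜} alg A∈𝒜 = go
    where
    open IsCoherentAlgebra alg
    go : ∀ {M} → CoherentClosure A M → 𝒜 M
    go generator     = A∈𝒜
    go (resp e p)    = respects-≈ e (go p)
    go (plus p q)    = +-closed (go p) (go q)
    go (scale a p)   = •-closed a (go p)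
    go (times p q)   = *-closed (go p) (go q)
    go (schur p q)   = ∘-closed (go p) (go q)
    go (transpose p) = ᵀ-closed (go p)
    go identity      = I-member
    go allOnes       = J-member

  record HasRank {n p} (𝒜 : Matrix n n → Set p) (r : ℕ) :
         Set (c ⊔ ℓ ⊔ p) where
    field
      basis       : Vector (Matrix n n) r
      member      : ∀ k → 𝒜 (basis k)
      zeroOne     : ∀ k i j → (basis k i j ≈ 0#) ⊎ (basis k i j ≈ 1#)
      sum≈J       : (λ i j → sum (λ k → basis k i j)) ≈ᴹ J
      independent : ∀ a → linearCombination a basis ≈ᴹ O → ∀ k → a k ≈ 0#
      spanning    : ∀ M → 𝒜 M → ∃[ a ] M ≈ᴹ linearCombination a basis

  HasCoherentRank : ∀ {n} → Graph n → ℕ → Set (c ⊔ ℓ)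
  HasCoherentRank Γ = HasRank (CoherentClosure (adjacencyMatrix Γ))

  ----------------------------------------------------------------------
  -- Vertex orderings

  HasFormUpToOrdering : ∀ {m n} → Graph n → Matrix m m → Set ℓ
  HasFormUpToOrdering {m} {n} Γ N = Σ[ σ ∈ Fin m ↔ Fin n ]
    (λ i j → adjacencyMatrix Γ (Inverse.to σ i) (Inverse.to σ j)) ≈ᴹ N

{-# OPTIONS --safe #-}
module Submission where

-- Let A be the adjacency matrix.  Over the complex numbers (a real closed field
-- with i adjoined) every vector is killed by some monic polynomial in A, since
-- n + 1 vectors of length n are dependent; splitting off roots one at a time, and
-- because a real symmetric matrix has real eigenvalues without generalised
-- eigenvectors, (A - a)(A - b)(A - c) = 0 for the three eigenvalues (eigenvalue-real,
-- annihilated).  If a is the largest, then a - A is positive semidefinite, so the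
-- entrywise absolute value of an eigenvector for a is again one (abs-eigen), and by
-- connectedness it has no zeros.  Hence the eigenspace is a line, spanned by a
-- positive vector y, and
--   A A - s A + p I = κ y yᵀ   with s = b + c, p = b c, κ ≠ 0,
-- where the diagonal shows that y is a function of the degree.  This is recorded in
-- RankOneEquation, and the eigenvalues are not used again.
--
-- The basis of the coherent closure colours the pairs of vertices with eight
-- colours.  More than eight pairs can thus not all be told apart by matrices in
-- the closure (pigeonhole), and fewer than eight types of pairs cannot determine all
-- entries of these matrices (tooFewTypes).  If the graph is regular, or is the join
-- of two graphs with constant degrees one of which is complete or edgeless, then
-- the matrices whose entries depend on the type of the position (the degrees,
-- adjacency and equality) form a coherent algebra with at most seven types
-- (rank≢8).  So there are at least two degrees.  There are at most two, since three
-- vertices told apart by constant-row matrices of the closure give nine pairs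
-- (no-three); for the same reason the number of neighbours of a vertex in either
-- degree class depends on its class only (DivisionByDegree).
--
-- The graph is not the join of the two classes: otherwise both classes contain
-- adjacent and distinct nonadjacent pairs, and an inequality between the
-- resulting parameters forces equal degrees (JoinExcluded).  So there are edges and
-- non-edges between the classes, which account for four colours.  Neither class is
-- a single vertex, since then the constant numbers of neighbours in it would leave
-- only edges or only non-edges.  Hence for each class there remain just the two
-- colours of equal and of distinct vertices in it, so that each class is a clique
-- or independent (uniform).  Now the equation says that any two distinct vertices
-- of a class have equally many common neighbours in the other class.  Counting
-- gives equal sizes and valencies, so exactly one class is independent, as the
-- degrees differ.  With m common neighbours, k neighbours and n vertices on either
-- side, the rank one condition is k k = m (m + n - 1), while the design satisfies
-- k k = n m + (k - m).  Therefore k = m m and n = m m m - m + 1 (Parameters), and it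
-- remains to sort the vertices by class (Assembly).

open import Algebra.Bundles using (CommutativeRing)
open import Algebra.Bundles.Raw using (RawRing)
import Algebra.Definitions.RawSemiring
import Algebra.Properties.Ring
import Algebra.Properties.Semiring.Mult.TCOptimised
import Algebra.Properties.Semiring.Sum
import Algebra.Solver.Ring
open import Algebra.Solver.Ring.AlmostCommutativeRing using (_-Raw-AlmostCommutative⟶_; fromCommutativeRing; Induced-equivalence)
open import Data.Bool.Base using (Bool; true; false; if_then_else_; _∧_; not)
import Data.Bool.Properties as Bool
open import Data.Empty using (⊥; ⊥-elim)
open import Data.Fin.Base using (Fin; zero; suc; toℕ; punchIn; punchOut; splitAt; remQuot; combine)
open import Data.Fin.Patterns using (0F; 1F; 2F; 3F; 4F; 5F; 6F; 7F; 8F)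
import Data.Fin.Properties as Fin
open import Data.Fin.Subset using (Subset; ∣_∣; _∩_)
open import Data.Fin.Subset.Properties using (_∈?_)
open import Data.Integer.Base using (ℤ; +_; -[1+_]; _⊖_)
import Data.Integer.Base as ℤ
import Data.Integer.Properties as ℤ
open import Data.Maybe.Base using (just; nothing)
open import Data.Nat.Base using (ℕ)
import Data.Nat.Base as ℕ
import Data.Nat.Properties as ℕ
import Data.Nat.Tactic.RingSolver as ℕ-solver
open import Data.Product.Base using (Σ-syntax; ∃-syntax; _×_; _,_; proj₁; proj₂)
open import Data.Product.Properties using (≡-dec)
open import Data.Sum.Base using (_⊎_; inj₁; inj₂)
import Data.Sum.Base as Sum
open import Data.Vec.Base using (tabulate)
open import Data.Vec.Functional using (Vector)
open import Function.Base using (_∘_; case_of_)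
open import Function.Bundles using (_↔_; Inverse; mk↔ₛ′)
open import Function.Construct.Composition using (_↔-∘_)
open import Level using (Level; _⊔_)
open import Relation.Binary.Construct.Closure.ReflexiveTransitive using (Star; ε; _◅_)
open import Relation.Binary.Definitions using (Decidable; WeaklyDecidable; tri<; tri≈; tri>)
import Relation.Binary.PropositionalEquality as ≡
open ≡ using (_≡_; _≢_)
import Relation.Binary.Reasoning.Setoid
open import Relation.Binary.Structures using (IsStrictTotalOrder)
open import Relation.Nullary using (¬_; Dec; yes; no; does)
open import Relation.Nullary.Decidable using (¬?; _×-dec_; _→-dec_; from-yes; dec-true; dec-false)
open import Defs

-- Rings, sums and fields

module RingTools {c ℓ} (R : CommutativeRing c ℓ) where
  open CommutativeRing R hiding (zero)
  open Algebra.Properties.Ring ring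
  module Mult = Algebra.Properties.Semiring.Mult.TCOptimised semiring
  open Relation.Binary.Reasoning.Setoid setoid

  -- The image of a natural number in the ring.
  ι : ℕ → Carrier
  ι n = n Mult.× 1#

  ι-suc : ∀ n → ι (ℕ.suc n) ≈ 1# + ι n
  ι-suc n = Mult.1+× n 1#

  ι-+ : ∀ m n → ι (m ℕ.+ n) ≈ ι m + ι n
  ι-+ = Mult.×-homo-+ 1#

  ι-* : ∀ m n → ι (m ℕ.* n) ≈ ι m * ι n
  ι-* = Mult.×1-homo-*

  private
    -- The image of an integer.
    ιℤ : ℤ → Carrier
    ιℤ (+ n)    = ι n
    ιℤ -[1+ n ] = - ι (ℕ.suc n)

    a+b-[a+c] : ∀ a b c → b - c ≈ (a + b) - (a + c)
    a+b-[a+c] a b c = begin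
      b - c                 ≈⟨ +-congʳ (sym (+-identityˡ b)) ⟩
      0# + b - c            ≈⟨ +-congʳ (+-congʳ (sym (-‿inverseʳ a))) ⟩
      a - a + b - c         ≈⟨ +-congʳ (trans (+-assoc _ _ _) (+-congˡ (+-comm _ _))) ⟩
      a + (b - a) - c       ≈⟨ +-congʳ (sym (+-assoc _ _ _)) ⟩
      a + b - a - c         ≈⟨ +-assoc _ _ _ ⟩
      a + b + (- a - c)     ≈⟨ +-congˡ (-‿+-comm a c) ⟩
      (a + b) - (a + c)     ∎

    ι-⊖ : ∀ m n → ιℤ (m ⊖ n) ≈ ι m - ι n
    ι-⊖ m         ℕ.zero    = sym (trans (+-congˡ -0#≈0#) (+-identityʳ _))
    ι-⊖ ℕ.zero    (ℕ.suc n) = sym (+-identityˡ _)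
    ι-⊖ (ℕ.suc m) (ℕ.suc n) = begin
      ιℤ (ℕ.suc m ⊖ ℕ.suc n)     ≡⟨ ≡.cong ιℤ (ℤ.[1+m]⊖[1+n]≡m⊖n m n) ⟩
      ιℤ (m ⊖ n)                 ≈⟨ ι-⊖ m n ⟩
      ι m - ι n                  ≈⟨ a+b-[a+c] 1# (ι m) (ι n) ⟩
      (1# + ι m) - (1# + ι n)    ≈⟨ +-cong (sym (ι-suc m)) (-‿cong (sym (ι-suc n))) ⟩
      ι (ℕ.suc m) - ι (ℕ.suc n)  ∎

    ιℤ-+ : ∀ i j → ιℤ (i ℤ.+ j) ≈ ιℤ i + ιℤ j
    ιℤ-+ (+ m)    (+ n)    = ι-+ m n
    ιℤ-+ (+ m)    -[1+ n ] = ι-⊖ m (ℕ.suc n)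
    ιℤ-+ -[1+ m ] (+ n)    = trans (ι-⊖ n (ℕ.suc m)) (+-comm _ _)
    ιℤ-+ -[1+ m ] -[1+ n ] = begin
      - ι (ℕ.suc (ℕ.suc (m ℕ.+ n)))        ≡⟨ ≡.cong (λ k → - ι (ℕ.suc k)) (≡.sym (ℕ.+-suc m n)) ⟩
      - ι (ℕ.suc m ℕ.+ ℕ.suc n)            ≈⟨ -‿cong (ι-+ (ℕ.suc m) (ℕ.suc n)) ⟩
      - (ι (ℕ.suc m) + ι (ℕ.suc n))        ≈⟨ sym (-‿+-comm _ _) ⟩
      - ι (ℕ.suc m) - ι (ℕ.suc n)          ∎

    ιℤ-neg : ∀ i → ιℤ (ℤ.- i) ≈ - ιℤ i
    ιℤ-neg (+ ℕ.zero)    = sym -0#≈0#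
    ιℤ-neg (+ (ℕ.suc n)) = refl
    ιℤ-neg -[1+ n ]      = sym (-‿involutive _)

    ιℤ-pos* : ∀ m j → ιℤ (+ m ℤ.* j) ≈ ι m * ιℤ j
    ιℤ-pos* m (+ n) = begin
      ιℤ (+ m ℤ.* + n)  ≡⟨ ≡.cong ιℤ (≡.sym (ℤ.pos-* m n)) ⟩
      ι (m ℕ.* n)       ≈⟨ ι-* m n ⟩
      ι m * ι n         ∎
    ιℤ-pos* m -[1+ n ] = begin
      ιℤ (+ m ℤ.* -[1+ n ])           ≡⟨ ≡.cong ιℤ (≡.sym (ℤ.neg-distribʳ-* (+ m) (+ ℕ.suc n))) ⟩
      ιℤ (ℤ.- (+ m ℤ.* + ℕ.suc n))    ≈⟨ ιℤ-neg (+ m ℤ.* + ℕ.suc n) ⟩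
      - ιℤ (+ m ℤ.* + ℕ.suc n)        ≈⟨ -‿cong (ιℤ-pos* m (+ ℕ.suc n)) ⟩
      - (ι m * ι (ℕ.suc n))           ≈⟨ -‿distribʳ-* _ _ ⟩
      ι m * - ι (ℕ.suc n)             ∎

    ιℤ-* : ∀ i j → ιℤ (i ℤ.* j) ≈ ιℤ i * ιℤ j
    ιℤ-* (+ m)    j = ιℤ-pos* m j
    ιℤ-* -[1+ m ] j = begin
      ιℤ (-[1+ m ] ℤ.* j)           ≡⟨ ≡.cong ιℤ (≡.sym (ℤ.neg-distribˡ-* (+ ℕ.suc m) j)) ⟩
      ιℤ (ℤ.- (+ ℕ.suc m ℤ.* j))    ≈⟨ ιℤ-neg (+ ℕ.suc m ℤ.* j) ⟩
      - ιℤ (+ ℕ.suc m ℤ.* j)        ≈⟨ -‿cong (ιℤ-pos* (ℕ.suc m) j) ⟩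
      - (ι (ℕ.suc m) * ιℤ j)        ≈⟨ -‿distribˡ-* _ _ ⟩
      - ι (ℕ.suc m) * ιℤ j          ∎

    morphism : ℤ.+-*-rawRing -Raw-AlmostCommutative⟶ fromCommutativeRing R
    morphism = record
      { ⟦_⟧    = ιℤ
      ; +-homo = ιℤ-+
      ; *-homo = ιℤ-*
      ; -‿homo = ιℤ-neg
      ; 0-homo = refl
      ; 1-homo = refl
      }

    _coeff≟_ : WeaklyDecidable (Induced-equivalence morphism)
    i coeff≟ j with i ℤ.≟ j
    ... | yes i≡j = just (reflexive (≡.cong ιℤ i≡j))
    ... | no  _   = nothing

  -- The coefficients are integers, so that terms cancel although equality in
  -- the ring need not be decidable.
  module Solver = Algebra.Solver.Ring ℤ.+-*-rawRing (fromCommutativeRing R) morphism _coeff≟_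
  open Solver public using (solve; _:=_; _:+_; _:*_; :-_; _:-_)

  :0 :1 : ∀ {n} → Solver.Polynomial n
  :0 = Solver.con (+ 0)
  :1 = Solver.con (+ 1)

  x-y≈0⇒x≈y : ∀ {x y} → x - y ≈ 0# → x ≈ y
  x-y≈0⇒x≈y {x} {y} e = begin
    x          ≈⟨ solve 2 (λ x y → x := (x :- y) :+ y) refl x y ⟩
    x - y + y  ≈⟨ +-congʳ e ⟩
    0# + y     ≈⟨ +-identityˡ y ⟩
    y          ∎

  x≈y⇒x-y≈0 : ∀ {x y} → x ≈ y → x - y ≈ 0#
  x≈y⇒x-y≈0 {x} {y} e = trans (+-congʳ e) (-‿inverseʳ y)

  open Algebra.Properties.Semiring.Sum semiring public
    using (sum; ∑-distrib-+; ∑-comm; *-distribˡ-sum; *-distribʳ-sum)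
    renaming (sum-cong-≋ to sum-cong)

  sum-≈0 : ∀ {n} (f : Fin n → Carrier) → (∀ i → f i ≈ 0#) → sum f ≈ 0#
  sum-≈0 {ℕ.zero}  f f≈0 = refl
  sum-≈0 {ℕ.suc n} f f≈0 = trans (+-cong (f≈0 zero) (sum-≈0 (f ∘ suc) (f≈0 ∘ suc))) (+-identityˡ 0#)

  sum-neg : ∀ {n} (f : Fin n → Carrier) → sum (λ i → - f i) ≈ - sum f
  sum-neg {ℕ.zero}  f = sym -0#≈0#
  sum-neg {ℕ.suc n} f = trans (+-congˡ (sum-neg (f ∘ suc))) (-‿+-comm _ _)

  sum-sub : ∀ {n} (f g : Fin n → Carrier) → sum (λ i → f i - g i) ≈ sum f - sum g
  sum-sub f g = trans (∑-distrib-+ f (λ i → - g i)) (+-congˡ (sum-neg g))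

  -- The indicator of a truth value.
  [_] : Bool → Carrier
  [ b ] = if b then 1# else 0#

  -- Kronecker's delta, the entries of the identity matrix.
  δ : ∀ {n} → Fin n → Fin n → Carrier
  δ i j = [ does (i Fin.≟ j) ]

  δ-refl : ∀ {n} (i : Fin n) → δ i i ≈ 1#
  δ-refl i with i Fin.≟ i
  ... | yes _ = refl
  ... | no i≢i = ⊥-elim (i≢i ≡.refl)

  δ-≢ : ∀ {n} {i j : Fin n} → i ≢ j → δ i j ≈ 0#
  δ-≢ {i = i} {j} i≢j with i Fin.≟ j
  ... | yes i≡j = ⊥-elim (i≢j i≡j)
  ... | no _ = refl

  δ-sym : ∀ {n} (i j : Fin n) → δ i j ≈ δ j i
  δ-sym i j with i Fin.≟ j
  ... | yes ≡.refl = sym (δ-refl i)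
  ... | no i≢j = sym (δ-≢ (i≢j ∘ ≡.sym))

  sum-δ : ∀ {n} (i : Fin n) (f : Fin n → Carrier) → sum (λ j → δ i j * f j) ≈ f i
  sum-δ zero f = begin
    1# * f zero + sum (λ j → 0# * f (suc j))
      ≈⟨ +-cong (*-identityˡ _) (sum-≈0 (λ j → 0# * f (suc j)) (λ j → zeroˡ (f (suc j)))) ⟩
    f zero + 0#  ≈⟨ +-identityʳ _ ⟩
    f zero       ∎
  sum-δ (suc i) f = begin
    0# * f zero + sum (λ j → δ (suc i) (suc j) * f (suc j))  ≈⟨ +-cong (zeroˡ _) (sum-δ i (f ∘ suc)) ⟩
    0# + f (suc i)                                           ≈⟨ +-identityˡ _ ⟩
    f (suc i)                                                ∎

  sum-δʳ : ∀ {n} (i : Fin n) (f : Fin n → Carrier) → sum (λ j → f j * δ j i) ≈ f i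
  sum-δʳ i f = trans (sum-cong (λ j → trans (*-comm _ _) (*-congʳ (δ-sym j i)))) (sum-δ i f)

  [∧] : ∀ a b → [ a ∧ b ] ≈ [ a ] * [ b ]
  [∧] true  b = sym (*-identityˡ _)
  [∧] false b = sym (zeroˡ _)

  []-cong : ∀ {a b} → a ≡ b → [ a ] ≈ [ b ]
  []-cong e = reflexive (≡.cong [_] e)

  []-idem : ∀ a → [ a ] * [ a ] ≈ [ a ]
  []-idem true  = *-identityˡ _
  []-idem false = zeroˡ _

  [not] : ∀ a → [ not a ] ≈ 1# - [ a ]
  [not] true  = sym (-‿inverseʳ 1#)
  [not] false = sym (trans (+-congˡ -0#≈0#) (+-identityʳ 1#))

-- The number of places where a truth-valued function is true.
count : ∀ {n} → (Fin n → Bool) → ℕ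
count {ℕ.zero}  b = 0
count {ℕ.suc n} b = (if b zero then 1 else 0) ℕ.+ count (b ∘ suc)

count≡0⇒false : ∀ {n} (b : Fin n → Bool) → count b ≡ 0 → ∀ i → b i ≡ false
count≡0⇒false {ℕ.suc n} b e i with b zero in b₀
count≡0⇒false b e zero    | false = b₀
count≡0⇒false b e (suc i) | false = count≡0⇒false (b ∘ suc) e i

count≡1⇒unique : ∀ {n} (b : Fin n → Bool) → count b ≡ 1 → ∀ i j → b i ≡ true → b j ≡ true → i ≡ j
count≡1⇒unique {ℕ.suc n} b e i j bi bj with b zero in b₀
count≡1⇒unique b e zero    zero    bi bj | _ = ≡.refl
count≡1⇒unique b e zero    (suc j) bi bj | true = case ≡.trans (≡.sym bj) (count≡0⇒false (b ∘ suc) (ℕ.suc-injective e) j) of λ ()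
count≡1⇒unique b e (suc i) zero    bi bj | true = case ≡.trans (≡.sym bi) (count≡0⇒false (b ∘ suc) (ℕ.suc-injective e) i) of λ ()
count≡1⇒unique b e (suc i) (suc j) bi bj | true = case ≡.trans (≡.sym bi) (count≡0⇒false (b ∘ suc) (ℕ.suc-injective e) i) of λ ()
count≡1⇒unique b e zero    (suc j) bi bj | false = case ≡.trans (≡.sym b₀) bi of λ ()
count≡1⇒unique b e (suc i) zero    bi bj | false = case ≡.trans (≡.sym b₀) bj of λ ()
count≡1⇒unique b e (suc i) (suc j) bi bj | false = ≡.cong suc (count≡1⇒unique (b ∘ suc) e i j bi bj)

module CountTools {c ℓ} (R : CommutativeRing c ℓ) where
  open CommutativeRing R hiding (zero)
  open RingTools R

  sum-[] : ∀ {n} (b : Fin n → Bool) → sum (λ i → [ b i ]) ≈ ι (count b)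
  sum-[] {ℕ.zero}  b = refl
  sum-[] {ℕ.suc n} b with b zero
  ... | true  = trans (+-congˡ (sum-[] (b ∘ suc))) (sym (ι-suc (count (b ∘ suc))))
  ... | false = trans (+-identityˡ _) (sum-[] (b ∘ suc))

-- Fields of characteristic zero with decidable equality.
record Field₀ (c ℓ : Level) : Set (Level.suc (c ⊔ ℓ)) where
  field
    commutativeRing : CommutativeRing c ℓ
  open CommutativeRing commutativeRing hiding (zero)
  open RingTools commutativeRing
  field
    _≈?_    : Decidable _≈_
    inverse : ∀ x → ¬ (x ≈ 0#) → ∃[ y ] x * y ≈ 1#
    char₀   : ∀ n → ¬ (ι (ℕ.suc n) ≈ 0#)

module FieldTools {c ℓ} (F : Field₀ c ℓ) where
  open Field₀ F public using (_≈?_; inverse; char₀)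
  R = Field₀.commutativeRing F
  open CommutativeRing R public hiding (zero)
  open RingTools R public
  open CountTools R public
  open Algebra.Properties.Ring ring public using (-0#≈0#)
  open Relation.Binary.Reasoning.Setoid setoid

  0≉1 : ¬ (0# ≈ 1#)
  0≉1 e = char₀ 0 (sym e)

  *-cancelˡ : ∀ {x y z} → ¬ (x ≈ 0#) → x * y ≈ x * z → y ≈ z
  *-cancelˡ {x} {y} {z} x≉0 e with i , xi≈1 ← inverse x x≉0 = begin
    y            ≈⟨ sym (*-identityˡ y) ⟩
    1# * y       ≈⟨ *-congʳ (sym xi≈1) ⟩
    x * i * y    ≈⟨ solve 3 (λ x i y → x :* i :* y := i :* (x :* y)) refl x i y ⟩
    i * (x * y)  ≈⟨ *-congˡ e ⟩
    i * (x * z)  ≈⟨ solve 3 (λ x i y → i :* (x :* y) := x :* i :* y) refl x i z ⟩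
    x * i * z    ≈⟨ *-congʳ xi≈1 ⟩
    1# * z       ≈⟨ *-identityˡ z ⟩
    z            ∎

  x*y≈0⇒y≈0 : ∀ {x y} → ¬ (x ≈ 0#) → x * y ≈ 0# → y ≈ 0#
  x*y≈0⇒y≈0 x≉0 e = *-cancelˡ x≉0 (trans e (sym (zeroʳ _)))

  *-≉0 : ∀ {x y} → ¬ (x ≈ 0#) → ¬ (y ≈ 0#) → ¬ (x * y ≈ 0#)
  *-≉0 x≉0 y≉0 e = y≉0 (x*y≈0⇒y≈0 x≉0 e)

  ι-injective : ∀ m n → ι m ≈ ι n → m ≡ n
  ι-injective ℕ.zero    ℕ.zero    e = ≡.refl
  ι-injective ℕ.zero    (ℕ.suc n) e = ⊥-elim (char₀ n (sym e))
  ι-injective (ℕ.suc m) ℕ.zero    e = ⊥-elim (char₀ m e)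
  ι-injective (ℕ.suc m) (ℕ.suc n) e = ≡.cong ℕ.suc (ι-injective m n (begin
    ι m             ≈⟨ solve 1 (λ x → x := (:1 :+ x) :- :1) refl (ι m) ⟩
    1# + ι m - 1#   ≈⟨ +-congʳ (trans (sym (ι-suc m)) (trans e (ι-suc n))) ⟩
    1# + ι n - 1#   ≈⟨ solve 1 (λ x → (:1 :+ x) :- :1 := x) refl (ι n) ⟩
    ι n             ∎))

  -- A sum of indicators vanishes only if each of them does.
  sum-[]≈0 : ∀ {n} (b : Fin n → Bool) → sum (λ i → [ b i ]) ≈ 0# → ∀ i → b i ≡ false
  sum-[]≈0 b e = count≡0⇒false b (ι-injective _ 0 (trans (sym (sum-[] b)) e))

-- Ordered fields and their complexifications

module OrderedTools {c ℓ₁ ℓ₂} (O : OrderedField c ℓ₁ ℓ₂) where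
  open OrderedField O using (_<_; isStrictTotalOrder; 0≉1; +-monoʳ-<; *-pos; commutativeRing; inverse)
  open CommutativeRing commutativeRing hiding (zero)
  open RingTools commutativeRing
  open Relation.Binary.Reasoning.Setoid setoid
  private module < = IsStrictTotalOrder isStrictTotalOrder

  -- NonNeg is a disjunction in order to be matched on.
  Pos NonNeg : Carrier → Set _
  Pos x    = 0# < x
  NonNeg x = Pos x ⊎ (x ≈ 0#)

  Pos-resp : ∀ {x y} → x ≈ y → Pos x → Pos y
  Pos-resp = <.<-respʳ-≈

  NonNeg-resp : ∀ {x y} → x ≈ y → NonNeg x → NonNeg y
  NonNeg-resp e (inj₁ p) = inj₁ (Pos-resp e p)
  NonNeg-resp e (inj₂ z) = inj₂ (trans (sym e) z)

  Pos⇒≉0 : ∀ {x} → Pos x → ¬ (x ≈ 0#)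
  Pos⇒≉0 p e = <.irrefl (sym e) p

  Pos-+ : ∀ {x y} → Pos x → NonNeg y → Pos (x + y)
  Pos-+ {x} p (inj₁ q) = <.trans p (<.<-respˡ-≈ (+-identityʳ x) (+-monoʳ-< x q))
  Pos-+ {x} p (inj₂ e) = Pos-resp (sym (trans (+-congˡ e) (+-identityʳ x))) p

  NonNeg-+ : ∀ {x y} → NonNeg x → NonNeg y → NonNeg (x + y)
  NonNeg-+ (inj₁ p) q = inj₁ (Pos-+ p q)
  NonNeg-+ (inj₂ e) q = NonNeg-resp (sym (trans (+-congʳ e) (+-identityˡ _))) q

  NonNeg-* : ∀ {x y} → NonNeg x → NonNeg y → NonNeg (x * y)
  NonNeg-* (inj₁ p) (inj₁ q) = inj₁ (*-pos p q)
  NonNeg-* (inj₁ p) (inj₂ e) = inj₂ (trans (*-congˡ e) (zeroʳ _))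
  NonNeg-* (inj₂ e) q        = inj₂ (trans (*-congʳ e) (zeroˡ _))

  <⇒Pos : ∀ {x y} → x < y → Pos (y - x)
  <⇒Pos {x} {y} lt = <.<-respˡ-≈ (-‿inverseˡ x) (<.<-respʳ-≈ (+-comm (- x) y) (+-monoʳ-< (- x) lt))

  neg⇒Pos : ∀ {x} → x < 0# → Pos (- x)
  neg⇒Pos lt = Pos-resp (+-identityˡ _) (<⇒Pos lt)

  NonNeg-antisym : ∀ {x} → NonNeg x → NonNeg (- x) → x ≈ 0#
  NonNeg-antisym (inj₂ e) _ = e
  NonNeg-antisym (inj₁ p) q = ⊥-elim (Pos⇒≉0 (Pos-+ p q) (-‿inverseʳ _))

  NonNeg-+≈0 : ∀ {x y} → NonNeg x → NonNeg y → x + y ≈ 0# → x ≈ 0#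
  NonNeg-+≈0 (inj₂ e) q s = e
  NonNeg-+≈0 (inj₁ p) q s = ⊥-elim (Pos⇒≉0 (Pos-+ p q) s)

  square : ∀ x → NonNeg (x * x)
  square x with <.compare x 0#
  ... | tri< lt _ _ = inj₁ (Pos-resp (solve 1 (λ x → :- x :* :- x := x :* x) refl x) (*-pos (neg⇒Pos lt) (neg⇒Pos lt)))
  ... | tri≈ _ e _  = inj₂ (trans (*-congʳ e) (zeroˡ _))
  ... | tri> _ _ gt = inj₁ (*-pos gt gt)

  1-pos : Pos 1#
  1-pos with NonNeg-resp (*-identityˡ 1#) (square 1#)
  ... | inj₁ p = p
  ... | inj₂ e = ⊥-elim (0≉1 (sym e))

  sum-NonNeg : ∀ {n} (f : Fin n → Carrier) → (∀ i → NonNeg (f i)) → NonNeg (sum f)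
  sum-NonNeg {ℕ.zero}  f p = inj₂ refl
  sum-NonNeg {ℕ.suc n} f p = NonNeg-+ (p zero) (sum-NonNeg (f ∘ suc) (p ∘ suc))

  sum-NonNeg≈0 : ∀ {n} (f : Fin n → Carrier) → (∀ i → NonNeg (f i)) → sum f ≈ 0# → ∀ i → f i ≈ 0#
  sum-NonNeg≈0 f p e zero    = NonNeg-+≈0 (p zero) (sum-NonNeg (f ∘ suc) (p ∘ suc)) e
  sum-NonNeg≈0 f p e (suc i) = sum-NonNeg≈0 (f ∘ suc) (p ∘ suc)
    (NonNeg-+≈0 (sum-NonNeg (f ∘ suc) (p ∘ suc)) (p zero) (trans (+-comm _ _) e)) i

  ι-pos : ∀ n → Pos (ι (ℕ.suc n))
  ι-pos ℕ.zero    = 1-pos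
  ι-pos (ℕ.suc n) = Pos-resp (sym (ι-suc (ℕ.suc n))) (Pos-+ 1-pos (inj₁ (ι-pos n)))

  field₀ : Field₀ c ℓ₁
  field₀ = record
    { commutativeRing = commutativeRing
    ; _≈?_            = <._≟_
    ; inverse         = inverse
    ; char₀           = λ n → Pos⇒≉0 (ι-pos n)
    }

  open FieldTools field₀ using (x*y≈0⇒y≈0)

  square≈0 : ∀ {x} → x * x ≈ 0# → x ≈ 0#
  square≈0 {x} e with x <.≟ 0#
  ... | yes x≈0 = x≈0
  ... | no  x≉0 = x*y≈0⇒y≈0 x≉0 e

  Pos-square-injective : ∀ {x y} → Pos x → Pos y → x * x ≈ y * y → x ≈ y
  Pos-square-injective {x} {y} p q e = x-y≈0⇒x≈y (x*y≈0⇒y≈0 (Pos⇒≉0 (Pos-+ p (inj₁ q))) (begin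
    (x + y) * (x - y)  ≈⟨ solve 2 (λ x y → (x :+ y) :* (x :- y) := x :* x :- y :* y) refl x y ⟩
    x * x - y * y      ≈⟨ x≈y⇒x-y≈0 e ⟩
    0#                 ∎))

  -- The absolute value.
  abs : Carrier → Carrier
  abs x with <.compare x 0#
  ... | tri< _ _ _ = - x
  ... | tri≈ _ _ _ = x
  ... | tri> _ _ _ = x

  abs-NonNeg : ∀ x → NonNeg (abs x)
  abs-NonNeg x with <.compare x 0#
  ... | tri< lt _ _ = inj₁ (neg⇒Pos lt)
  ... | tri≈ _ e _  = inj₂ e
  ... | tri> _ _ gt = inj₁ gt

  abs-square : ∀ x → abs x * abs x ≈ x * x
  abs-square x with <.compare x 0#
  ... | tri< lt _ _ = solve 1 (λ x → :- x :* :- x := x :* x) refl x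
  ... | tri≈ _ e _  = refl
  ... | tri> _ _ gt = refl

  abs-bound : ∀ x → NonNeg (abs x - x)
  abs-bound x with <.compare x 0#
  ... | tri< lt _ _ = inj₁ (Pos-+ (neg⇒Pos lt) (inj₁ (neg⇒Pos lt)))
  ... | tri≈ _ e _  = inj₂ (-‿inverseʳ x)
  ... | tri> _ _ gt = inj₂ (-‿inverseʳ x)

  abs-neg-bound : ∀ x → NonNeg (abs x + x)
  abs-neg-bound x with <.compare x 0#
  ... | tri< lt _ _ = inj₂ (-‿inverseˡ x)
  ... | tri≈ _ e _  = inj₂ (trans (+-cong e e) (+-identityˡ _))
  ... | tri> _ _ gt = inj₁ (Pos-+ gt (inj₁ gt))

  -- xy is at most the product of the absolute values: twice the difference is
  -- (|x| - x)(|y| + y) + (|x| + x)(|y| - y).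
  abs-*-bound : ∀ x y → NonNeg ((abs x * abs y - x * y) + (abs x * abs y - x * y))
  abs-*-bound x y = NonNeg-resp
    (solve 4 (λ a b x y → (a :- x) :* (b :+ y) :+ (a :+ x) :* (b :- y)
                       := (a :* b :- x :* y) :+ (a :* b :- x :* y)) refl (abs x) (abs y) x y)
    (NonNeg-+ (NonNeg-* (abs-bound x) (abs-neg-bound y)) (NonNeg-* (abs-neg-bound x) (abs-bound y)))

module Complexification {c ℓ₁ ℓ₂} (O : OrderedField c ℓ₁ ℓ₂) where
  open OrderedField O using (_<_; commutativeRing; complexification)
  open CommutativeRing commutativeRing hiding (zero)
  open RingTools commutativeRing
  open OrderedTools O
  open FieldTools field₀ using (_≈?_; inverse; char₀; *-≉0)
  open Relation.Binary.Reasoning.Setoid setoid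
  private module ℂ = RawRing complexification

  -- The pairs a + bi as a commutative ring and, since the norm of a nonzero
  -- pair is invertible, as a field.
  ℂ-ring : CommutativeRing c ℓ₁
  ℂ-ring = record
    { Carrier = ℂ.Carrier ; _≈_ = ℂ._≈_ ; _+_ = ℂ._+_ ; _*_ = ℂ._*_ ; -_ = ℂ.-_ ; 0# = ℂ.0# ; 1# = ℂ.1#
    ; isCommutativeRing = record
      { isRing = record
        { +-isAbelianGroup = record
          { isGroup = record
            { isMonoid = record
              { isSemigroup = record
                { isMagma = record
                  { isEquivalence = record
                    { refl  = refl , refl
                    ; sym   = λ (p , q) → sym p , sym q
                    ; trans = λ (p , q) (p′ , q′) → trans p p′ , trans q q′ }
                  ; ∙-cong = λ (p , q) (p′ , q′) → +-cong p p′ , +-cong q q′ }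
                ; assoc = λ _ _ _ → +-assoc _ _ _ , +-assoc _ _ _ }
              ; identity = (λ _ → +-identityˡ _ , +-identityˡ _) , (λ _ → +-identityʳ _ , +-identityʳ _) }
            ; inverse = (λ _ → -‿inverseˡ _ , -‿inverseˡ _) , (λ _ → -‿inverseʳ _ , -‿inverseʳ _)
            ; ⁻¹-cong = λ (p , q) → -‿cong p , -‿cong q }
          ; comm = λ _ _ → +-comm _ _ , +-comm _ _ }
        ; *-cong = λ (p , q) (p′ , q′) →
            +-cong (*-cong p p′) (-‿cong (*-cong q q′)) , +-cong (*-cong p q′) (*-cong q p′)
        ; *-assoc = λ (a , b) (a′ , b′) (a″ , b″) →
            solve 6 (λ a b c d e f → (a :* c :- b :* d) :* e :- (a :* d :+ b :* c) :* f
                                  := a :* (c :* e :- d :* f) :- b :* (c :* f :+ d :* e)) refl a b a′ b′ a″ b″ ,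
            solve 6 (λ a b c d e f → (a :* c :- b :* d) :* f :+ (a :* d :+ b :* c) :* e
                                  := a :* (c :* f :+ d :* e) :+ b :* (c :* e :- d :* f)) refl a b a′ b′ a″ b″
        ; *-identity =
            (λ (a , b) →
              solve 2 (λ a b → :1 :* a :- :0 :* b := a) refl a b ,
              solve 2 (λ a b → :1 :* b :+ :0 :* a := b) refl a b) ,
            (λ (a , b) →
              solve 2 (λ a b → a :* :1 :- b :* :0 := a) refl a b ,
              solve 2 (λ a b → a :* :0 :+ b :* :1 := b) refl a b)
        ; distrib =
            (λ (a , b) (c , d) (e , f) →
              solve 6 (λ a b c d e f → a :* (c :+ e) :- b :* (d :+ f)
                                    := (a :* c :- b :* d) :+ (a :* e :- b :* f)) refl a b c d e f ,
              solve 6 (λ a b c d e f → a :* (d :+ f) :+ b :* (c :+ e)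
                                    := (a :* d :+ b :* c) :+ (a :* f :+ b :* e)) refl a b c d e f) ,
            (λ (a , b) (c , d) (e , f) →
              solve 6 (λ a b c d e f → (c :+ e) :* a :- (d :+ f) :* b
                                    := (c :* a :- d :* b) :+ (e :* a :- f :* b)) refl a b c d e f ,
              solve 6 (λ a b c d e f → (c :+ e) :* b :+ (d :+ f) :* a
                                    := (c :* b :+ d :* a) :+ (e :* b :+ f :* a)) refl a b c d e f)
        }
      ; *-comm = λ (a , b) (c , d) →
          solve 4 (λ a b c d → a :* c :- b :* d := c :* a :- d :* b) refl a b c d ,
          solve 4 (λ a b c d → a :* d :+ b :* c := c :* b :+ d :* a) refl a b c d
      }
    }

  private module ℂ-tools = RingTools ℂ-ring

  ℂ-ι : ∀ n → ℂ-tools.ι n ℂ.≈ (ι n , 0#)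
  ℂ-ι ℕ.zero    = refl , refl
  ℂ-ι (ℕ.suc n) = CommutativeRing.trans ℂ-ring (ℂ-tools.ι-suc n)
    (trans (+-congˡ (proj₁ (ℂ-ι n))) (sym (ι-suc n)) , trans (+-congˡ (proj₂ (ℂ-ι n))) (+-identityˡ _))

  norm≈0 : ∀ {a b} → a * a + b * b ≈ 0# → (a ≈ 0#) × (b ≈ 0#)
  norm≈0 {a} {b} e = square≈0 (NonNeg-+≈0 (square a) (square b) e) ,
                     square≈0 (NonNeg-+≈0 (square b) (square a) (trans (+-comm _ _) e))

  ℂ-field : Field₀ c ℓ₁
  ℂ-field = record
    { commutativeRing = ℂ-ring
    ; _≈?_    = λ (a , b) (c , d) → (a ≈? c) ×-dec (b ≈? d)
    ; inverse = λ (a , b) ≉0 → let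
        (i , ni≈1) = inverse (a * a + b * b) (λ e → ≉0 (norm≈0 e)) in
        (a * i , - (b * i)) ,
        trans (solve 3 (λ a b i → a :* (a :* i) :- b :* :- (b :* i) := (a :* a :+ b :* b) :* i) refl a b i) ni≈1 ,
        solve 3 (λ a b i → a :* :- (b :* i) :+ b :* (a :* i) := :0) refl a b i
    ; char₀   = λ n e → char₀ n (trans (sym (proj₁ (ℂ-ι (ℕ.suc n)))) (proj₁ e))
    }

-- Polynomials in a matrix

-- The action of a square matrix A on column vectors.
module Operators {c ℓ} (R : CommutativeRing c ℓ) {n} (A : Fin n → Fin n → CommutativeRing.Carrier R) where
  open CommutativeRing R hiding (zero)
  open RingTools R
  open Relation.Binary.Reasoning.Setoid setoid

  -- Equality of vectors.
  infix 4 _≋_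
  _≋_ : Vector Carrier n → Vector Carrier n → Set _
  v ≋ w = ∀ x → v x ≈ w x

  𝟎 : Vector Carrier n
  𝟎 _ = 0#

  -- The operator A.
  mul : Vector Carrier n → Vector Carrier n
  mul v x = sum (λ z → A x z * v z)

  -- The operator A - a.
  L : Carrier → Vector Carrier n → Vector Carrier n
  L a v x = mul v x - a * v x

  mul-cong : ∀ {v w} → v ≋ w → mul v ≋ mul w
  mul-cong v≋w x = sum-cong (λ z → *-congˡ (v≋w z))

  L-cong : ∀ a {v w} → v ≋ w → L a v ≋ L a w
  L-cong a v≋w x = +-cong (mul-cong v≋w x) (-‿cong (*-congˡ (v≋w x)))

  L-congˡ : ∀ {a b} → a ≈ b → ∀ v → L a v ≋ L b v
  L-congˡ a≈b v x = +-congˡ (-‿cong (*-congʳ a≈b))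

  mul-scale : ∀ a v → mul (λ z → a * v z) ≋ (λ x → a * mul v x)
  mul-scale a v x = begin
    sum (λ z → A x z * (a * v z))  ≈⟨ sum-cong (λ z → solve 3 (λ p q r → p :* (q :* r) := q :* (p :* r)) refl (A x z) a (v z)) ⟩
    sum (λ z → a * (A x z * v z))  ≈⟨ sym (*-distribˡ-sum a (λ z → A x z * v z)) ⟩
    a * mul v x                    ∎

  mul-sub : ∀ v w → mul (λ z → v z - w z) ≋ (λ x → mul v x - mul w x)
  mul-sub v w x = begin
    sum (λ z → A x z * (v z - w z))
      ≈⟨ sum-cong (λ z → solve 3 (λ p q r → p :* (q :- r) := p :* q :- p :* r) refl (A x z) (v z) (w z)) ⟩
    sum (λ z → A x z * v z - A x z * w z)
      ≈⟨ sum-sub (λ z → A x z * v z) (λ z → A x z * w z) ⟩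
    mul v x - mul w x ∎

  mul-L : ∀ a v → mul (L a v) ≋ L a (mul v)
  mul-L a v x = trans (mul-sub (mul v) (λ z → a * v z) x) (+-congˡ (-‿cong (mul-scale a v x)))

  L-comm : ∀ a b v → L a (L b v) ≋ L b (L a v)
  L-comm a b v x = begin
    mul (L b v) x - a * L b v x
      ≈⟨ +-congʳ (mul-L b v x) ⟩
    L b (mul v) x - a * L b v x
      ≈⟨ solve 5 (λ a b p q r → (p :- b :* q) :- a :* (q :- b :* r) := (p :- a :* q) :- b :* (q :- a :* r))
               refl a b (mul (mul v) x) (mul v x) (v x) ⟩
    L a (mul v) x - b * L a v x
      ≈⟨ +-congʳ (sym (mul-L a v x)) ⟩
    mul (L a v) x - b * L a v x ∎

  L-𝟎 : ∀ a {v} → v ≋ 𝟎 → L a v ≋ 𝟎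
  L-𝟎 a v≋𝟎 x = trans (L-cong a v≋𝟎 x) (begin
    mul 𝟎 x - a * 0#  ≈⟨ +-congʳ (sum-≈0 (λ z → A x z * 0#) (λ z → zeroʳ _)) ⟩
    0# - a * 0#       ≈⟨ solve 1 (λ a → :0 :- a :* :0 := :0) refl a ⟩
    0#                ∎)

  L-L : ∀ a b v → (λ x → L a v x - L b v x) ≋ (λ x → (b - a) * v x)
  L-L a b v x = solve 4 (λ a b p q → (p :- a :* q) :- (p :- b :* q) := (b :- a) :* q) refl a b (mul v x) (v x)

module _ {c ℓ} (F : Field₀ c ℓ) where
  open FieldTools F
  open Relation.Binary.Reasoning.Setoid setoid

  -- Any n + 1 vectors of length n are linearly dependent.
  dependent : ∀ n (V : Fin (ℕ.suc n) → Fin n → Carrier) →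
    Σ[ a ∈ (Fin (ℕ.suc n) → Carrier) ] (∃[ i ] ¬ (a i ≈ 0#)) × (∀ j → sum (λ i → a i * V i j) ≈ 0#)
  dependent ℕ.zero    V = (λ _ → 1#) , (zero , λ e → 0≉1 (sym e)) , λ ()
  dependent (ℕ.suc n) V with Fin.any? (λ j → ¬? (V zero j ≈? 0#))
  ... | no all≈0 = a , (zero , λ e → 0≉1 (sym e)) , λ j → begin
      1# * V zero j + sum (λ i → 0# * V (suc i) j)  ≈⟨ +-cong (trans (*-identityˡ _) (V₀≈0 j)) (sum-≈0 (λ i → 0# * V (suc i) j) (λ i → zeroˡ _)) ⟩
      0# + 0#                                       ≈⟨ +-identityˡ _ ⟩
      0#                                            ∎
    where
    a : Fin (ℕ.suc (ℕ.suc n)) → Carrier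
    a zero    = 1#
    a (suc i) = 0#

    V₀≈0 : ∀ j → V zero j ≈ 0#
    V₀≈0 j with V zero j ≈? 0#
    ... | yes e = e
    ... | no ≉0 = ⊥-elim (all≈0 (j , ≉0))
  ... | yes (j₀ , pivot) = a′ , (suc (proj₁ a≉0) , proj₂ a≉0) , vanish
    where
    -- Subtract multiples of the first vector from the others so as to clear
    -- the coordinate of the pivot.
    t : Fin (ℕ.suc n) → Carrier
    t k = V (suc k) j₀ * proj₁ (inverse _ pivot)

    U : Fin (ℕ.suc n) → Fin (ℕ.suc n) → Carrier
    U k j = V (suc k) j - t k * V zero j

    smaller = dependent n (λ k j → U k (punchIn j₀ j))
    a   = proj₁ smaller
    a≉0 = proj₁ (proj₂ smaller)

    a′ : Fin (ℕ.suc (ℕ.suc n)) → Carrier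
    a′ zero    = - sum (λ k → a k * t k)
    a′ (suc k) = a k

    reduce : ∀ j → sum (λ i → a′ i * V i j) ≈ sum (λ k → a k * U k j)
    reduce j = sym (begin
      sum (λ k → a k * U k j)
        ≈⟨ sum-cong (λ k → solve 4 (λ a v t w → a :* (v :- t :* w) := a :* v :- a :* t :* w) refl (a k) (V (suc k) j) (t k) (V zero j)) ⟩
      sum (λ k → a k * V (suc k) j - a k * t k * V zero j)
        ≈⟨ sum-sub (λ k → a k * V (suc k) j) (λ k → a k * t k * V zero j) ⟩
      sum (λ k → a k * V (suc k) j) - sum (λ k → a k * t k * V zero j)
        ≈⟨ +-congˡ (-‿cong (sym (*-distribʳ-sum (V zero j) (λ k → a k * t k)))) ⟩
      sum (λ k → a k * V (suc k) j) - sum (λ k → a k * t k) * V zero j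
        ≈⟨ solve 3 (λ p q r → p :- q :* r := :- q :* r :+ p) refl (sum (λ k → a k * V (suc k) j)) (sum (λ k → a k * t k)) (V zero j) ⟩
      - sum (λ k → a k * t k) * V zero j + sum (λ k → a k * V (suc k) j) ∎)

    U-pivot : ∀ k → U k j₀ ≈ 0#
    U-pivot k = begin
      V (suc k) j₀ - V (suc k) j₀ * proj₁ (inverse _ pivot) * V zero j₀
        ≈⟨ solve 3 (λ v i w → v :- v :* i :* w := v :* (:1 :- w :* i)) refl (V (suc k) j₀) (proj₁ (inverse _ pivot)) (V zero j₀) ⟩
      V (suc k) j₀ * (1# - V zero j₀ * proj₁ (inverse _ pivot))
        ≈⟨ *-congˡ (x≈y⇒x-y≈0 (sym (proj₂ (inverse _ pivot)))) ⟩
      V (suc k) j₀ * 0#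
        ≈⟨ zeroʳ _ ⟩
      0# ∎

    vanish : ∀ j → sum (λ i → a′ i * V i j) ≈ 0#
    vanish j with j₀ Fin.≟ j
    ... | yes ≡.refl = trans (reduce j) (sum-≈0 (λ k → a k * U k j) (λ k → trans (*-congˡ (U-pivot k)) (zeroʳ _)))
    ... | no j₀≢j = trans (reduce j) (trans
      (sum-cong (λ k → *-congˡ {x = a k} (reflexive (≡.cong (U k) (≡.sym (Fin.punchIn-punchOut j₀≢j))))))
      (proj₂ (proj₂ smaller) (punchOut j₀≢j)))

-- Polynomials in a matrix, over an algebraically closed field.
module Annihilation {c ℓ} (F : Field₀ c ℓ)
  (closed : AlgebraicallyClosed (CommutativeRing.rawRing (Field₀.commutativeRing F)))
  {n} (A : Fin n → Fin n → CommutativeRing.Carrier (Field₀.commutativeRing F)) where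
  open FieldTools F
  open Operators R A
  open Relation.Binary.Reasoning.Setoid setoid
  open Algebra.Definitions.RawSemiring (RawRing.rawSemiring rawRing) using (_^_)

  -- The value at z of the monic polynomial whose lower coefficients are a, in
  -- Horner form, and its value at A applied to a vector.
  horner : ∀ d → (Fin d → Carrier) → Carrier → Carrier
  horner ℕ.zero    a z = 1#
  horner (ℕ.suc d) a z = a zero + z * horner d (a ∘ suc) z

  eval : ∀ d → (Fin d → Carrier) → Vector Carrier n → Vector Carrier n
  eval ℕ.zero    a w x = w x
  eval (ℕ.suc d) a w x = a zero * w x + eval d (a ∘ suc) (mul w) x

  eval-cong : ∀ d a {v w} → v ≋ w → eval d a v ≋ eval d a w
  eval-cong ℕ.zero    a v≋w x = v≋w x
  eval-cong (ℕ.suc d) a v≋w x = +-cong (*-congˡ (v≋w x)) (eval-cong d (a ∘ suc) (mul-cong v≋w) x)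

  horner-sum : ∀ d a z → z ^ d + sum (λ i → a i * z ^ toℕ i) ≈ horner d a z
  horner-sum ℕ.zero    a z = +-identityʳ _
  horner-sum (ℕ.suc d) a z = begin
    z * z ^ d + (a zero * 1# + sum (λ i → a (suc i) * (z * z ^ toℕ i)))
      ≈⟨ +-congˡ (+-congˡ (sum-cong (λ i → solve 3 (λ a z y → a :* (z :* y) := z :* (a :* y)) refl (a (suc i)) z (z ^ toℕ i)))) ⟩
    z * z ^ d + (a zero * 1# + sum (λ i → z * (a (suc i) * z ^ toℕ i)))
      ≈⟨ +-congˡ (+-congˡ (sym (*-distribˡ-sum z (λ i → a (suc i) * z ^ toℕ i)))) ⟩
    z * z ^ d + (a zero * 1# + z * sum (λ i → a (suc i) * z ^ toℕ i))
      ≈⟨ solve 4 (λ z y a s → z :* y :+ (a :* :1 :+ z :* s) := a :+ z :* (y :+ s)) refl z (z ^ d) (a zero) (sum (λ i → a (suc i) * z ^ toℕ i)) ⟩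
    a zero + z * (z ^ d + sum (λ i → a (suc i) * z ^ toℕ i))
      ≈⟨ +-congˡ (*-congˡ (horner-sum d (a ∘ suc) z)) ⟩
    a zero + z * horner d (a ∘ suc) z ∎

  -- The constant polynomial 1, of degree 0, is the only one without a root.
  root : ∀ d a → ∃[ z ] horner (ℕ.suc d) a z ≈ 0#
  root d a with z , e ← closed d a = z , trans (sym (horner-sum (ℕ.suc d) a z)) e

  -- The quotient of a monic polynomial by X - z.
  quotient : ∀ d → (Fin (ℕ.suc d) → Carrier) → Carrier → Fin d → Carrier
  quotient (ℕ.suc d) a z zero    = horner (ℕ.suc d) (a ∘ suc) z
  quotient (ℕ.suc d) a z (suc i) = quotient d (a ∘ suc) z i

  division : ∀ d a z w → eval (ℕ.suc d) a w ≋ (λ x → eval d (quotient d a z) (L z w) x + horner (ℕ.suc d) a z * w x)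
  division ℕ.zero a z w x =
    solve 4 (λ a z m v → a :* v :+ m := (m :- z :* v) :+ (a :+ z :* :1) :* v) refl (a zero) z (mul w x) (w x)
  division (ℕ.suc d) a z w x = begin
    a zero * w x + eval (ℕ.suc d) a′ (mul w) x
      ≈⟨ +-congˡ (division d a′ z (mul w) x) ⟩
    a zero * w x + (eval d q (L z (mul w)) x + h * mul w x)
      ≈⟨ +-congˡ (+-congʳ (eval-cong d q (λ y → sym (mul-L z w y)) x)) ⟩
    a zero * w x + (eval d q (mul (L z w)) x + h * mul w x)
      ≈⟨ solve 6 (λ a v e h m z → a :* v :+ (e :+ h :* m) := (h :* (m :- z :* v) :+ e) :+ (a :+ z :* h) :* v)
           refl (a zero) (w x) (eval d q (mul (L z w)) x) h (mul w x) z ⟩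
    (h * L z w x + eval d q (mul (L z w)) x) + (a zero + z * h) * w x ∎
    where
    a′ = a ∘ suc
    q  = quotient d a′ z
    h  = horner (ℕ.suc d) a′ z

  -- The powers of A.
  iterate : ∀ {m} → Fin m → Vector Carrier n → Vector Carrier n
  iterate zero    w = w
  iterate (suc i) w = iterate i (mul w)

  -- A nontrivial combination of the powers of A is a nonzero multiple of a
  -- monic polynomial in A.
  normalise : ∀ m (b : Fin m → Carrier) → (∀ i → b i ≈ 0#) ⊎
    (∃[ t ] ¬ (t ≈ 0#) × (∃[ d ] Σ[ a ∈ (Fin d → Carrier) ]
      (∀ w x → sum (λ i → b i * iterate i w x) ≈ t * eval d a w x)))
  normalise ℕ.zero    b = inj₁ λ ()
  normalise (ℕ.suc m) b with normalise m (b ∘ suc) | b zero ≈? 0#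
  ... | inj₁ b≈0 | yes b₀≈0 = inj₁ λ { zero → b₀≈0 ; (suc i) → b≈0 i }
  ... | inj₁ b≈0 | no  b₀≉0 = inj₂ (b zero , b₀≉0 , 0 , (λ ()) , λ w x →
    trans (+-congˡ (sum-≈0 (λ i → b (suc i) * iterate (suc i) w x) (λ i → trans (*-congʳ (b≈0 i)) (zeroˡ _)))) (+-identityʳ _))
  ... | inj₂ (t , t≉0 , d , a , e) | _ = inj₂ (t , t≉0 , ℕ.suc d , a′ , λ w x → begin
      b zero * w x + sum (λ i → b (suc i) * iterate i (mul w) x)
        ≈⟨ +-cong (*-congʳ (sym (trans (solve 3 (λ t i b → t :* (i :* b) := t :* i :* b) refl t t⁻¹ (b zero))
                                       (trans (*-congʳ (proj₂ (inverse t t≉0))) (*-identityˡ _))))) (e (mul w) x) ⟩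
      t * (t⁻¹ * b zero) * w x + t * eval d a (mul w) x
        ≈⟨ solve 4 (λ t b w e → t :* b :* w :+ t :* e := t :* (b :* w :+ e)) refl t (t⁻¹ * b zero) (w x) (eval d a (mul w) x) ⟩
      t * (t⁻¹ * b zero * w x + eval d a (mul w) x) ∎)
    where
    t⁻¹ = proj₁ (inverse t t≉0)
    a′ : Fin (ℕ.suc d) → Carrier
    a′ zero    = t⁻¹ * b zero
    a′ (suc i) = a i

  -- Every vector is killed by some monic polynomial in A.
  killed : ∀ w → ∃[ d ] Σ[ a ∈ (Fin d → Carrier) ] eval d a w ≋ 𝟎
  killed w with b , (i , bᵢ≉0) , e ← dependent F n (λ i → iterate i w) with normalise (ℕ.suc n) b
  ... | inj₁ b≈0 = ⊥-elim (bᵢ≉0 (b≈0 i))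
  ... | inj₂ (t , t≉0 , d , a , f) = d , a , λ x → x*y≈0⇒y≈0 t≉0 (trans (sym (f w x)) (e x))

  -- A matrix whose eigenvalues are all among a, b, c and have no generalised
  -- eigenvectors other than eigenvectors satisfies the cubic equation with
  -- these roots.
  module _ (a b c : Carrier)
    (eigenvalues : ∀ z v → ¬ (v ≋ 𝟎) → L z v ≋ 𝟎 → (z ≈ a) ⊎ (z ≈ b) ⊎ (z ≈ c))
    (semisimple : ∀ z → (z ≈ a) ⊎ (z ≈ b) ⊎ (z ≈ c) → ∀ v → L z (L z v) ≋ 𝟎 → L z v ≋ 𝟎) where

    private
      P : Vector Carrier n → Vector Carrier n
      P w = L a (L b (L c w))

      P-L : ∀ z w → P (L z w) ≋ L z (P w)
      P-L z w x = begin
        L a (L b (L c (L z w))) x  ≈⟨ L-cong a (L-cong b (L-comm c z w)) x ⟩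
        L a (L b (L z (L c w))) x  ≈⟨ L-cong a (L-comm b z (L c w)) x ⟩
        L a (L z (L b (L c w))) x  ≈⟨ L-comm a z (L b (L c w)) x ⟩
        L z (P w) x                ∎

      -- The factor of P that belongs to z may be moved to the front, where it
      -- meets a second copy of itself.
      split : ∀ z w → L z (P w) ≋ 𝟎 → (z ≈ a) ⊎ (z ≈ b) ⊎ (z ≈ c) → P w ≋ 𝟎
      split z w e (inj₁ z≈a) x = trans (L-congˡ (sym z≈a) u x) (semisimple z (inj₁ z≈a) u
          (λ y → trans (L-cong z (L-congˡ z≈a u) y) (e y)) x)
        where u = L b (L c w)
      split z w e (inj₂ (inj₁ z≈b)) x = trans (swap x) (trans (L-congˡ (sym z≈b) u x) (semisimple z (inj₂ (inj₁ z≈b)) u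
          (λ y → trans (L-cong z (λ y → trans (L-congˡ z≈b u y) (sym (swap y))) y) (e y)) x))
        where
        u = L a (L c w)
        swap : P w ≋ L b u
        swap = L-comm a b (L c w)
      split z w e (inj₂ (inj₂ z≈c)) x = trans (swap x) (trans (L-congˡ (sym z≈c) u x) (semisimple z (inj₂ (inj₂ z≈c)) u
          (λ y → trans (L-cong z (λ y → trans (L-congˡ z≈c u y) (sym (swap y))) y) (e y)) x))
        where
        u = L a (L b w)
        swap : P w ≋ L c u
        swap y = trans (L-cong a (L-comm b c w) y) (L-comm a c (L b w) y)

      -- If a monic polynomial in A kills w, then P kills w: by induction, with z
      -- a root of the polynomial, P kills (A - z) w, so that P w is either zero
      -- or an eigenvector for z.
      kill : ∀ d g w → eval d g w ≋ 𝟎 → P w ≋ 𝟎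
      kill ℕ.zero    g w e = L-𝟎 a (L-𝟎 b (L-𝟎 c e))
      kill (ℕ.suc d) g w e with root d g
      ... | z , r with Fin.all? (λ x → P w x ≈? 0#)
      ...   | yes P≋0 = P≋0
      ...   | no  P≉0 = split z w Lz (eigenvalues z (P w) P≉0 Lz)
        where
        Lz : L z (P w) ≋ 𝟎
        Lz x = trans (sym (P-L z w x)) (kill d (quotient d g z) (L z w) (λ y → begin
          eval d (quotient d g z) (L z w) y
            ≈⟨ solve 2 (λ e v → e := e :+ :0 :* v) refl (eval d (quotient d g z) (L z w) y) (w y) ⟩
          eval d (quotient d g z) (L z w) y + 0# * w y
            ≈⟨ +-congˡ (*-congʳ (sym r)) ⟩
          eval d (quotient d g z) (L z w) y + horner (ℕ.suc d) g z * w y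
            ≈⟨ sym (division d g z w y) ⟩
          eval (ℕ.suc d) g w y
            ≈⟨ e y ⟩
          0# ∎) x)

    annihilated : ∀ w → L a (L b (L c w)) ≋ 𝟎
    annihilated w with d , g , e ← killed w = kill d g w e

-- Perron-Frobenius theory for a connected graph

-- The adjacency matrix of a graph over an ordered field.
module PerronFrobenius {c ℓ₁ ℓ₂} (O : OrderedField c ℓ₁ ℓ₂) {n} (Γ : Graph n) where
  open Graph Γ
  open OrderedTools O
  open FieldTools field₀
  open Relation.Binary.Reasoning.Setoid setoid

  A : Fin n → Fin n → Carrier
  A x y = [ adjacent? x y ]

  A-sym : ∀ x y → A x y ≈ A y x
  A-sym x y = []-cong (symmetric x y)

  open Operators R A

  A-NonNeg : ∀ x y → NonNeg (A x y)
  A-NonNeg x y with adjacent? x y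
  ... | true  = inj₁ 1-pos
  ... | false = inj₂ refl

  -- The inner product.
  infix 7 _·_
  _·_ : Vector Carrier n → Vector Carrier n → Carrier
  u · v = sum (λ x → u x * v x)

  ·-cong : ∀ {u u′ v v′} → u ≋ u′ → v ≋ v′ → u · v ≈ u′ · v′
  ·-cong p q = sum-cong (λ x → *-cong (p x) (q x))

  ·-scale : ∀ r u v → u · (λ x → r * v x) ≈ r * (u · v)
  ·-scale r u v = begin
    sum (λ x → u x * (r * v x))  ≈⟨ sum-cong (λ x → solve 3 (λ u r v → u :* (r :* v) := r :* (u :* v)) refl (u x) r (v x)) ⟩
    sum (λ x → r * (u x * v x))  ≈⟨ sym (*-distribˡ-sum r (λ x → u x * v x)) ⟩
    r * (u · v)                  ∎

  ·-sub : ∀ u v w → u · (λ x → v x - w x) ≈ u · v - u · w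
  ·-sub u v w = begin
    sum (λ x → u x * (v x - w x))        ≈⟨ sum-cong (λ x → solve 3 (λ u v w → u :* (v :- w) := u :* v :- u :* w) refl (u x) (v x) (w x)) ⟩
    sum (λ x → u x * v x - u x * w x)    ≈⟨ sum-sub (λ x → u x * v x) (λ x → u x * w x) ⟩
    u · v - u · w                        ∎

  ·-comm : ∀ u v → u · v ≈ v · u
  ·-comm u v = sum-cong (λ x → *-comm (u x) (v x))

  ·-mul : ∀ u v → u · mul v ≈ mul u · v
  ·-mul u v = begin
    sum (λ x → u x * sum (λ z → A x z * v z))
      ≈⟨ sum-cong (λ x → *-distribˡ-sum (u x) (λ z → A x z * v z)) ⟩
    sum (λ x → sum (λ z → u x * (A x z * v z)))
      ≈⟨ ∑-comm (λ x z → u x * (A x z * v z)) ⟩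
    sum (λ z → sum (λ x → u x * (A x z * v z)))
      ≈⟨ sum-cong (λ z → sum-cong (λ x → trans (*-congˡ {x = u x} (*-congʳ (A-sym x z)))
           (solve 3 (λ u a v → u :* (a :* v) := a :* u :* v) refl (u x) (A z x) (v z)))) ⟩
    sum (λ z → sum (λ x → A z x * u x * v z))
      ≈⟨ sum-cong (λ z → sym (*-distribʳ-sum (v z) (λ x → A z x * u x))) ⟩
    mul u · v ∎

  ·-L : ∀ a u v → u · L a v ≈ L a u · v
  ·-L a u v = begin
    u · L a v                        ≈⟨ ·-sub u (mul v) (λ x → a * v x) ⟩
    u · mul v - u · (λ x → a * v x)  ≈⟨ +-cong (trans (·-mul u v) (·-comm (mul u) v)) (-‿cong (trans (·-scale a u v) (trans (*-congˡ (·-comm u v)) (sym (·-scale a v u))))) ⟩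
    v · mul u - v · (λ x → a * u x)  ≈⟨ sym (·-sub v (mul u) (λ x → a * u x)) ⟩
    v · L a u                        ≈⟨ ·-comm v (L a u) ⟩
    L a u · v                        ∎

  ·-𝟎 : ∀ u {v} → v ≋ 𝟎 → u · v ≈ 0#
  ·-𝟎 u {v} e = sum-≈0 (λ x → u x * v x) (λ x → trans (*-congˡ (e x)) (zeroʳ _))

  ·-NonNeg : ∀ u → NonNeg (u · u)
  ·-NonNeg u = sum-NonNeg (λ x → u x * u x) (λ x → square (u x))

  ·-definite : ∀ {u} → u · u ≈ 0# → u ≋ 𝟎
  ·-definite {u} e x = square≈0 (sum-NonNeg≈0 (λ x → u x * u x) (λ x → square (u x)) e x)

  -- The inner product of L a v with itself is that of v with L a (L a v).
  L-semisimple : ∀ a v → L a (L a v) ≋ 𝟎 → L a v ≋ 𝟎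
  L-semisimple a v e = ·-definite (trans (sym (·-L a v (L a v))) (·-𝟎 v e))

  L-scale : ∀ a r v → L a (λ x → r * v x) ≋ (λ x → r * L a v x)
  L-scale a r v x = trans (+-congʳ (mul-scale r v x))
    (solve 4 (λ r m a v → r :* m :- a :* (r :* v) := r :* (m :- a :* v)) refl r (mul v x) a (v x))

  L-sub : ∀ a v w → L a (λ x → v x - w x) ≋ (λ x → L a v x - L a w x)
  L-sub a v w x = trans (+-congʳ (mul-sub v w x))
    (solve 5 (λ m k a v w → (m :- k) :- a :* (v :- w) := (m :- a :* v) :- (k :- a :* w)) refl (mul v x) (mul w x) a (v x) (w x))

  L-eigen : ∀ {t} s {v} → L t v ≋ 𝟎 → L s v ≋ (λ x → (t - s) * v x)
  L-eigen {t} s {v} e x = begin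
    L s v x              ≈⟨ solve 2 (λ p q → p := (p :- q) :+ q) refl (L s v x) (L t v x) ⟩
    L s v x - L t v x + L t v x  ≈⟨ +-cong (L-L s t v x) (e x) ⟩
    (t - s) * v x + 0#   ≈⟨ +-identityʳ _ ⟩
    (t - s) * v x        ∎

  L-L-eigen : ∀ {t} r s {v} → L t v ≋ 𝟎 → L r (L s v) ≋ (λ x → (t - r) * (t - s) * v x)
  L-L-eigen {t} r s {v} e x = begin
    L r (L s v) x                  ≈⟨ L-cong r (L-eigen s e) x ⟩
    L r (λ x → (t - s) * v x) x    ≈⟨ L-scale r (t - s) v x ⟩
    (t - s) * L r v x              ≈⟨ *-congˡ (L-eigen r e x) ⟩
    (t - s) * ((t - r) * v x)      ≈⟨ solve 3 (λ p q v → p :* (q :* v) := q :* p :* v) refl (t - s) (t - r) (v x) ⟩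
    (t - r) * (t - s) * v x        ∎

  degree : Fin n → Carrier
  degree x = sum (A x)

  -- Let (A - a)(A - b)(A - c) = 0 with a the largest of three distinct roots.
  module PositiveEigenvector (connected : Connected) (a b c : Carrier)
    (a>b : Pos (a - b)) (a>c : Pos (a - c)) (b≉c : ¬ (b ≈ c))
    (annihilated : ∀ w → L a (L b (L c w)) ≋ 𝟎) where

    private
      b-c≉0 : ¬ (b - c ≈ 0#)
      b-c≉0 e = b≉c (x-y≈0⇒x≈y e)

    -- The operator a - A is positive semidefinite, and a vector on which its
    -- quadratic form is not positive lies in its kernel.  Up to scalars, the
    -- vectors u and v below are the components of y in the eigenspaces for b
    -- and c; their norms express the quadratic form at y.  The form is doubled
    -- in the hypothesis to avoid a division by two.
    semidefinite : ∀ y → NonNeg ((y · L a y) + (y · L a y)) → L a y ≋ 𝟎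
    semidefinite y q≥0 x = x*y≈0⇒y≈0 b-c≉0 (begin
        (b - c) * L a y x  ≈⟨ sym (difference x) ⟩
        u x - v x          ≈⟨ +-cong (u≋0 x) (-‿cong (v≋0 x)) ⟩
        0# - 0#            ≈⟨ -‿inverseʳ 0# ⟩
        0#                 ∎)
      where
      u = L a (L c y)
      v = L a (L b y)

      Lb-u : L b u ≋ 𝟎
      Lb-u x = trans (L-comm b a (L c y) x) (annihilated y x)

      Lc-v : L c v ≋ 𝟎
      Lc-v x = trans (L-comm c a (L b y) x) (trans (L-cong a (L-comm c b y) x) (annihilated y x))

      difference : (λ x → u x - v x) ≋ (λ x → (b - c) * L a y x)
      difference x = begin
        u x - v x                            ≈⟨ sym (L-sub a (L c y) (L b y) x) ⟩
        L a (λ x → L c y x - L b y x) x      ≈⟨ L-cong a (L-L c b y) x ⟩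
        L a (λ x → (b - c) * y x) x          ≈⟨ L-scale a (b - c) y x ⟩
        (b - c) * L a y x                    ∎

      norm : ∀ {t} s {w z} → z ≋ L a (L s w) → L t z ≋ 𝟎 → z · z ≈ (t - s) * (t - a) * (w · z)
      norm {t} s {w} {z} e k = begin
        z · z                       ≈⟨ ·-cong e (λ _ → refl) ⟩
        L a (L s w) · z             ≈⟨ sym (·-L a (L s w) z) ⟩
        L s w · L a z               ≈⟨ sym (·-L s w (L a z)) ⟩
        w · L s (L a z)             ≈⟨ ·-cong {u = w} (λ _ → refl) (L-L-eigen s a k) ⟩
        w · (λ x → (t - s) * (t - a) * z x) ≈⟨ ·-scale _ w z ⟩
        (t - s) * (t - a) * (w · z) ∎

      uu = norm c {y} {u} (λ _ → refl) Lb-u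
      vv = norm b {y} {v} (λ _ → refl) Lc-v

      q = y · L a y
      X = (a - c) * (u · u) + (a - b) * (v · v)

      q-eq : y · u - y · v ≈ (b - c) * q
      q-eq = trans (sym (·-sub y u v)) (trans (·-cong {u = y} (λ _ → refl) difference) (·-scale (b - c) y (L a y)))

      X-eq : X ≈ - ((a - c) * (a - b) * ((b - c) * (b - c)) * q)
      X-eq = begin
        (a - c) * (u · u) + (a - b) * (v · v)
          ≈⟨ +-cong (*-congˡ uu) (*-congˡ vv) ⟩
        (a - c) * ((b - c) * (b - a) * (y · u)) + (a - b) * ((c - b) * (c - a) * (y · v))
          ≈⟨ solve 5 (λ a b c p q → (a :- c) :* ((b :- c) :* (b :- a) :* p) :+ (a :- b) :* ((c :- b) :* (c :- a) :* q)
                                 := :- ((a :- c) :* (a :- b) :* ((b :- c) :* (p :- q)))) refl a b c (y · u) (y · v) ⟩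
        - ((a - c) * (a - b) * ((b - c) * (y · u - y · v)))
          ≈⟨ -‿cong (*-congˡ (*-congˡ q-eq)) ⟩
        - ((a - c) * (a - b) * ((b - c) * ((b - c) * q)))
          ≈⟨ solve 5 (λ p q r s t → :- (p :* q :* (r :* (s :* t))) := :- (p :* q :* (r :* s) :* t)) refl (a - c) (a - b) (b - c) (b - c) q ⟩
        - ((a - c) * (a - b) * ((b - c) * (b - c)) * q) ∎

      X≥0 : NonNeg X
      X≥0 = NonNeg-+ (NonNeg-* (inj₁ a>c) (·-NonNeg u)) (NonNeg-* (inj₁ a>b) (·-NonNeg v))

      X≈0 : X ≈ 0#
      X≈0 = NonNeg-antisym X≥0 (NonNeg-resp (begin
          X + (a - c) * (a - b) * ((b - c) * (b - c)) * (q + q)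
            ≈⟨ solve 3 (λ x r q → x :+ r :* (q :+ q) := x :- (:- (r :* q) :+ :- (r :* q))) refl X ((a - c) * (a - b) * ((b - c) * (b - c))) q ⟩
          X - (- ((a - c) * (a - b) * ((b - c) * (b - c)) * q) + - ((a - c) * (a - b) * ((b - c) * (b - c)) * q))
            ≈⟨ +-congˡ (-‿cong (+-cong (sym X-eq) (sym X-eq))) ⟩
          X - (X + X)
            ≈⟨ solve 1 (λ x → x :- (x :+ x) := :- x) refl X ⟩
          - X ∎)
        (NonNeg-+ X≥0 (NonNeg-* (NonNeg-* (NonNeg-* (inj₁ a>c) (inj₁ a>b)) (square (b - c))) q≥0)))

      u≋0 : u ≋ 𝟎
      u≋0 = ·-definite (x*y≈0⇒y≈0 (Pos⇒≉0 a>c)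
        (NonNeg-+≈0 (NonNeg-* (inj₁ a>c) (·-NonNeg u)) (NonNeg-* (inj₁ a>b) (·-NonNeg v)) X≈0))

      v≋0 : v ≋ 𝟎
      v≋0 = ·-definite (x*y≈0⇒y≈0 (Pos⇒≉0 a>b)
        (NonNeg-+≈0 (NonNeg-* (inj₁ a>b) (·-NonNeg v)) (NonNeg-* (inj₁ a>c) (·-NonNeg u)) (trans (+-comm _ _) X≈0)))

    -- As A has no negative entries, passing to absolute values does not
    -- decrease the quadratic form of A.
    abs-eigen : ∀ v → L a v ≋ 𝟎 → L a (abs ∘ v) ≋ 𝟎
    abs-eigen v e = semidefinite y (NonNeg-resp (+-cong (sym q-eq) (sym q-eq)) (NonNeg-resp
        (trans (sum-cong (λ x → trans (sum-cong (λ z → distribˡ (A x z) (t x z) (t x z))) (∑-distrib-+ (λ z → A x z * t x z) (λ z → A x z * t x z))))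
          (∑-distrib-+ (λ x → sum (λ z → A x z * t x z)) (λ x → sum (λ z → A x z * t x z))))
        (sum-NonNeg (λ x → sum (λ z → A x z * (t x z + t x z))) (λ x →
          sum-NonNeg (λ z → A x z * (t x z + t x z)) (λ z → NonNeg-* (A-NonNeg x z) (abs-*-bound (v x) (v z)))))))
      where
      y = abs ∘ v

      t : Fin n → Fin n → Carrier
      t x z = y x * y z - v x * v z

      q-eq : y · L a y ≈ sum (λ x → sum (λ z → A x z * t x z))
      q-eq = begin
        y · L a y
          ≈⟨ solve 1 (λ q → q := q :- :0) refl (y · L a y) ⟩
        y · L a y - 0#
          ≈⟨ +-congˡ (-‿cong (sym (·-𝟎 v e))) ⟩
        y · L a y - v · L a v
          ≈⟨ sym (sum-sub (λ x → y x * L a y x) (λ x → v x * L a v x)) ⟩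
        sum (λ x → y x * L a y x - v x * L a v x)
          ≈⟨ sum-cong (λ x → trans
               (solve 5 (λ y m v k a → y :* (m :- a :* y) :- v :* (k :- a :* v) := (y :* m :- v :* k) :- a :* (y :* y :- v :* v))
                  refl (y x) (mul y x) (v x) (mul v x) a)
               (trans (+-congˡ (-‿cong (trans (*-congˡ (x≈y⇒x-y≈0 (abs-square (v x)))) (zeroʳ a))))
                 (solve 1 (λ q → q :- :0 := q) refl (y x * mul y x - v x * mul v x)))) ⟩
        sum (λ x → y x * mul y x - v x * mul v x)
          ≈⟨ sum-cong (λ x → +-cong (*-distribˡ-sum (y x) (λ z → A x z * y z)) (-‿cong (*-distribˡ-sum (v x) (λ z → A x z * v z)))) ⟩
        sum (λ x → sum (λ z → y x * (A x z * y z)) - sum (λ z → v x * (A x z * v z)))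
          ≈⟨ sum-cong (λ x → trans (sym (sum-sub (λ z → y x * (A x z * y z)) (λ z → v x * (A x z * v z))))
               (sum-cong (λ z → solve 5 (λ y y′ v v′ a → y :* (a :* y′) :- v :* (a :* v′) := a :* (y :* y′ :- v :* v′))
                  refl (y x) (y z) (v x) (v z) (A x z)))) ⟩
        sum (λ x → sum (λ z → A x z * t x z)) ∎

    -- Zeros of a nonnegative eigenvector spread along edges.
    spread : ∀ {y} → (∀ x → NonNeg (y x)) → L a y ≋ 𝟎 → ∀ {x z} → Star Adjacent x z → y x ≈ 0# → y z ≈ 0#
    spread y≥0 e ε yx≈0 = yx≈0
    spread {y} y≥0 e {x} (_◅_ {j = w} x~w path) yx≈0 = spread y≥0 e path (begin
        y w          ≈⟨ sym (*-identityˡ (y w)) ⟩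
        1# * y w     ≈⟨ *-congʳ ([]-cong (≡.sym x~w)) ⟩
        A x w * y w  ≈⟨ sum-NonNeg≈0 (λ z → A x z * y z) (λ z → NonNeg-* (A-NonNeg x z) (y≥0 z)) sum≈0 w ⟩
        0#           ∎)
      where
      sum≈0 : mul y x ≈ 0#
      sum≈0 = trans (x-y≈0⇒x≈y (e x)) (trans (*-congˡ yx≈0) (zeroʳ a))

    nowhere-zero : ∀ u → L a u ≋ 𝟎 → ∀ x → u x ≈ 0# → u ≋ 𝟎
    nowhere-zero u e x ux≈0 z = square≈0 (begin
        u z * u z              ≈⟨ sym (abs-square (u z)) ⟩
        abs (u z) * abs (u z)  ≈⟨ *-congʳ abs≈0 ⟩
        0# * abs (u z)         ≈⟨ zeroˡ _ ⟩
        0#                     ∎)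
      where
      abs≈0 : abs (u z) ≈ 0#
      abs≈0 = spread (λ x → abs-NonNeg (u x)) (abs-eigen u e) (connected x z)
        (square≈0 (trans (abs-square (u x)) (trans (*-congʳ ux≈0) (zeroˡ _))))

    -- The matrix (A - b)(A - c), whose columns are eigenvectors for a.  The
    -- first argument is the column.
    N : Fin n → Fin n → Carrier
    N w = L b (L c (λ z → δ z w))

    N-entry : ∀ x w → N w x ≈ sum (λ z → A x z * A z w) - (b + c) * A x w + b * c * δ x w
    N-entry x w = begin
      L b (L c e) x
        ≈⟨ L-cong b Lce x ⟩
      mul (λ z → A z w - c * δ z w) x - b * (A x w - c * δ x w)
        ≈⟨ +-congʳ (trans (mul-sub (λ z → A z w) (λ z → c * δ z w) x)
             (+-congˡ (-‿cong (trans (mul-scale c e x) (*-congˡ (sum-δʳ w (A x))))))) ⟩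
      (sum (λ z → A x z * A z w) - c * A x w) - b * (A x w - c * δ x w)
        ≈⟨ solve 5 (λ s b c a d → (s :- c :* a) :- b :* (a :- c :* d) := s :- (b :+ c) :* a :+ b :* c :* d)
             refl (sum (λ z → A x z * A z w)) b c (A x w) (δ x w) ⟩
      sum (λ z → A x z * A z w) - (b + c) * A x w + b * c * δ x w ∎
      where
      e = λ z → δ z w
      Lce : L c e ≋ (λ z → A z w - c * δ z w)
      Lce z = +-congʳ (sum-δʳ w (A z))

    N-sym : ∀ x w → N w x ≈ N x w
    N-sym x w = begin
      N w x
        ≈⟨ N-entry x w ⟩
      sum (λ z → A x z * A z w) - (b + c) * A x w + b * c * δ x w
        ≈⟨ +-cong (+-cong (sum-cong (λ z → trans (*-comm _ _) (*-cong (A-sym z w) (A-sym x z)))) (-‿cong (*-congˡ (A-sym x w)))) (*-congˡ (δ-sym x w)) ⟩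
      sum (λ z → A w z * A z x) - (b + c) * A w x + b * c * δ w x
        ≈⟨ sym (N-entry w x) ⟩
      N x w ∎

    -- From here on v is an eigenvector for a.
    module _ (v : Vector Carrier n) (v≉0 : ¬ (v ≋ 𝟎)) (v-eigen : L a v ≋ 𝟎) where

      -- The Perron eigenvector.
      y : Vector Carrier n
      y = abs ∘ v

      y-eigen : L a y ≋ 𝟎
      y-eigen = abs-eigen v v-eigen

      y-pos : ∀ x → Pos (y x)
      y-pos x with abs-NonNeg (v x)
      ... | inj₁ p = p
      ... | inj₂ e = ⊥-elim (v≉0 (nowhere-zero v v-eigen x
                       (square≈0 (trans (sym (abs-square (v x))) (trans (*-congʳ e) (zeroˡ _))))))

      -- The combination of two eigenvectors that vanishes at o is zero.
      N-proportional : ∀ w x o → N w x * y o ≈ N w o * y x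
      N-proportional w x o = x-y≈0⇒x≈y (trans
          (solve 4 (λ a b c d → a :* b :- c :* d := b :* a :- c :* d) refl (N w x) (y o) (N w o) (y x))
          (nowhere-zero u u-eigen o (solve 2 (λ a b → a :* b :- b :* a := :0) refl (y o) (N w o)) x))
        where
        u : Vector Carrier n
        u x = y o * N w x - N w o * y x

        u-eigen : L a u ≋ 𝟎
        u-eigen x = begin
          L a u x
            ≈⟨ L-sub a (λ x → y o * N w x) (λ x → N w o * y x) x ⟩
          L a (λ x → y o * N w x) x - L a (λ x → N w o * y x) x
            ≈⟨ +-cong (L-scale a (y o) (N w) x) (-‿cong (L-scale a (N w o) y x)) ⟩
          y o * L a (N w) x - N w o * L a y x
            ≈⟨ +-cong (*-congˡ (annihilated (λ z → δ z w) x)) (-‿cong (*-congˡ (y-eigen x))) ⟩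
          y o * 0# - N w o * 0#
            ≈⟨ solve 2 (λ p q → p :* :0 :- q :* :0 := :0) refl (y o) (N w o) ⟩
          0# ∎

      module _ (o : Fin n) where

        private
          i = proj₁ (inverse (y o) (Pos⇒≉0 (y-pos o)))
          yi≈1 = proj₂ (inverse (y o) (Pos⇒≉0 (y-pos o)))

        -- N is κ times the matrix y yᵀ.
        κ : Carrier
        κ = N o o * (i * i)

        N-rank-one : ∀ x w → N w x ≈ κ * (y x * y w)
        N-rank-one x w = begin
          N w x
            ≈⟨ solve 1 (λ m → m := m :* (:1 :* :1)) refl (N w x) ⟩
          N w x * (1# * 1#)
            ≈⟨ *-congˡ (*-cong (sym yi≈1) (sym yi≈1)) ⟩
          N w x * (y o * i * (y o * i))
            ≈⟨ solve 3 (λ m y i → m :* (y :* i :* (y :* i)) := m :* y :* (i :* (y :* i))) refl (N w x) (y o) i ⟩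
          N w x * y o * (i * (y o * i))
            ≈⟨ *-congʳ (trans (N-proportional w x o) (*-congʳ (N-sym o w))) ⟩
          N o w * y x * (i * (y o * i))
            ≈⟨ solve 4 (λ m y i x → m :* x :* (i :* (y :* i)) := m :* y :* (x :* (i :* i))) refl (N o w) (y o) i (y x) ⟩
          N o w * y o * (y x * (i * i))
            ≈⟨ *-congʳ (N-proportional o w o) ⟩
          N o o * y w * (y x * (i * i))
            ≈⟨ solve 4 (λ m w x i → m :* w :* (x :* i) := m :* i :* (x :* w)) refl (N o o) (y w) (y x) (i * i) ⟩
          κ * (y x * y w) ∎

        -- Compare the entries at o in N y = (a - c)(a - b) y.
        κ≉0 : ¬ (κ ≈ 0#)
        κ≉0 κ≈0 = *-≉0 (*-≉0 (Pos⇒≉0 a>c) (Pos⇒≉0 a>b)) (Pos⇒≉0 (y-pos o)) (begin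
          (a - c) * (a - b) * y o
            ≈⟨ *-congˡ (sym (sum-δʳ o y)) ⟩
          (a - c) * (a - b) * (y · e)
            ≈⟨ trans (*-congˡ (·-comm y e)) (sym (·-scale ((a - c) * (a - b)) e y)) ⟩
          e · (λ x → (a - c) * (a - b) * y x)
            ≈⟨ ·-cong {u = e} (λ _ → refl) (λ x → sym (L-L-eigen c b y-eigen x)) ⟩
          e · L c (L b y)
            ≈⟨ trans (·-L c e (L b y)) (·-L b (L c e) y) ⟩
          N o · y
            ≈⟨ trans (·-comm (N o) y) (·-𝟎 y (λ x → trans (N-rank-one x o) (trans (*-congʳ κ≈0) (zeroˡ _)))) ⟩
          0# ∎)
          where e = λ z → δ z o

        y-equation : ∀ x w → sum (λ z → A x z * A z w) - (b + c) * A x w + b * c * δ x w ≈ κ * (y x * y w)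
        y-equation x w = trans (sym (N-entry x w)) (N-rank-one x w)

        -- The diagonal of the equation.
        degree-y : ∀ x → degree x + b * c ≈ κ * (y x * y x)
        degree-y x = begin
          degree x + b * c
            ≈⟨ +-congʳ (sum-cong (λ z → trans (sym ([]-idem (adjacent? x z))) (*-congˡ (A-sym x z)))) ⟩
          sum (λ z → A x z * A z x) + b * c
            ≈⟨ solve 4 (λ s b c d → s :+ b :* c := s :- (b :+ c) :* :0 :+ b :* c :* :1) refl (sum (λ z → A x z * A z x)) b c 0# ⟩
          sum (λ z → A x z * A z x) - (b + c) * 0# + b * c * 1#
            ≈⟨ +-cong (+-congˡ (-‿cong (*-congˡ ([]-cong (≡.sym (loopless x)))))) (*-congˡ (sym (δ-refl x))) ⟩
          sum (λ z → A x z * A z x) - (b + c) * A x x + b * c * δ x x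
            ≈⟨ y-equation x x ⟩
          κ * (y x * y x) ∎

        degree⇒y : ∀ x w → degree x ≈ degree w → y x ≈ y w
        degree⇒y x w e = Pos-square-injective (y-pos x) (y-pos w)
          (*-cancelˡ κ≉0 (trans (sym (degree-y x)) (trans (+-congʳ e) (degree-y w))))

-- Graphs with three eigenvalues

-- All that is needed of the spectrum: A A - s A + p I is a nonzero multiple of
-- y yᵀ for a vector y (the Perron eigenvector) without zeros that takes equal
-- values at vertices of equal degree.  The vertex o shows that there is one.
record RankOneEquation {c ℓ} (F : Field₀ c ℓ) {n} (Γ : Graph n) : Set (c ⊔ ℓ) where
  open FieldTools F
  open Graph Γ
  field
    s p κ    : Carrier
    y        : Fin n → Carrier
    equation : ∀ x w → sum (λ z → [ adjacent? x z ] * [ adjacent? z w ]) - s * [ adjacent? x w ] + p * δ x w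
                       ≈ κ * (y x * y w)
    κ≉0      : ¬ (κ ≈ 0#)
    y≉0      : ∀ x → ¬ (y x ≈ 0#)
    degree⇒y : ∀ x w → sum (λ z → [ adjacent? x z ]) ≈ sum (λ z → [ adjacent? w z ]) → y x ≈ y w
    o        : Fin n

-- Among three distinct elements one is the largest.
module _ {c ℓ₁ ℓ₂} (O : OrderedField c ℓ₁ ℓ₂) where
  open OrderedTools O
  open FieldTools field₀
  private module < = IsStrictTotalOrder (OrderedField.isStrictTotalOrder O)

  largest : (r : Fin 3 → Carrier) → (∀ i j → i ≢ j → ¬ (r i ≈ r j)) →
    ∃[ i ] ∃[ j ] ∃[ k ] Pos (r i - r j) × Pos (r i - r k) × j ≢ k × (∀ l → l ≡ i ⊎ l ≡ j ⊎ l ≡ k)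
  largest r distinct with <.compare (r zero) (r (suc zero)) | <.compare (r zero) (r (suc (suc zero))) | <.compare (r (suc zero)) (r (suc (suc zero)))
  ... | tri≈ _ e _ | _ | _ = ⊥-elim (distinct _ _ (λ ()) e)
  ... | _ | tri≈ _ e _ | _ = ⊥-elim (distinct _ _ (λ ()) e)
  ... | _ | _ | tri≈ _ e _ = ⊥-elim (distinct _ _ (λ ()) e)
  ... | tri> _ _ 1<0 | tri> _ _ 2<0 | _ = zero , suc zero , suc (suc zero) , <⇒Pos 1<0 , <⇒Pos 2<0 , (λ ()) ,
    λ { zero → inj₁ ≡.refl ; (suc zero) → inj₂ (inj₁ ≡.refl) ; (suc (suc zero)) → inj₂ (inj₂ ≡.refl) }
  ... | tri< 0<1 _ _ | _ | tri> _ _ 2<1 = suc zero , zero , suc (suc zero) , <⇒Pos 0<1 , <⇒Pos 2<1 , (λ ()) ,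
    λ { zero → inj₂ (inj₁ ≡.refl) ; (suc zero) → inj₁ ≡.refl ; (suc (suc zero)) → inj₂ (inj₂ ≡.refl) }
  ... | _ | tri< 0<2 _ _ | tri< 1<2 _ _ = suc (suc zero) , zero , suc zero , <⇒Pos 0<2 , <⇒Pos 1<2 , (λ ()) ,
    λ { zero → inj₂ (inj₁ ≡.refl) ; (suc zero) → inj₂ (inj₂ ≡.refl) ; (suc (suc zero)) → inj₁ ≡.refl }
  ... | tri< 0<1 _ _ | tri> _ _ 2<0 | tri< 1<2 _ _ = ⊥-elim (<.irrefl refl (<.trans 2<0 (<.trans 0<1 1<2)))
  ... | tri> _ _ 1<0 | tri< 0<2 _ _ | tri> _ _ 2<1 = ⊥-elim (<.irrefl refl (<.trans 2<1 (<.trans 1<0 0<2)))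

module Spectral {c ℓ₁ ℓ₂} (ℝ : RealClosedField c ℓ₁ ℓ₂) {n} (Γ : Graph n) where
  open RealClosedField ℝ
  open Graph Γ
  private O = orderedField
  open OrderedTools O
  open FieldTools field₀
  open Matrices ℂ using (𝒢₃; adjacencyMatrix; IsEigenvalue; PreciselyDistinctEigenvalues)
  open PerronFrobenius O Γ
  open Relation.Binary.Reasoning.Setoid setoid
  private
    module ℂ = FieldTools (Complexification.ℂ-field (RealClosedField.orderedField ℝ))
    module Opℝ = Operators R A
    module Opℂ = Operators (Complexification.ℂ-ring (RealClosedField.orderedField ℝ)) (adjacencyMatrix Γ)
  open Opℝ

  -- Real and imaginary parts.
  re im : Vector ℂ.Carrier n → Vector Carrier n
  re v x = proj₁ (v x)
  im v x = proj₂ (v x)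

  re-sum : ∀ {m} (f : Fin m → ℂ.Carrier) → proj₁ (ℂ.sum f) ≈ sum (λ i → proj₁ (f i))
  re-sum {ℕ.zero}  f = refl
  re-sum {ℕ.suc m} f = +-congˡ (re-sum (f ∘ suc))

  im-sum : ∀ {m} (f : Fin m → ℂ.Carrier) → proj₂ (ℂ.sum f) ≈ sum (λ i → proj₂ (f i))
  im-sum {ℕ.zero}  f = refl
  im-sum {ℕ.suc m} f = +-congˡ (im-sum (f ∘ suc))

  re-[]* : ∀ b w → proj₁ (ℂ.[ b ] ℂ.* w) ≈ [ b ] * proj₁ w
  re-[]* true  (u , v) = solve 2 (λ u v → :1 :* u :- :0 :* v := :1 :* u) refl u v
  re-[]* false (u , v) = solve 2 (λ u v → :0 :* u :- :0 :* v := :0 :* u) refl u v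

  im-[]* : ∀ b w → proj₂ (ℂ.[ b ] ℂ.* w) ≈ [ b ] * proj₂ w
  im-[]* true  (u , v) = solve 2 (λ u v → :1 :* v :+ :0 :* u := :1 :* v) refl u v
  im-[]* false (u , v) = solve 2 (λ u v → :0 :* v :+ :0 :* u := :0 :* v) refl u v

  re-mul : ∀ v → re (Opℂ.mul v) ≋ mul (re v)
  re-mul v x = trans (re-sum (λ z → adjacencyMatrix Γ x z ℂ.* v z)) (sum-cong (λ z → re-[]* (adjacent? x z) (v z)))

  im-mul : ∀ v → im (Opℂ.mul v) ≋ mul (im v)
  im-mul v x = trans (im-sum (λ z → adjacencyMatrix Γ x z ℂ.* v z)) (sum-cong (λ z → im-[]* (adjacent? x z) (v z)))

  module _ {z : ℂ.Carrier} (real : proj₂ z ≈ 0#) where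

    re-L : ∀ v → re (Opℂ.L z v) ≋ L (proj₁ z) (re v)
    re-L v x = +-cong (re-mul v x) (-‿cong (trans (+-congˡ (-‿cong (*-congʳ real)))
      (solve 3 (λ r u w → r :* u :- :0 :* w := r :* u) refl (proj₁ z) (re v x) (im v x))))

    im-L : ∀ v → im (Opℂ.L z v) ≋ L (proj₁ z) (im v)
    im-L v x = +-cong (im-mul v x) (-‿cong (trans (+-congˡ (*-congʳ real))
      (solve 3 (λ r u w → r :* w :+ :0 :* u := r :* w) refl (proj₁ z) (re v x) (im v x))))

    real-semisimple : ∀ v → Opℂ.L z (Opℂ.L z v) Opℂ.≋ Opℂ.𝟎 → Opℂ.L z v Opℂ.≋ Opℂ.𝟎
    real-semisimple v e x =
      trans (re-L v x) (L-semisimple r (re v) (λ x → trans (sym (trans (re-L (Opℂ.L z v) x) (L-cong r (re-L v) x))) (proj₁ (e x))) x) ,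
      trans (im-L v x) (L-semisimple r (im v) (λ x → trans (sym (trans (im-L (Opℂ.L z v) x) (L-cong r (im-L v) x))) (proj₂ (e x))) x)
      where r = proj₁ z

  -- A symmetric real matrix has real eigenvalues only.
  eigenvalue-real : ∀ z v → ¬ (v Opℂ.≋ Opℂ.𝟎) → Opℂ.L z v Opℂ.≋ Opℂ.𝟎 → proj₂ z ≈ 0#
  eigenvalue-real (r , s) v v≉0 e with s ≈? 0#
  ... | yes s≈0 = s≈0
  ... | no  s≉0 = ⊥-elim (v≉0 λ i → ·-definite xx≈0 i , ·-definite yy≈0 i)
    where
    x = re v
    y = im v

    Ax : mul x ≋ (λ i → r * x i - s * y i)
    Ax i = trans (sym (re-mul v i)) (x-y≈0⇒x≈y (proj₁ (e i)))

    Ay : mul y ≋ (λ i → r * y i - (- s) * x i)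
    Ay i = trans (trans (sym (im-mul v i)) (x-y≈0⇒x≈y (proj₂ (e i))))
      (solve 4 (λ r s x y → r :* y :+ s :* x := r :* y :- (:- s) :* x) refl r s (x i) (y i))

    expand : ∀ u v w t → u · (λ i → r * v i - t * w i) ≈ r * (u · v) - t * (u · w)
    expand u v w t = trans (·-sub u (λ i → r * v i) (λ i → t * w i))
      (+-cong (·-scale r u v) (-‿cong (·-scale t u w)))

    xx+yy≈0 : x · x + y · y ≈ 0#
    xx+yy≈0 = x*y≈0⇒y≈0 s≉0 (begin
      s * (x · x + y · y)
        ≈⟨ solve 5 (λ r s xx yy xy → s :* (xx :+ yy) := (r :* xy :- (:- s) :* xx) :- (r :* xy :- s :* yy)) refl r s (x · x) (y · y) (x · y) ⟩
      (r * (x · y) - (- s) * (x · x)) - (r * (x · y) - s * (y · y))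
        ≈⟨ +-cong (sym (trans (·-cong {u = x} (λ _ → refl) Ay) (expand x y x (- s))))
             (-‿cong (trans (+-congʳ (*-congˡ (·-comm x y))) (sym (trans (·-cong {u = y} (λ _ → refl) Ax) (expand y x y s))))) ⟩
      x · mul y - y · mul x
        ≈⟨ x≈y⇒x-y≈0 (trans (·-mul x y) (·-comm (mul x) y)) ⟩
      0# ∎)

    xx≈0 : x · x ≈ 0#
    xx≈0 = NonNeg-+≈0 (·-NonNeg x) (·-NonNeg y) xx+yy≈0

    yy≈0 : y · y ≈ 0#
    yy≈0 = NonNeg-+≈0 (·-NonNeg y) (·-NonNeg x) (trans (+-comm _ _) xx+yy≈0)

  -- The real or the imaginary part of an eigenvector is an eigenvector.
  real-eigenvector : ∀ z v → proj₂ z ≈ 0# → ¬ (v Opℂ.≋ Opℂ.𝟎) → Opℂ.L z v Opℂ.≋ Opℂ.𝟎 →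
    Σ[ u ∈ Vector Carrier n ] ¬ (u ≋ 𝟎) × L (proj₁ z) u ≋ 𝟎
  real-eigenvector z v real v≉0 e with Fin.all? (λ i → re v i ≈? 0#)
  ... | no  x≉0 = re v , x≉0 , λ i → trans (sym (re-L real v i)) (proj₁ (e i))
  ... | yes x≋0 = im v , (λ y≋0 → v≉0 (λ i → x≋0 i , y≋0 i)) , λ i → trans (sym (im-L real v i)) (proj₂ (e i))

  -- The inclusion of the reals.
  ⌜_⌝ : Carrier → ℂ.Carrier
  ⌜ r ⌝ = r , 0#

  ⌜⌝-cong : ∀ {r s} → r ≈ s → ⌜ r ⌝ ℂ.≈ ⌜ s ⌝
  ⌜⌝-cong e = e , refl

  ⌜⌝-+ : ∀ r s → ⌜ r ⌝ ℂ.+ ⌜ s ⌝ ℂ.≈ ⌜ r + s ⌝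
  ⌜⌝-+ r s = refl , +-identityˡ 0#

  ⌜⌝-neg : ∀ r → ℂ.- ⌜ r ⌝ ℂ.≈ ⌜ - r ⌝
  ⌜⌝-neg r = refl , -0#≈0#

  ⌜⌝-* : ∀ r s → ⌜ r ⌝ ℂ.* ⌜ s ⌝ ℂ.≈ ⌜ r * s ⌝
  ⌜⌝-* r s = solve 2 (λ r s → r :* s :- :0 :* :0 := r :* s) refl r s ,
             solve 2 (λ r s → r :* :0 :+ :0 :* s := :0) refl r s

  ⌜⌝-[] : ∀ b → ℂ.[ b ] ℂ.≈ ⌜ [ b ] ⌝
  ⌜⌝-[] true  = ℂ.refl
  ⌜⌝-[] false = ℂ.refl

  ⌜⌝-sum : ∀ {m} (f : Fin m → Carrier) → ℂ.sum (λ i → ⌜ f i ⌝) ℂ.≈ ⌜ sum f ⌝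
  ⌜⌝-sum {ℕ.zero}  f = ℂ.refl
  ⌜⌝-sum {ℕ.suc m} f = ℂ.trans (ℂ.+-congˡ (⌜⌝-sum (f ∘ suc))) (⌜⌝-+ _ _)

  -- The equation carries over from the reals to the complex numbers.
  ⌜⌝-equation : ∀ s p κ (y : Vector Carrier n) →
    (∀ x w → sum (λ z → A x z * A z w) - s * A x w + p * δ x w ≈ κ * (y x * y w)) →
    ∀ x w → ℂ.sum (λ z → ℂ.[ adjacent? x z ] ℂ.* ℂ.[ adjacent? z w ]) ℂ.- ⌜ s ⌝ ℂ.* ℂ.[ adjacent? x w ] ℂ.+ ⌜ p ⌝ ℂ.* ℂ.δ x w
            ℂ.≈ ⌜ κ ⌝ ℂ.* (⌜ y x ⌝ ℂ.* ⌜ y w ⌝)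
  ⌜⌝-equation s p κ y e x w = ℂ.trans
    (ℂ.+-cong (ℂ.+-cong square-part
        (ℂ.trans (ℂ.-‿cong (scaled s (adjacent? x w))) (⌜⌝-neg (s * A x w))))
      (scaled p (does (x Fin.≟ w))))
    (ℂ.trans (ℂ.+-congʳ (⌜⌝-+ (sum (λ z → A x z * A z w)) (- (s * A x w))))
      (ℂ.trans (⌜⌝-+ (sum (λ z → A x z * A z w) - s * A x w) (p * δ x w))
        (ℂ.trans (⌜⌝-cong (e x w))
          (ℂ.sym (ℂ.trans (ℂ.*-congˡ (⌜⌝-* (y x) (y w))) (⌜⌝-* κ (y x * y w)))))))
    where
    scaled : ∀ r b → ⌜ r ⌝ ℂ.* ℂ.[ b ] ℂ.≈ ⌜ r * [ b ] ⌝
    scaled r b = ℂ.trans (ℂ.*-congˡ (⌜⌝-[] b)) (⌜⌝-* r [ b ])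

    product : ∀ b b′ → ℂ.[ b ] ℂ.* ℂ.[ b′ ] ℂ.≈ ⌜ [ b ] * [ b′ ] ⌝
    product b b′ = ℂ.trans (ℂ.*-cong (⌜⌝-[] b) (⌜⌝-[] b′)) (⌜⌝-* [ b ] [ b′ ])

    square-part : ℂ.sum (λ z → ℂ.[ adjacent? x z ] ℂ.* ℂ.[ adjacent? z w ]) ℂ.≈ ⌜ sum (λ z → A x z * A z w) ⌝
    square-part = ℂ.trans (ℂ.sum-cong (λ z → product (adjacent? x z) (adjacent? z w))) (⌜⌝-sum (λ z → A x z * A z w))

  ⌜⌝-degree : ∀ x → ℂ.sum (λ z → ℂ.[ adjacent? x z ]) ℂ.≈ ⌜ degree x ⌝
  ⌜⌝-degree x = ℂ.trans (ℂ.sum-cong (λ z → ⌜⌝-[] (adjacent? x z))) (⌜⌝-sum (A x))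

  module _ (connected : Connected) (a b d : Carrier)
    (a>b : Pos (a - b)) (a>d : Pos (a - d)) (b≉d : ¬ (b ≈ d))
    (annihilated : ∀ w → L a (L b (L d w)) ≋ 𝟎)
    (v : Vector Carrier n) (v≉0 : ¬ (v ≋ 𝟎)) (v-eigen : L a v ≋ 𝟎) where
    private module P = PositiveEigenvector connected a b d a>b a>d b≉d annihilated

    complexEquation : RankOneEquation (Complexification.ℂ-field (RealClosedField.orderedField ℝ)) Γ
    complexEquation = record
      { s = ⌜ b + d ⌝
      ; p = ⌜ b * d ⌝
      ; κ = ⌜ P.κ v v≉0 v-eigen o ⌝
      ; y = λ x → ⌜ P.y v v≉0 v-eigen x ⌝
      ; equation = ⌜⌝-equation (b + d) (b * d) (P.κ v v≉0 v-eigen o) (P.y v v≉0 v-eigen) (P.y-equation v v≉0 v-eigen o)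
      ; κ≉0 = λ e → P.κ≉0 v v≉0 v-eigen o (proj₁ e)
      ; y≉0 = λ x e → Pos⇒≉0 (P.y-pos v v≉0 v-eigen x) (proj₁ e)
      ; degree⇒y = λ x w e → ⌜⌝-cong (P.degree⇒y v v≉0 v-eigen o x w
          (proj₁ (ℂ.trans (ℂ.sym (⌜⌝-degree x)) (ℂ.trans e (⌜⌝-degree w)))))
      ; o = o
      }
      where o = proj₁ (Fin.¬∀⟶∃¬ n _ (λ i → v i ≈? 0#) v≉0)

  -- The cubic equation over the complex numbers, read off on real vectors.
  module _ (a b d : ℂ.Carrier) (a-real : proj₂ a ≈ 0#) (b-real : proj₂ b ≈ 0#) (d-real : proj₂ d ≈ 0#)
    (eigenvalues : ∀ z v → ¬ (v Opℂ.≋ Opℂ.𝟎) → Opℂ.L z v Opℂ.≋ Opℂ.𝟎 → (z ℂ.≈ a) ⊎ (z ℂ.≈ b) ⊎ (z ℂ.≈ d)) where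

    private
      real : ∀ z → (z ℂ.≈ a) ⊎ (z ℂ.≈ b) ⊎ (z ℂ.≈ d) → proj₂ z ≈ 0#
      real z (inj₁ e)        = trans (proj₂ e) a-real
      real z (inj₂ (inj₁ e)) = trans (proj₂ e) b-real
      real z (inj₂ (inj₂ e)) = trans (proj₂ e) d-real

    real-annihilated : ∀ w → L (proj₁ a) (L (proj₁ b) (L (proj₁ d) w)) ≋ 𝟎
    real-annihilated w x = trans (sym (trans (re-L a-real (Opℂ.L b (Opℂ.L d ŵ)) x)
        (L-cong (proj₁ a) (λ x → trans (re-L b-real (Opℂ.L d ŵ) x) (L-cong (proj₁ b) (re-L d-real ŵ) x)) x)))
      (proj₁ (Annihilation.annihilated (Complexification.ℂ-field (RealClosedField.orderedField ℝ)) algebraicallyClosed (adjacencyMatrix Γ)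
        a b d eigenvalues (λ z z∈ → real-semisimple (real z z∈)) ŵ x))
      where
      ŵ : Vector ℂ.Carrier n
      ŵ x = ⌜ w x ⌝

  module _ (connected : Connected) (spectrum : PreciselyDistinctEigenvalues (adjacencyMatrix Γ) 3) where
    open PreciselyDistinctEigenvalues spectrum

    private
      vector : Fin 3 → Vector ℂ.Carrier n
      vector i = proj₁ (isEigenvalue i)

      vector≉0 : ∀ i → ¬ (vector i Opℂ.≋ Opℂ.𝟎)
      vector≉0 i = proj₁ (proj₂ (isEigenvalue i))

      eigen : ∀ i → Opℂ.L (eigenvalue i) (vector i) Opℂ.≋ Opℂ.𝟎
      eigen i x = ℂ.x≈y⇒x-y≈0 {Opℂ.mul (vector i) x} {eigenvalue i ℂ.* vector i x} (proj₂ (proj₂ (isEigenvalue i)) x)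

      real : ∀ i → proj₂ (eigenvalue i) ≈ 0#
      real i = eigenvalue-real (eigenvalue i) (vector i) (vector≉0 i) (eigen i)

      re-distinct : ∀ i j → i ≢ j → ¬ (proj₁ (eigenvalue i) ≈ proj₁ (eigenvalue j))
      re-distinct i j i≢j e = distinct i j i≢j (e , trans (real i) (sym (real j)))

      choose : ∀ {i j k l z} → l ≡ i ⊎ l ≡ j ⊎ l ≡ k → z ℂ.≈ eigenvalue l →
        (z ℂ.≈ eigenvalue i) ⊎ (z ℂ.≈ eigenvalue j) ⊎ (z ℂ.≈ eigenvalue k)
      choose (inj₁ ≡.refl)        e = inj₁ e
      choose (inj₂ (inj₁ ≡.refl)) e = inj₂ (inj₁ e)
      choose (inj₂ (inj₂ ≡.refl)) e = inj₂ (inj₂ e)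

      only : ∀ {i j k} → (∀ l → l ≡ i ⊎ l ≡ j ⊎ l ≡ k) →
        ∀ z v → ¬ (v Opℂ.≋ Opℂ.𝟎) → Opℂ.L z v Opℂ.≋ Opℂ.𝟎 →
        (z ℂ.≈ eigenvalue i) ⊎ (z ℂ.≈ eigenvalue j) ⊎ (z ℂ.≈ eigenvalue k)
      only {i} {j} {k} cover z v v≉0 e = choose {i} {j} {k} {proj₁ found} {z} (cover (proj₁ found)) (proj₂ found)
        where
        found : ∃[ l ] z ℂ.≈ eigenvalue l
        found = exhaustive z (v , v≉0 , λ x → ℂ.x-y≈0⇒x≈y {Opℂ.mul v x} {z ℂ.* v x} (e x))

      fromLargest : ∀ i j k → Pos (proj₁ (eigenvalue i) - proj₁ (eigenvalue j)) → Pos (proj₁ (eigenvalue i) - proj₁ (eigenvalue k)) →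
        j ≢ k → (∀ l → l ≡ i ⊎ l ≡ j ⊎ l ≡ k) → RankOneEquation (Complexification.ℂ-field (RealClosedField.orderedField ℝ)) Γ
      fromLargest i j k i>j i>k j≢k cover = complexEquation connected
        (proj₁ (eigenvalue i)) (proj₁ (eigenvalue j)) (proj₁ (eigenvalue k)) i>j i>k (re-distinct j k j≢k)
        (real-annihilated (eigenvalue i) (eigenvalue j) (eigenvalue k) (real i) (real j) (real k) (only {i} {j} {k} cover))
        (proj₁ u) (proj₁ (proj₂ u)) (proj₂ (proj₂ u))
        where u = real-eigenvector (eigenvalue i) (vector i) (real i) (vector≉0 i) (eigen i)

    rankOneEquation : RankOneEquation (Complexification.ℂ-field (RealClosedField.orderedField ℝ)) Γ
    rankOneEquation =
      let (i , j , k , i>j , i>k , j≢k , cover) = largest O (λ i → proj₁ (eigenvalue i)) re-distinct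
      in fromLargest i j k i>j i>k j≢k cover

-- Coherent rank and colours of pairs

-- A space of matrices with a basis of r zero-one matrices that add up to the
-- all-ones matrix.
module RankTools {c ℓ} (F : Field₀ c ℓ) {n p r}
  (𝒜 : Matrices.Matrix (CommutativeRing.rawRing (Field₀.commutativeRing F)) n n → Set p)
  (rank : Matrices.HasRank (CommutativeRing.rawRing (Field₀.commutativeRing F)) 𝒜 r) where
  open FieldTools F
  open Matrices rawRing using (Matrix; linearCombination)
  open Matrices.HasRank rank
  open Relation.Binary.Reasoning.Setoid setoid

  private
    -- Whether an entry of a basis matrix is 1.
    bit : Fin n → Fin n → Fin r → Bool
    bit x y k = does (basis k x y ≈? 1#)

    basis≈bit : ∀ k x y → basis k x y ≈ [ bit x y k ]
    basis≈bit k x y with basis k x y ≈? 1#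
    ... | yes e = e
    ... | no ≉1 with zeroOne k x y
    ...   | inj₁ e = e
    ...   | inj₂ e = ⊥-elim (≉1 e)

    sum-bit : ∀ x y → sum (λ k → [ bit x y k ]) ≈ 1#
    sum-bit x y = trans (sum-cong (λ k → sym (basis≈bit k x y))) (sum≈J x y)

    count-bit : ∀ x y → count (bit x y) ≡ 1
    count-bit x y = ι-injective _ 1 (trans (sym (sum-[] (bit x y))) (sum-bit x y))

    someColour : ∀ x y → ∃[ k ] bit x y k ≡ true
    someColour x y with Fin.any? (λ k → bit x y k Bool.≟ true)
    ... | yes found = found
    ... | no  none  = ⊥-elim (0≉1 (trans (sym (sum-≈0 (λ k → [ bit x y k ])
      (λ k → reflexive (≡.cong [_] (Bool.¬-not (λ e → none (k , e))))))) (sum-bit x y)))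

  -- The index of the basis matrix with entry 1 at a position.  There is exactly
  -- one, because r indicators add up to 1.
  colour : Fin n → Fin n → Fin r
  colour x y = proj₁ (someColour x y)

  basis-δ : ∀ k x y → basis k x y ≈ δ k (colour x y)
  basis-δ k x y with k Fin.≟ colour x y
  ... | yes ≡.refl = trans (basis≈bit k x y) ([]-cong (proj₂ (someColour x y)))
  ... | no  k≢     = trans (basis≈bit k x y) (reflexive (≡.cong [_] (Bool.¬-not (λ e →
    k≢ (count≡1⇒unique (bit x y) (count-bit x y) k (colour x y) e (proj₂ (someColour x y)))))))

  entry-colour : ∀ a x y → linearCombination a basis x y ≈ a (colour x y)
  entry-colour a x y = trans (sum-cong (λ k → *-congˡ {x = a k} (basis-δ k x y))) (sum-δʳ (colour x y) a)

  colour-constant : ∀ {M} → 𝒜 M → ∀ {x y x′ y′} → colour x y ≡ colour x′ y′ → M x y ≈ M x′ y′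
  colour-constant {M} M∈𝒜 {x} {y} {x′} {y′} e with a , M≈ ← spanning M M∈𝒜 = begin
    M x y             ≈⟨ trans (M≈ x y) (entry-colour a x y) ⟩
    a (colour x y)    ≡⟨ ≡.cong a e ⟩
    a (colour x′ y′)  ≈⟨ sym (trans (M≈ x′ y′) (entry-colour a x′ y′)) ⟩
    M x′ y′           ∎

  colour-surjective : ∀ k → ∃[ x ] ∃[ y ] colour x y ≡ k
  colour-surjective k with Fin.any? (λ x → Fin.any? (λ y → colour x y Fin.≟ k))
  ... | yes found = found
  ... | no  none  = ⊥-elim (0≉1 (sym (trans (sym (δ-refl k)) (independent (δ k) (λ x y →
    trans (entry-colour (δ k) x y) (δ-≢ (λ k≡ → none (x , y , ≡.sym k≡)))) k))))

  -- Entries in more than r positions cannot all be told apart by 𝒜.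
  pigeonhole : ∀ {s} → r ℕ.< s → (P : Fin s → Fin n × Fin n) →
    ∃[ i ] ∃[ j ] i ≢ j × (∀ M → 𝒜 M → M (proj₁ (P i)) (proj₂ (P i)) ≈ M (proj₁ (P j)) (proj₂ (P j)))
  pigeonhole r<s P with i , j , i<j , e ← Fin.pigeonhole r<s (λ i → colour (proj₁ (P i)) (proj₂ (P i))) =
    i , j , Fin.<⇒≢ i<j , λ M M∈𝒜 → colour-constant M∈𝒜 e

  -- Fewer than r types of positions cannot determine the entries in 𝒜.
  tooFewTypes : ∀ {t} → t ℕ.< r → (τ : Fin n → Fin n → Fin t) →
    ¬ (∀ M → 𝒜 M → ∀ x y x′ y′ → τ x y ≡ τ x′ y′ → M x y ≈ M x′ y′)
  tooFewTypes t<r τ determined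
    with k , l , k<l , e ← Fin.pigeonhole t<r (λ k → let (x , y , _) = colour-surjective k in τ x y) =
    0≉1 (trans (sym (δ-≢ (Fin.<⇒≢ k<l))) (trans (sym (at k l)) (trans
      (sym (determined (basis k) (member k) _ _ _ _ e)) (trans (at k k) (δ-refl k)))))
    where
    at : ∀ k l → basis k (proj₁ (colour-surjective l)) (proj₁ (proj₂ (colour-surjective l))) ≈ δ k l
    at k l with x , y , e ← colour-surjective l = trans (basis-δ k x y) (reflexive (≡.cong (δ k) e))

-- The coherent closure of a graph of coherent rank eight.
module ClosureTools {c ℓ} (F : Field₀ c ℓ) {n} (Γ : Graph n)
  (rank8 : Matrices.HasCoherentRank (CommutativeRing.rawRing (Field₀.commutativeRing F)) Γ 8) where
  open FieldTools F
  open Graph Γ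
  open Matrices rawRing hiding (O; I; J)
  open Relation.Binary.Reasoning.Setoid setoid

  A : Fin n → Fin n → Carrier
  A = adjacencyMatrix Γ

  W : Matrix n n → Set _
  W = CoherentClosure A

  open RankTools F W rank8 public

  -- Functions on the vertices that are recorded by the closure, as matrices
  -- with constant rows.
  Recorded : (Fin n → Carrier) → Set _
  Recorded f = W (λ x y → f x)

  neighbour-sum : ∀ {f} → Recorded f → Recorded (λ x → sum (λ z → A x z * f z))
  neighbour-sum r = times generator r

  recorded-affine : ∀ {f} a b → Recorded f → Recorded (λ x → a * f x + b)
  recorded-affine a b r = plus (scale a r) (resp (λ _ _ → *-identityʳ b) (scale b allOnes))

  recorded-degree : Recorded (λ x → sum (A x))
  recorded-degree = resp (λ x y → sum-cong (λ z → *-identityʳ (A x z))) (times generator allOnes)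

  -- Three vertices that recorded functions tell apart give nine pairs that
  -- the closure tells apart.
  no-three : (x : Fin 3 → Fin n) →
    ¬ (∀ i j → i ≢ j → Σ[ f ∈ (Fin n → Carrier) ] Recorded f × ¬ (f (x i) ≈ f (x j)))
  no-three x separated = collide (pigeonhole (ℕ.n<1+n 8) P)
    where
    P : Fin 9 → Fin n × Fin n
    P k = x (proj₁ (remQuot {3} 3 k)) , x (proj₂ (remQuot {3} 3 k))

    same : ∀ {k l} → (∀ f → Recorded f → f (x k) ≈ f (x l)) → k ≡ l
    same {k} {l} e with k Fin.≟ l
    ... | yes k≡l = k≡l
    ... | no  k≢l = ⊥-elim (proj₂ (proj₂ sep) (e (proj₁ sep) (proj₁ (proj₂ sep))))
      where sep = separated k l k≢l

    collide : ¬ (∃[ i ] ∃[ j ] i ≢ j × (∀ M → W M → M (proj₁ (P i)) (proj₂ (P i)) ≈ M (proj₁ (P j)) (proj₂ (P j))))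
    collide (i , j , i≢j , e) = i≢j (≡.trans (≡.sym (Fin.combine-remQuot {3} 3 i)) (≡.trans
      (≡.cong₂ combine
        (same (λ f r → e (λ x _ → f x) r))
        (same (λ f r → e (λ _ y → f y) (transpose r))))
      (Fin.combine-remQuot {3} 3 j)))

-- Joins of two regular graphs

-- Whether two truth values are equal, computed by cases on the first.
is : Bool → Bool → Bool
is true  b = b
is false b = not b

is-≡ : ∀ c {b} → b ≡ c → is c b ≡ true
is-≡ true  ≡.refl = ≡.refl
is-≡ false ≡.refl = ≡.refl

is-not : ∀ c {b} → b ≡ not c → is c b ≡ false
is-not true  ≡.refl = ≡.refl
is-not false ≡.refl = ≡.refl

same-or-not : ∀ c b → (b ≡ c) ⊎ (b ≡ not c)
same-or-not true  true  = inj₁ ≡.refl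
same-or-not true  false = inj₂ ≡.refl
same-or-not false true  = inj₂ ≡.refl
same-or-not false false = inj₁ ≡.refl

not-not : ∀ c {b} → b ≡ c → b ≡ not (not c)
not-not c e = ≡.trans e (≡.sym (Bool.not-involutive c))

not-≢ : ∀ c → not c ≢ c
not-≢ true  ()
not-≢ false ()

-- The type of a pair of vertices: the class of either, whether they are
-- adjacent, and whether they are equal.
Type : Set
Type = Bool × Bool × Bool × Bool

type-cong : ∀ {a b d g a′ b′ d′ g′ : Bool} → a ≡ a′ → b ≡ b′ → d ≡ d′ → g ≡ g′ → (a , b , d , g) ≡ (a′ , b′ , d′ , g′)
type-cong ≡.refl ≡.refl ≡.refl ≡.refl = ≡.refl

-- A division of the vertices into two classes, named true and false.
module Classes {c ℓ} (R : CommutativeRing c ℓ) {n} (Γ : Graph n) (cls : Fin n → Bool) where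
  open CommutativeRing R hiding (zero)
  open RingTools R
  open CountTools R
  open Graph Γ
  open Relation.Binary.Reasoning.Setoid setoid

  A : Fin n → Fin n → Carrier
  A x y = [ adjacent? x y ]

  A-sym : ∀ x y → A x y ≈ A y x
  A-sym x y = []-cong (symmetric x y)

  type : Fin n → Fin n → Type
  type x z = cls x , cls z , adjacent? x z , does (x Fin.≟ z)

  member : Bool → Fin n → Bool
  member c z = is c (cls z)

  -- The indicator of a class.
  χ : Bool → Fin n → Carrier
  χ c z = [ member c z ]

  χ-hit : ∀ c {z} → cls z ≡ c → χ c z ≈ 1#
  χ-hit c e = []-cong (is-≡ c e)

  χ-miss : ∀ c {z} → cls z ≡ not c → χ c z ≈ 0#
  χ-miss c e = []-cong (is-not c e)

  -- In a sum over a class, terms may be replaced as if at a member.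
  χ-cong : ∀ c z {u v} → (cls z ≡ c → u ≈ v) → χ c z * u ≈ χ c z * v
  χ-cong c z e with same-or-not c (cls z)
  ... | inj₁ z∈c = *-congˡ (e z∈c)
  ... | inj₂ z∉c = trans (*-congʳ (χ-miss c z∉c)) (trans (zeroˡ _) (sym (trans (*-congʳ (χ-miss c z∉c)) (zeroˡ _))))

  χ-complete : ∀ c z → χ c z + χ (not c) z ≈ 1#
  χ-complete true  z with cls z
  ... | true  = +-identityʳ _
  ... | false = +-identityˡ _
  χ-complete false z with cls z
  ... | true  = +-identityˡ _
  ... | false = +-identityʳ _

  split : ∀ c (f : Fin n → Carrier) → sum f ≈ sum (λ z → χ c z * f z) + sum (λ z → χ (not c) z * f z)
  split c f = trans (sum-cong (λ z → trans (sym (*-identityˡ (f z))) (trans (*-congʳ (sym (χ-complete c z))) (distribʳ (f z) (χ c z) (χ (not c) z)))))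
    (∑-distrib-+ (λ z → χ c z * f z) (λ z → χ (not c) z * f z))

  -- The number of members.
  size : Bool → Carrier
  size c = sum (χ c)

  -- The number of neighbours of x in class c.
  valency : Bool → Fin n → Carrier
  valency c x = sum (λ z → χ c z * A x z)

  -- The number of common neighbours of x and y in class c.
  common : Bool → Fin n → Fin n → Carrier
  common c x y = sum (λ z → χ c z * (A x z * A z y))

  degree-split : ∀ c x → sum (A x) ≈ valency c x + valency (not c) x
  degree-split c x = split c (A x)

  common-split : ∀ c x y → sum (λ z → A x z * A z y) ≈ common c x y + common (not c) x y
  common-split c x y = split c (λ z → A x z * A z y)

  common-adjacentˡ : ∀ c x y → (∀ z → cls z ≡ c → adjacent? x z ≡ true) → common c x y ≈ valency c y
  common-adjacentˡ c x y adj = sum-cong (λ z → χ-cong c z (λ z∈c →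
    trans (*-cong ([]-cong (adj z z∈c)) (A-sym z y)) (*-identityˡ (A y z))))

  common-adjacentʳ : ∀ c x y → (∀ z → cls z ≡ c → adjacent? z y ≡ true) → common c x y ≈ valency c x
  common-adjacentʳ c x y adj = sum-cong (λ z → χ-cong c z (λ z∈c →
    trans (*-congˡ ([]-cong (adj z z∈c))) (*-identityʳ (A x z))))

  valency-adjacent : ∀ c x → (∀ z → cls z ≡ c → adjacent? x z ≡ true) → valency c x ≈ size c
  valency-adjacent c x adj = sum-cong (λ z → trans (χ-cong c z (λ z∈c → []-cong (adj z z∈c))) (*-identityʳ (χ c z)))

  valency-[] : ∀ c x → valency c x ≈ sum (λ z → [ member c z ∧ adjacent? x z ])
  valency-[] c x = sum-cong (λ z → sym ([∧] (member c z) (adjacent? x z)))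

  valency-count : ∀ c x → valency c x ≈ ι (count (λ z → member c z ∧ adjacent? x z))
  valency-count c x = trans (valency-[] c x) (sum-[] (λ z → member c z ∧ adjacent? x z))

  common-count : ∀ c x w → common c x w ≈ ι (count (λ z → member c z ∧ (adjacent? x z ∧ adjacent? z w)))
  common-count c x w = trans
    (sum-cong (λ z → sym (trans ([∧] (member c z) (adjacent? x z ∧ adjacent? z w)) (*-congˡ ([∧] (adjacent? x z) (adjacent? z w))))))
    (sum-[] (λ z → member c z ∧ (adjacent? x z ∧ adjacent? z w)))

  common-self : ∀ c x → common c x x ≈ valency c x
  common-self c x = sum-cong (λ z → *-congˡ {x = χ c z} (trans (*-congˡ (A-sym z x)) ([]-idem (adjacent? x z))))

  -- The walks of length two from x through class d to class c, counted by
  -- their middle vertex and by their end.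
  two-step-walks : ∀ c d x v → (∀ z → cls z ≡ d → valency c z ≈ v) →
    valency d x * v ≈ sum (λ w → χ c w * common d x w)
  two-step-walks c d x v constant = begin
    valency d x * v
      ≈⟨ *-distribʳ-sum v (λ z → χ d z * A x z) ⟩
    sum (λ z → χ d z * A x z * v)
      ≈⟨ sum-cong (λ z → trans (*-assoc (χ d z) (A x z) v) (trans (χ-cong d z (λ z∈d → *-congˡ (sym (constant z z∈d)))) (sym (*-assoc (χ d z) (A x z) (valency c z))))) ⟩
    sum (λ z → χ d z * A x z * valency c z)
      ≈⟨ sum-cong (λ z → *-distribˡ-sum (χ d z * A x z) (λ w → χ c w * A z w)) ⟩
    sum (λ z → sum (λ w → χ d z * A x z * (χ c w * A z w)))
      ≈⟨ ∑-comm (λ z w → χ d z * A x z * (χ c w * A z w)) ⟩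
    sum (λ w → sum (λ z → χ d z * A x z * (χ c w * A z w)))
      ≈⟨ sum-cong (λ w → trans
           (sum-cong (λ z → solve 4 (λ x a y b → x :* a :* (y :* b) := y :* (x :* (a :* b))) refl (χ d z) (A x z) (χ c w) (A z w)))
           (sym (*-distribˡ-sum (χ c w) (λ z → χ d z * (A x z * A z w))))) ⟩
    sum (λ w → χ c w * common d x w) ∎

-- The join of two graphs, where the degree and the vector y are constant on
-- either side, with values D and Y.  One side may be empty, in which case the
-- graph is just a regular graph.
module Join {c ℓ} (F : Field₀ c ℓ) {n} (Γ : Graph n)
  (E : RankOneEquation F Γ)
  (cls : Fin n → Bool)
  (D Y : Bool → CommutativeRing.Carrier (Field₀.commutativeRing F)) where
  open FieldTools F
  open Graph Γ
  open RankOneEquation E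
  open Classes R Γ cls
  open Relation.Binary.Reasoning.Setoid setoid

  module TypedMatrices
    (degree-D : ∀ x → sum (A x) ≈ D (cls x))
    (y-Y : ∀ x → y x ≈ Y (cls x))
    (join : ∀ c x z → cls x ≡ not c → cls z ≡ c → adjacent? x z ≡ true) where

    private
      join′ : ∀ c x z → cls x ≡ not c → cls z ≡ c → adjacent? z x ≡ true
      join′ c x z x∉c z∈c = ≡.trans (symmetric z x) (join c x z x∉c z∈c)

    valency-class : ∀ c x → cls x ≡ c → valency c x ≈ D c - size (not c)
    valency-class c x x∈c = begin
      valency c x
        ≈⟨ solve 2 (λ p q → p := (p :+ q) :- q) refl (valency c x) (valency (not c) x) ⟩
      valency c x + valency (not c) x - valency (not c) x
        ≈⟨ +-cong (sym (degree-split c x)) (-‿cong (valency-adjacent (not c) x (λ z → join (not c) x z (not-not c x∈c)))) ⟩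
      sum (A x) - size (not c)
        ≈⟨ +-congʳ (trans (degree-D x) (reflexive (≡.cong D x∈c))) ⟩
      D c - size (not c) ∎

    common-class : ∀ c x z → cls x ≡ c → cls z ≡ c →
      common c x z ≈ s * A x z - p * δ x z + κ * (Y c * Y c) - size (not c)
    common-class c x w x∈c w∈c = begin
      common c x w
        ≈⟨ solve 4 (λ p q r t → p := (p :+ q :- r :+ t) :+ r :- t :- q) refl (common c x w) (common (not c) x w) (s * A x w) (p * δ x w) ⟩
      common c x w + common (not c) x w - s * A x w + p * δ x w + s * A x w - p * δ x w - common (not c) x w
        ≈⟨ +-cong (+-congʳ (+-congʳ (trans (+-congʳ (+-congʳ (sym (common-split c x w)))) (trans (equation x w)
             (*-congˡ (*-cong (trans (y-Y x) (reflexive (≡.cong Y x∈c))) (trans (y-Y w) (reflexive (≡.cong Y w∈c)))))))))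
             (-‿cong (trans (common-adjacentˡ (not c) x w (λ z → join (not c) x z (not-not c x∈c)))
                            (valency-adjacent (not c) w (λ z → join (not c) w z (not-not c w∈c))))) ⟩
      κ * (Y c * Y c) + s * A x w - p * δ x w - size (not c)
        ≈⟨ solve 4 (λ k r t n → k :+ r :- t :- n := r :- t :+ k :- n) refl (κ * (Y c * Y c)) (s * A x w) (p * δ x w) (size (not c)) ⟩
      s * A x w - p * δ x w + κ * (Y c * Y c) - size (not c) ∎

    -- A matrix whose entries depend on the types of their positions only.
    record Typed (M : Fin n → Fin n → Carrier) : Set (c ⊔ ℓ) where
      constructor typed
      field
        value   : Type → Carrier
        correct : ∀ x z → M x z ≈ value (type x z)

    typed-resp : ∀ {M N} → (∀ x z → M x z ≈ N x z) → Typed M → Typed N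
    typed-resp e (typed f p) = typed f (λ x z → trans (sym (e x z)) (p x z))

    typed-+ : ∀ {M N} → Typed M → Typed N → Typed (λ x z → M x z + N x z)
    typed-+ (typed f p) (typed g q) = typed (λ t → f t + g t) (λ x z → +-cong (p x z) (q x z))

    typed-* : ∀ {M N} → Typed M → Typed N → Typed (λ x z → M x z * N x z)
    typed-* (typed f p) (typed g q) = typed (λ t → f t * g t) (λ x z → *-cong (p x z) (q x z))

    typed-const : ∀ k → Typed (λ _ _ → k)
    typed-const k = typed (λ _ → k) (λ _ _ → refl)

    typed-row : (f : Bool → Carrier) → Typed (λ x _ → f (cls x))
    typed-row f = typed (λ t → f (proj₁ t)) (λ _ _ → refl)

    typed-col : (f : Bool → Carrier) → Typed (λ _ z → f (cls z))
    typed-col f = typed (λ t → f (proj₁ (proj₂ t))) (λ _ _ → refl)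

    typed-A : Typed A
    typed-A = typed (λ t → [ proj₁ (proj₂ (proj₂ t)) ]) (λ _ _ → refl)

    typed-δ : Typed δ
    typed-δ = typed (λ t → [ proj₂ (proj₂ (proj₂ t)) ]) (λ _ _ → refl)

    typed-transpose : ∀ {M} → Typed M → Typed (λ x z → M z x)
    typed-transpose (typed f p) = typed (λ (c , c′ , a , d) → f (c′ , c , a , d)) (λ x z → trans (p z x)
      (reflexive (≡.cong₂ (λ a d → f (cls z , cls x , a , d)) (symmetric z x) (does-sym z x))))
      where
      does-sym : ∀ (x z : Fin n) → does (x Fin.≟ z) ≡ does (z Fin.≟ x)
      does-sym x z with x Fin.≟ z | z Fin.≟ x
      ... | yes _      | yes _     = ≡.refl
      ... | no _       | no _      = ≡.refl
      ... | yes x≡z    | no z≢x    = ⊥-elim (z≢x (≡.sym x≡z))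
      ... | no x≢z     | yes z≡x   = ⊥-elim (x≢z (≡.sym z≡x))

    typed-valency : ∀ c → Typed (λ x _ → valency c x)
    typed-valency c = typed-resp eq (typed-+ (typed-* (typed-row (λ b → [ is c b ])) (typed-const (D c - size (not c))))
                                             (typed-* (typed-row (λ b → [ is (not c) b ])) (typed-const (size c))))
      where
      eq : ∀ x (z : Fin n) → χ c x * (D c - size (not c)) + χ (not c) x * size c ≈ valency c x
      eq x z with same-or-not c (cls x)
      ... | inj₁ x∈c = begin
        χ c x * (D c - size (not c)) + χ (not c) x * size c
          ≈⟨ +-cong (*-congʳ (χ-hit c x∈c)) (*-congʳ (χ-miss (not c) (not-not c x∈c))) ⟩
        1# * (D c - size (not c)) + 0# * size c
          ≈⟨ solve 2 (λ p q → :1 :* p :+ :0 :* q := p) refl (D c - size (not c)) (size c) ⟩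
        D c - size (not c)
          ≈⟨ sym (valency-class c x x∈c) ⟩
        valency c x ∎
      ... | inj₂ x∉c = begin
        χ c x * (D c - size (not c)) + χ (not c) x * size c
          ≈⟨ +-cong (*-congʳ (χ-miss c x∉c)) (*-congʳ (χ-hit (not c) x∉c)) ⟩
        0# * (D c - size (not c)) + 1# * size c
          ≈⟨ solve 2 (λ p q → :0 :* p :+ :1 :* q := q) refl (D c - size (not c)) (size c) ⟩
        size c
          ≈⟨ sym (valency-adjacent c x (λ z → join c x z x∉c)) ⟩
        valency c x ∎

    typed-common : ∀ c → Typed (common c)
    typed-common c = typed-resp eq (typed-+
        (typed-* (typed-row (λ b → [ is c b ])) (typed-+
          (typed-* (typed-col (λ b → [ is c b ])) (typed-+ (typed-+ (typed-* (typed-const s) typed-A) (typed-* (typed-const (- p)) typed-δ))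
                                                           (typed-const (κ * (Y c * Y c) - size (not c)))))
          (typed-* (typed-col (λ b → [ is (not c) b ])) (typed-valency c))))
        (typed-* (typed-row (λ b → [ is (not c) b ])) (typed-transpose (typed-valency c))))
      where
      E′ : Fin n → Fin n → Carrier
      E′ x z = s * A x z + - p * δ x z + (κ * (Y c * Y c) - size (not c))

      eq : ∀ x z → χ c x * (χ c z * E′ x z + χ (not c) z * valency c x) + χ (not c) x * valency c z ≈ common c x z
      eq x z with same-or-not c (cls x) | same-or-not c (cls z)
      ... | inj₂ x∉c | _ = begin
        χ c x * (χ c z * E′ x z + χ (not c) z * valency c x) + χ (not c) x * valency c z
          ≈⟨ +-cong (*-congʳ (χ-miss c x∉c)) (*-congʳ (χ-hit (not c) x∉c)) ⟩
        0# * (χ c z * E′ x z + χ (not c) z * valency c x) + 1# * valency c z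
          ≈⟨ solve 2 (λ p q → :0 :* p :+ :1 :* q := q) refl _ (valency c z) ⟩
        valency c z
          ≈⟨ sym (common-adjacentˡ c x z (λ w → join c x w x∉c)) ⟩
        common c x z ∎
      ... | inj₁ x∈c | inj₂ z∉c = begin
        χ c x * (χ c z * E′ x z + χ (not c) z * valency c x) + χ (not c) x * valency c z
          ≈⟨ +-cong (*-cong (χ-hit c x∈c) (+-cong (*-congʳ (χ-miss c z∉c)) (*-congʳ (χ-hit (not c) z∉c))))
                    (*-congʳ (χ-miss (not c) (not-not c x∈c))) ⟩
        1# * (0# * E′ x z + 1# * valency c x) + 0# * valency c z
          ≈⟨ solve 3 (λ p q r → :1 :* (:0 :* p :+ :1 :* q) :+ :0 :* r := q) refl (E′ x z) (valency c x) (valency c z) ⟩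
        valency c x
          ≈⟨ sym (common-adjacentʳ c x z (λ w → join′ c z w z∉c)) ⟩
        common c x z ∎
      ... | inj₁ x∈c | inj₁ z∈c = begin
        χ c x * (χ c z * E′ x z + χ (not c) z * valency c x) + χ (not c) x * valency c z
          ≈⟨ +-cong (*-cong (χ-hit c x∈c) (+-cong (*-congʳ (χ-hit c z∈c)) (*-congʳ (χ-miss (not c) (not-not c z∈c)))))
                    (*-congʳ (χ-miss (not c) (not-not c x∈c))) ⟩
        1# * (1# * E′ x z + 0# * valency c x) + 0# * valency c z
          ≈⟨ solve 3 (λ p q r → :1 :* (:1 :* p :+ :0 :* q) :+ :0 :* r := p) refl (E′ x z) (valency c x) (valency c z) ⟩
        E′ x z
          ≈⟨ solve 6 (λ s a p d k n → s :* a :+ :- p :* d :+ (k :- n) := s :* a :- p :* d :+ k :- n) refl s (A x z) p (δ x z) (κ * (Y c * Y c)) (size (not c)) ⟩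
        s * A x z - p * δ x z + κ * (Y c * Y c) - size (not c)
          ≈⟨ sym (common-class c x z x∈c z∈c) ⟩
        common c x z ∎

    -- Families h such that the matrix of the sums of h x z y over z is typed.
    Summable : (Fin n → Fin n → Fin n → Carrier) → Set _
    Summable h = Typed (λ x y → sum (λ z → h x z y))

    summable-+ : ∀ {h k} → Summable h → Summable k → Summable (λ x z y → h x z y + k x z y)
    summable-+ {h} {k} S T = typed-resp (λ x y → sym (∑-distrib-+ (λ z → h x z y) (λ z → k x z y))) (typed-+ S T)

    summable-* : ∀ {m h} → Typed m → Summable h → Summable (λ x z y → m x y * h x z y)
    summable-* {m} {h} T S = typed-resp (λ x y → *-distribˡ-sum (m x y) (λ z → h x z y)) (typed-* T S)

    summable-resp : ∀ {h k} → (∀ x z y → h x z y ≈ k x z y) → Summable h → Summable k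
    summable-resp e = typed-resp (λ x y → sum-cong (λ z → e x z y))

    -- A typed matrix is, on each pair of classes, a combination of the
    -- all-ones matrix, A and the identity.
    private
      coefficient : (Type → Carrier) → Bool → Bool → Fin 3 → Carrier
      coefficient f c c′ 0F           = f (c , c′ , false , false)
      coefficient f c c′ 1F       = f (c , c′ , true , false) - f (c , c′ , false , false)
      coefficient f c c′ 2F = f (c , c′ , false , true) - f (c , c′ , false , false)

      linear : ∀ (f : Type → Carrier) x z → let k = coefficient f (cls x) (cls z) in
        f (type x z) ≈ k 0F + k 1F * A x z + k 2F * δ x z
      linear f x z with adjacent? x z in adj | x Fin.≟ z
      ... | true  | yes ≡.refl = case ≡.trans (≡.sym adj) (loopless x) of λ ()
      ... | true  | no _  = solve 3 (λ p q r → q := p :+ (q :- p) :* :1 :+ (r :- p) :* :0) refl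
                              (f (cls x , cls z , false , false)) (f (cls x , cls z , true , false)) (f (cls x , cls z , false , true))
      ... | false | yes _ = solve 3 (λ p q r → r := p :+ (q :- p) :* :0 :+ (r :- p) :* :1) refl
                              (f (cls x , cls z , false , false)) (f (cls x , cls z , true , false)) (f (cls x , cls z , false , true))
      ... | false | no _  = solve 3 (λ p q r → p := p :+ (q :- p) :* :0 :+ (r :- p) :* :0) refl
                              (f (cls x , cls z , false , false)) (f (cls x , cls z , true , false)) (f (cls x , cls z , false , true))

      typed-product : ∀ {M N} → Typed M → Typed N → Typed (λ x y → sum (λ z → M x z * N z y))
      typed-product {M} {N} (typed f p) (typed g q) = typed-resp
        (λ x y → sym (trans (split true (λ z → M x z * N z y))
          (+-cong (sum-cong (λ z → *-congˡ (*-cong (p x z) (q z y)))) (sum-cong (λ z → *-congˡ (*-cong (p x z) (q z y)))))))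
        (typed-+ (part true) (part false))
        where
        part : ∀ c → Summable (λ x z y → χ c z * (f (type x z) * g (type z y)))
        part c = summable-resp expand (summable-+ (summable-+
            (summable-+ (summable-+ (summable-* (typed-* P P′) S₁) (summable-* (typed-* P Q′) S₂)) (summable-* (typed-* P T′) S₃))
            (summable-+ (summable-+ (summable-* (typed-* Q P′) S₄) (summable-* (typed-* Q Q′) S₅)) (summable-* (typed-* Q T′) S₆)))
            (summable-+ (summable-+ (summable-* (typed-* T P′) S₇) (summable-* (typed-* T Q′) S₈)) (summable-* (typed-* T T′) S₉)))
          where
          k  = λ i b → coefficient f b c i
          k′ = λ i b → coefficient g c b i
          P  = typed-row (k 0F)
          Q  = typed-row (k 1F)
          T  = typed-row (k 2F)
          P′ = typed-col (k′ 0F)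
          Q′ = typed-col (k′ 1F)
          T′ = typed-col (k′ 2F)

          S₁ : Summable (λ x z y → χ c z)
          S₁ = typed-const (size c)
          S₂ : Summable (λ x z y → χ c z * A z y)
          S₂ = typed-resp (λ x y → sum-cong (λ z → *-congˡ {x = χ c z} (A-sym y z))) (typed-transpose (typed-valency c))
          S₃ : Summable (λ x z y → χ c z * δ z y)
          S₃ = typed-resp (λ x y → sym (sum-δʳ y (χ c))) (typed-col (λ b → [ is c b ]))
          S₄ : Summable (λ x z y → χ c z * A x z)
          S₄ = typed-valency c
          S₅ : Summable (λ x z y → χ c z * (A x z * A z y))
          S₅ = typed-common c
          S₆ : Summable (λ x z y → (χ c z * A x z) * δ z y)
          S₆ = typed-resp (λ x y → sym (sum-δʳ y (λ z → χ c z * A x z))) (typed-* (typed-col (λ b → [ is c b ])) typed-A)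
          S₇ : Summable (λ x z y → δ x z * χ c z)
          S₇ = typed-resp (λ x y → sym (sum-δ x (χ c))) (typed-row (λ b → [ is c b ]))
          S₈ : Summable (λ x z y → δ x z * (χ c z * A z y))
          S₈ = typed-resp (λ x y → sym (sum-δ x (λ z → χ c z * A z y))) (typed-* (typed-row (λ b → [ is c b ])) typed-A)
          S₉ : Summable (λ x z y → δ x z * (χ c z * δ z y))
          S₉ = typed-resp (λ x y → sym (sum-δ x (λ z → χ c z * δ z y))) (typed-* (typed-row (λ b → [ is c b ])) typed-δ)

          expand : ∀ x z y → _ ≈ χ c z * (f (type x z) * g (type z y))
          expand x z y = trans
            (solve 11 (λ χ a d a′ d′ P Q T P′ Q′ T′ →
                (P :* P′ :* χ :+ P :* Q′ :* (χ :* a′) :+ P :* T′ :* (χ :* d′)) :+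
                (Q :* P′ :* (χ :* a) :+ Q :* Q′ :* (χ :* (a :* a′)) :+ Q :* T′ :* (χ :* a :* d′)) :+
                (T :* P′ :* (d :* χ) :+ T :* Q′ :* (d :* (χ :* a′)) :+ T :* T′ :* (d :* (χ :* d′)))
                := χ :* ((P :+ Q :* a :+ T :* d) :* (P′ :+ Q′ :* a′ :+ T′ :* d′)))
              refl (χ c z) (A x z) (δ x z) (A z y) (δ z y)
              (k 0F (cls x)) (k 1F (cls x)) (k 2F (cls x))
              (k′ 0F (cls y)) (k′ 1F (cls y)) (k′ 2F (cls y)))
            (χ-cong c z (λ { ≡.refl → sym (*-cong (linear f x z) (linear g z y)) }))

    open Matrices rawRing using (CoherentClosure; IsCoherentAlgebra; closure-least; adjacencyMatrix; HasCoherentRank)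

    typed-coherent : IsCoherentAlgebra Typed
    typed-coherent = record
      { respects-≈ = typed-resp
      ; +-closed   = typed-+
      ; •-closed   = λ a → typed-* (typed-const a)
      ; *-closed   = typed-product
      ; ∘-closed   = typed-*
      ; ᵀ-closed   = typed-transpose
      ; I-member   = typed-δ
      ; J-member   = typed-const 1#
      }

    closure-typed : ∀ {M} → CoherentClosure (adjacencyMatrix Γ) M → Typed M
    closure-typed = closure-least typed-coherent typed-A

    -- If one side of the join is complete or edgeless (or empty), then only seven
    -- types occur, so that the rank is at most seven.
    module _ (c e : Bool)
      (uniform : ∀ x z → cls x ≡ c → cls z ≡ c → x ≢ z → adjacent? x z ≡ e) where

      -- The seven types.
      decode : Fin 7 → Type
      decode 0F = c , c , false , true
      decode 1F = c , c , e , false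
      decode 2F = not c , not c , false , true
      decode 3F = not c , not c , true , false
      decode 4F = not c , not c , false , false
      decode 5F = c , not c , true , false
      decode 6F = not c , c , true , false

      -- Every type that occurs is in the list.
      encode : ∀ x z → ∃[ i ] type x z ≡ decode i
      encode x z with same-or-not c (cls x) | same-or-not c (cls z) | x Fin.≟ z
      ... | inj₁ p | inj₁ q | yes ≡.refl = 0F , type-cong p q (loopless x) ≡.refl
      ... | inj₁ p | inj₁ q | no x≢z     = 1F , type-cong p q (uniform x z p q x≢z) ≡.refl
      ... | inj₂ p | inj₂ q | yes ≡.refl = 2F , type-cong p q (loopless x) ≡.refl
      ... | inj₂ p | inj₂ q | no x≢z with adjacent? x z
      ...   | true  = 3F , type-cong p q ≡.refl ≡.refl
      ...   | false = 4F , type-cong p q ≡.refl ≡.refl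
      encode x z | inj₁ p | inj₂ q | yes ≡.refl = ⊥-elim (not-≢ c (≡.trans (≡.sym q) p))
      encode x z | inj₂ p | inj₁ q | yes ≡.refl = ⊥-elim (not-≢ c (≡.trans (≡.sym p) q))
      encode x z | inj₁ p | inj₂ q | no _ = 5F , type-cong p q (join′ c z x q p) ≡.refl
      encode x z | inj₂ p | inj₁ q | no _ = 6F , type-cong p q (join c x z p q) ≡.refl

      rank≢8 : ¬ HasCoherentRank Γ 8
      rank≢8 rank8 = RankTools.tooFewTypes F (CoherentClosure (adjacencyMatrix Γ)) rank8 (ℕ.n<1+n 7)
        (λ x z → proj₁ (encode x z)) (λ M M∈W x z x′ z′ e → determined (closure-typed M∈W) x z x′ z′ e)
        where
        determined : ∀ {M} → Typed M → ∀ x z x′ z′ → proj₁ (encode x z) ≡ proj₁ (encode x′ z′) → M x z ≈ M x′ z′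
        determined {M} (typed f p) x z x′ z′ e = begin
          M x z            ≈⟨ p x z ⟩
          f (type x z)     ≡⟨ ≡.cong f (≡.trans (proj₂ (encode x z)) (≡.trans (≡.cong decode e) (≡.sym (proj₂ (encode x′ z′))))) ⟩
          f (type x′ z′)   ≈⟨ sym (p x′ z′) ⟩
          M x′ z′          ∎

-- Division of the vertices by degree

does-true : ∀ {p} {P : Set p} (P? : Dec P) → does P? ≡ true → P
does-true (yes p) _ = p

does-false : ∀ {p} {P : Set p} (P? : Dec P) → does P? ≡ false → ¬ P
does-false (no ¬p) _ = ¬p

-- A division into two classes by degree, with a representative of each class.
-- The numbers of neighbours in either class depend on the class of a vertex
-- only, and the coherent closure tells the classes apart.
record Division {c ℓ} (F : Field₀ c ℓ) {n} (Γ : Graph n) : Set (c ⊔ ℓ) where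
  open FieldTools F
  open Graph Γ
  field
    cls      : Fin n → Bool
    rep      : Bool → Fin n
    cls-rep  : ∀ c → cls (rep c) ≡ c
  open Classes R Γ cls
  field
    degree-rep       : ∀ x → sum (A x) ≈ sum (A (rep (cls x)))
    degrees-distinct : ¬ (sum (A (rep true)) ≈ sum (A (rep false)))
    valency-rep      : ∀ c x → valency c x ≈ valency c (rep (cls x))
    recorded         : Matrices.CoherentClosure rawRing A (λ x _ → χ true x)

module DivisionByDegree {c ℓ} (F : Field₀ c ℓ) {n} (Γ : Graph n) (E : RankOneEquation F Γ)
  (rank8 : Matrices.HasCoherentRank (CommutativeRing.rawRing (Field₀.commutativeRing F)) Γ 8) where
  open FieldTools F
  open Graph Γ
  open RankOneEquation E
  open ClosureTools F Γ rank8
  open Matrices rawRing using (CoherentClosure; resp)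
  open Relation.Binary.Reasoning.Setoid setoid

  degree : Fin n → Carrier
  degree x = sum (A x)

  -- A regular graph is a join with one side empty.
  irregular : ∃[ x ] ¬ (degree x ≈ degree o)
  irregular = Fin.¬∀⟶∃¬ n _ (λ x → degree x ≈? degree o) λ regular →
    Join.TypedMatrices.rank≢8 F Γ E (λ _ → true) (λ _ → degree o) (λ _ → y o)
      regular (λ x → degree⇒y x o (regular x)) (λ c x z p q → ⊥-elim (not-≢ c (≡.trans (≡.sym p) q)))
      false false (λ _ _ ()) rank8

  private
    o′ : Fin n
    o′ = proj₁ irregular

    -- Vertices told apart by a recorded function.
    Separated : Fin n → Fin n → Set _
    Separated x z = Σ[ f ∈ (Fin n → Carrier) ] Recorded f × ¬ (f x ≈ f z)

    turn : ∀ {x z} → Separated x z → Separated z x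
    turn (f , r , x≉z) = f , r , λ e → x≉z (sym e)

    no-triple : ∀ x z w → Separated x z → Separated x w → Separated z w → ⊥
    no-triple x z w x|z x|w z|w = no-three (λ { 0F → x ; 1F → z ; 2F → w }) λ where
      0F 0F i≢i → ⊥-elim (i≢i ≡.refl)
      1F 1F i≢i → ⊥-elim (i≢i ≡.refl)
      2F 2F i≢i → ⊥-elim (i≢i ≡.refl)
      0F 1F _   → x|z
      0F 2F _   → x|w
      1F 2F _   → z|w
      1F 0F _   → turn x|z
      2F 0F _   → turn x|w
      2F 1F _   → turn z|w

    -- Any degree other than that of o is the degree of o′, lest three vertices
    -- have distinct degrees.
    cls : Fin n → Bool
    cls x = does (degree x ≈? degree o)

    degree-true : ∀ x → cls x ≡ true → degree x ≈ degree o
    degree-true x = does-true (degree x ≈? degree o)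

    degree-false : ∀ x → cls x ≡ false → degree x ≈ degree o′
    degree-false x e = by-cases (degree x ≈? degree o′)
      where
      by-cases : Dec (degree x ≈ degree o′) → degree x ≈ degree o′
      by-cases (yes d)  = d
      by-cases (no ≉o′) = ⊥-elim (no-triple x o o′
        (degree , recorded-degree , does-false (degree x ≈? degree o) e)
        (degree , recorded-degree , ≉o′) (degree , recorded-degree , λ d → proj₂ irregular (sym d)))

    rep : Bool → Fin n
    rep true  = o
    rep false = o′

    cls-rep : ∀ c → cls (rep c) ≡ c
    cls-rep true  = dec-true (degree o ≈? degree o) refl
    cls-rep false = dec-false (degree o′ ≈? degree o) (proj₂ irregular)

    degree-rep : ∀ x → degree x ≈ degree (rep (cls x))
    degree-rep x = go (cls x) ≡.refl
      where
      go : ∀ c → cls x ≡ c → degree x ≈ degree (rep c)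
      go true  e = degree-true x e
      go false e = degree-false x e

  open Classes R Γ cls using (χ; χ-hit; χ-miss; χ-complete; valency)

  -- The indicator of a class is an affine function of the degree.
  private
    gap≉0 : ¬ (degree o - degree o′ ≈ 0#)
    gap≉0 e = proj₂ irregular (sym (x-y≈0⇒x≈y e))

    i : Carrier
    i = proj₁ (inverse (degree o - degree o′) gap≉0)

    gap*i≈1 : (degree o - degree o′) * i ≈ 1#
    gap*i≈1 = proj₂ (inverse (degree o - degree o′) gap≉0)

    χ-true : ∀ x c → cls x ≡ c → i * degree x + - (i * degree o′) ≈ χ true x
    χ-true x true e = begin
      i * degree x + - (i * degree o′)  ≈⟨ +-congʳ (*-congˡ (degree-true x e)) ⟩
      i * degree o + - (i * degree o′)  ≈⟨ solve 3 (λ i p q → i :* p :+ :- (i :* q) := (p :- q) :* i) refl i (degree o) (degree o′) ⟩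
      (degree o - degree o′) * i        ≈⟨ gap*i≈1 ⟩
      1#                                ≈⟨ sym (χ-hit true e) ⟩
      χ true x                          ∎
    χ-true x false e = begin
      i * degree x + - (i * degree o′)   ≈⟨ +-congʳ (*-congˡ (degree-false x e)) ⟩
      i * degree o′ + - (i * degree o′)  ≈⟨ -‿inverseʳ (i * degree o′) ⟩
      0#                                 ≈⟨ sym (χ-miss true e) ⟩
      χ true x                           ∎

    χ-false : ∀ x → - 1# * χ true x + 1# ≈ χ false x
    χ-false x = begin
      - 1# * χ true x + 1#                      ≈⟨ +-congˡ (sym (χ-complete true x)) ⟩
      - 1# * χ true x + (χ true x + χ false x)  ≈⟨ solve 2 (λ p q → :- :1 :* p :+ (p :+ q) := q) refl (χ true x) (χ false x) ⟩
      χ false x                                 ∎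

  recorded-resp : ∀ f g → (∀ x → f x ≈ g x) → Recorded f → Recorded g
  recorded-resp f g e = resp {M = λ x _ → f x} {N = λ x _ → g x} (λ x _ → e x)

  recorded-χ : ∀ c → Recorded (χ c)
  recorded-χ true = recorded-resp (λ x → i * degree x + - (i * degree o′)) (χ true) (λ x → χ-true x (cls x) ≡.refl)
    (recorded-affine i (- (i * degree o′)) recorded-degree)
  recorded-χ false = recorded-resp (λ x → - 1# * χ true x + 1#) (χ false) χ-false
    (recorded-affine (- 1#) 1# (recorded-χ true))

  recorded-valency : ∀ c → Recorded (valency c)
  recorded-valency c = recorded-resp (λ x → sum (λ z → A x z * χ c z)) (valency c)
    (λ x → sum-cong (λ z → *-comm (A x z) (χ c z))) (neighbour-sum (recorded-χ c))

  division : Division F Γ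
  division = record
    { cls              = cls
    ; rep              = rep
    ; cls-rep          = cls-rep
    ; degree-rep       = degree-rep
    ; degrees-distinct = λ d → proj₂ irregular (sym d)
    ; valency-rep      = valency-rep
    ; recorded         = recorded-χ true
    }
    where
    valency-rep : ∀ c x → valency c x ≈ valency c (rep (cls x))
    valency-rep c x = by-cases (valency c x ≈? valency c (rep (cls x)))
      where
      apart : ∀ z b → cls z ≡ b → ¬ (χ true z ≈ χ true (rep (not b)))
      apart z true  e d = 0≉1 (trans (sym (χ-miss true (cls-rep false))) (trans (sym d) (χ-hit true e)))
      apart z false e d = 0≉1 (trans (sym (χ-miss true e)) (trans d (χ-hit true (cls-rep true))))

      by-cases : Dec (valency c x ≈ valency c (rep (cls x))) → valency c x ≈ valency c (rep (cls x))
      by-cases (yes e) = e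
      by-cases (no  ≉) = ⊥-elim (no-triple x (rep (cls x)) (rep (not (cls x)))
        (valency c , recorded-valency c , ≉)
        (χ true , recorded-χ true , apart x (cls x) ≡.refl)
        (χ true , recorded-χ true , apart (rep (cls x)) (cls x) (cls-rep (cls x))))

-- Exclusion of joins

≤-of-products : ∀ μ q b l → 0 ℕ.< μ ℕ.+ q → b ℕ.* (μ ℕ.+ q) ≡ μ ℕ.* l → b ℕ.≤ l
≤-of-products ℕ.zero    (ℕ.suc q) b l pos e = ≡.subst (ℕ._≤ l) (≡.sym b≡0) ℕ.z≤n
  where
  b≡0 : b ≡ 0
  b≡0 = ℕ.m*n≡0⇒m≡0 b (ℕ.suc q) e
≤-of-products (ℕ.suc μ) q b l pos e = ℕ.*-cancelˡ-≤ (ℕ.suc μ) (begin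
  ℕ.suc μ ℕ.* b            ≡⟨ ℕ.*-comm (ℕ.suc μ) b ⟩
  b ℕ.* ℕ.suc μ            ≤⟨ ℕ.*-monoʳ-≤ b (ℕ.m≤m+n (ℕ.suc μ) q) ⟩
  b ℕ.* (ℕ.suc μ ℕ.+ q)    ≡⟨ e ⟩
  ℕ.suc μ ℕ.* l            ∎)
  where open ℕ.≤-Reasoning

-- If two factors are at least u = t + b > 0 and their product is u squared, then
-- both are u.
square-factors : ∀ t b l l′ → 0 ℕ.< t → b ℕ.≤ l → b ℕ.≤ l′ →
  (t ℕ.+ b) ℕ.* (t ℕ.+ b) ≡ (t ℕ.+ l) ℕ.* (t ℕ.+ l′) → l ≡ l′
square-factors t b l l′ (ℕ.s≤s _) b≤l b≤l′ e
  with ℕ.m≤n⇒∃[o]m+o≡n b≤l | ℕ.m≤n⇒∃[o]m+o≡n b≤l′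
... | (f , ≡.refl) | (f′ , ≡.refl) = ≡.cong (b ℕ.+_) (≡.trans f≡0 (≡.sym f′≡0))
  where
  u = t ℕ.+ b

  expand : ∀ t b f f′ → (t ℕ.+ (b ℕ.+ f)) ℕ.* (t ℕ.+ (b ℕ.+ f′))
         ≡ (t ℕ.+ b) ℕ.* (t ℕ.+ b) ℕ.+ ((t ℕ.+ b) ℕ.* f ℕ.+ ((t ℕ.+ b) ℕ.* f′ ℕ.+ f ℕ.* f′))
  expand = ℕ-solver.solve-∀

  rest≡0 : u ℕ.* f ℕ.+ (u ℕ.* f′ ℕ.+ f ℕ.* f′) ≡ 0
  rest≡0 = ℕ.+-cancelˡ-≡ (u ℕ.* u) _ 0 (≡.trans (≡.sym (expand t b f f′)) (≡.trans (≡.sym e) (≡.sym (ℕ.+-identityʳ (u ℕ.* u)))))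

  f≡0 : f ≡ 0
  f≡0 = ℕ.m*n≡0⇒m≡0 f u (≡.trans (ℕ.*-comm f u) (ℕ.m+n≡0⇒m≡0 (u ℕ.* f) rest≡0))

  f′≡0 : f′ ≡ 0
  f′≡0 = ℕ.m*n≡0⇒m≡0 f′ u (≡.trans (ℕ.*-comm f′ u) (ℕ.m+n≡0⇒m≡0 (u ℕ.* f′) (ℕ.m+n≡0⇒n≡0 (u ℕ.* f) rest≡0)))

-- The classes of a division by degree are not completely joined.  Otherwise
-- neither class is complete or edgeless.  With natural numbers q, b, and μ, k, l
-- for either class, where k is the degree within the class and l the number of
-- other vertices not adjacent to a given one, the equation gives p = - q,
-- s = q - 1 - b and k = μ + q; counting walks of length two in a class gives
-- b k = μ l, so that b is at most l, while rank one gives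
-- (t + b)(t + b) = (t + l)(t + l′) with a positive t.  So l = l′ = b, and then
-- the degrees are equal.
module JoinExcluded {c ℓ} (F : Field₀ c ℓ) {n} (Γ : Graph n) (E : RankOneEquation F Γ)
  (rank8 : Matrices.HasCoherentRank (CommutativeRing.rawRing (Field₀.commutativeRing F)) Γ 8)
  (Δ : Division F Γ)
  (joined : ∀ x z → Division.cls Δ x ≡ true → Division.cls Δ z ≡ false → Graph.adjacent? Γ x z ≡ true) where
  open FieldTools F
  open Graph Γ
  open RankOneEquation E
  open Division Δ
  open Classes R Γ cls
  open Relation.Binary.Reasoning.Setoid setoid

  private
    D Y : Bool → Carrier
    D c = sum (A (rep c))
    Y c = y (rep c)

    join : ∀ c x z → cls x ≡ not c → cls z ≡ c → adjacent? x z ≡ true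
    join true  x z p q = ≡.trans (symmetric x z) (joined z x q p)
    join false x z p q = joined x z p q

  open Join F Γ E cls D Y using (module TypedMatrices)
  open TypedMatrices degree-rep (λ x → degree⇒y x (rep (cls x)) (degree-rep x)) join

  private
    nonuniform : ∀ c e → ∃[ x ] ∃[ z ] (cls x ≡ c × cls z ≡ c × x ≢ z × adjacent? x z ≡ not e)
    nonuniform c e = by-cases (Fin.any? (λ x → Fin.any? (λ z →
        (cls x Bool.≟ c) ×-dec (cls z Bool.≟ c) ×-dec ¬? (x Fin.≟ z) ×-dec (adjacent? x z Bool.≟ not e))))
      where
      by-cases : Dec _ → _
      by-cases (yes found) = found
      by-cases (no  none)  = ⊥-elim (rank≢8 c e (λ x z p q x≢z →
        ≡.trans (Bool.¬-not (λ a → none (x , z , p , q , x≢z , a))) (Bool.not-involutive e)) rank8)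

    -- Within class c, a vertex has k c neighbours and l c other vertices not
    -- adjacent to it, and two nonadjacent vertices have μ c common neighbours.
    k μ l : Bool → ℕ
    k c = count (λ z → member c z ∧ adjacent? (rep c) z)
    l c = count (λ z → member c z ∧ (not (adjacent? (rep c) z) ∧ not (does (rep c Fin.≟ z))))
    μ c = let (x , w , _) = nonuniform c true in count (λ z → member c z ∧ (adjacent? x z ∧ adjacent? z w))

    valency-k : ∀ c x → cls x ≡ c → valency c x ≈ ι (k c)
    valency-k c x x∈c = trans (valency-class c x x∈c) (trans (sym (valency-class c (rep c) (cls-rep c))) (valency-count c (rep c)))

    not-loop : ∀ {x z} → adjacent? x z ∧ does (x Fin.≟ z) ≡ false
    not-loop {x} {z} with x Fin.≟ z
    ... | yes ≡.refl = ≡.trans (Bool.∧-identityʳ (adjacent? x x)) (loopless x)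
    ... | no _       = Bool.∧-zeroʳ (adjacent? x z)

    -- A vertex is equal, adjacent, or neither.
    three-way : ∀ i a d → a ∧ d ≡ false → [ i ] ≈ [ d ] * [ i ] + [ i ] * [ a ] + [ i ∧ (not a ∧ not d) ]
    three-way true  true  false _ = solve 0 (:1 := :0 :* :1 :+ :1 :* :1 :+ :0) refl
    three-way true  false true  _ = solve 0 (:1 := :1 :* :1 :+ :1 :* :0 :+ :0) refl
    three-way true  false false _ = solve 0 (:1 := :0 :* :1 :+ :1 :* :0 :+ :1) refl
    three-way false a     d     _ = solve 2 (λ a d → :0 := d :* :0 :+ :0 :* a :+ :0) refl [ a ] [ d ]

    size-k : ∀ c → size c ≈ 1# + ι (k c) + ι (l c)
    size-k c = begin
      sum (χ c)
        ≈⟨ sum-cong (λ z → three-way (member c z) (adjacent? r z) (does (r Fin.≟ z)) (not-loop {r} {z})) ⟩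
      sum (λ z → δ r z * χ c z + χ c z * A r z + [ rest z ])
        ≈⟨ trans (∑-distrib-+ (λ z → δ r z * χ c z + χ c z * A r z) (λ z → [ rest z ]))
             (+-congʳ (∑-distrib-+ (λ z → δ r z * χ c z) (λ z → χ c z * A r z))) ⟩
      sum (λ z → δ r z * χ c z) + valency c r + sum (λ z → [ rest z ])
        ≈⟨ +-cong (+-cong (trans (sum-δ r (χ c)) (χ-hit c (cls-rep c))) (valency-count c r)) (sum-[] rest) ⟩
      1# + ι (k c) + ι (l c) ∎
      where
      r = rep c
      rest : Fin n → Bool
      rest z = member c z ∧ (not (adjacent? r z) ∧ not (does (r Fin.≟ z)))

    -- The number of common neighbours within a class of two of its
    -- nonadjacent vertices.
    B : Bool → Carrier
    B c = κ * (Y c * Y c) - size (not c)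

    common-B : ∀ c x w → cls x ≡ c → cls w ≡ c → common c x w ≈ s * A x w - p * δ x w + B c
    common-B c x w x∈c w∈c = trans (common-class c x w x∈c w∈c) (+-assoc _ _ _)

    μ-B : ∀ c → ι (μ c) ≈ B c
    μ-B c = let (x , w , x∈c , w∈c , x≢w , x≁w) = nonuniform c true in begin
      ι (μ c)                      ≈⟨ sym (common-count c x w) ⟩
      common c x w                 ≈⟨ common-B c x w x∈c w∈c ⟩
      s * A x w - p * δ x w + B c  ≈⟨ +-congʳ (+-cong (*-congˡ ([]-cong x≁w)) (-‿cong (*-congˡ (δ-≢ x≢w)))) ⟩
      s * 0# - p * 0# + B c        ≈⟨ solve 3 (λ s p b → s :* :0 :- p :* :0 :+ b := b) refl s p (B c) ⟩
      B c                          ∎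

    k-B : ∀ c → ι (k c) ≈ B c - p
    k-B c = begin
      ι (k c)                      ≈⟨ sym (valency-count c r) ⟩
      valency c r                  ≈⟨ sym (common-self c r) ⟩
      common c r r                 ≈⟨ common-B c r r (cls-rep c) (cls-rep c) ⟩
      s * A r r - p * δ r r + B c  ≈⟨ +-congʳ (+-cong (*-congˡ ([]-cong (loopless r))) (-‿cong (*-congˡ (δ-refl r)))) ⟩
      s * 0# - p * 1# + B c        ≈⟨ solve 3 (λ s p b → s :* :0 :- p :* :1 :+ b := b :- p) refl s p (B c) ⟩
      B c - p                      ∎
      where r = rep c

    -- The number of neighbours of a vertex within its class which are not
    -- neighbours of a given nonadjacent vertex.
    q : ℕ
    q = let (x , w , _) = nonuniform true true in count (λ z → member true z ∧ (adjacent? x z ∧ not (adjacent? z w)))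

    k-q : ι (k true) ≈ ι (μ true) + ι q
    k-q = let (x , w , x∈ , _) = nonuniform true true
              rest = λ z → member true z ∧ (adjacent? x z ∧ not (adjacent? z w)) in begin
      ι (k true)
        ≈⟨ sym (valency-k true x x∈) ⟩
      valency true x
        ≈⟨ sum-cong (λ z → trans
             (solve 3 (λ i a b → i :* a := i :* (a :* b) :+ i :* (a :* (:1 :- b))) refl (χ true z) (A x z) (A z w))
             (+-congˡ (sym (trans ([∧] (member true z) (adjacent? x z ∧ not (adjacent? z w)))
               (*-congˡ (trans ([∧] (adjacent? x z) (not (adjacent? z w))) (*-congˡ ([not] (adjacent? z w))))))))) ⟩
      sum (λ z → χ true z * (A x z * A z w) + [ rest z ])
        ≈⟨ ∑-distrib-+ (λ z → χ true z * (A x z * A z w)) (λ z → [ rest z ]) ⟩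
      common true x w + sum (λ z → [ rest z ])
        ≈⟨ +-cong (common-count true x w) (sum-[] rest) ⟩
      ι (μ true) + ι q ∎

    p-q : p ≈ - ι q
    p-q = begin
      p                                  ≈⟨ solve 2 (λ p b → p := b :- (b :- p)) refl p (B true) ⟩
      B true - (B true - p)              ≈⟨ +-cong (sym (μ-B true)) (-‿cong (trans (sym (k-B true)) k-q)) ⟩
      ι (μ true) - (ι (μ true) + ι q)    ≈⟨ solve 2 (λ m q → m :- (m :+ q) := :- q) refl (ι (μ true)) (ι q) ⟩
      - ι q                              ∎

    k-μ : ∀ c → ι (k c) ≈ ι (μ c) + ι q
    k-μ c = begin
      ι (k c)            ≈⟨ k-B c ⟩
      B c - p            ≈⟨ +-cong (sym (μ-B c)) (-‿cong p-q) ⟩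
      ι (μ c) - - ι q    ≈⟨ solve 2 (λ m q → m :- (:- q) := m :+ q) refl (ι (μ c)) (ι q) ⟩
      ι (μ c) + ι q      ∎

    -- The same for a given adjacent vertex, which is itself not counted.
    b : ℕ
    b = let (x , w , _) = nonuniform true false in
      count (λ z → (member true z ∧ adjacent? x z) ∧ (not (adjacent? z w) ∧ not (does (z Fin.≟ w))))

    k-b : ι (k true) ≈ s + B true + 1# + ι b
    k-b = let (x , w , x∈ , w∈ , x≢w , x~w) = nonuniform true false
              rest = λ z → (member true z ∧ adjacent? x z) ∧ (not (adjacent? z w) ∧ not (does (z Fin.≟ w))) in begin
      ι (k true)
        ≈⟨ sym (valency-k true x x∈) ⟩
      valency true x
        ≈⟨ sum-cong (λ z → trans (sym ([∧] (member true z) (adjacent? x z)))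
             (trans (three-way (member true z ∧ adjacent? x z) (adjacent? z w) (does (z Fin.≟ w)) (not-loop {z} {w}))
               (+-congʳ (trans (+-cong (trans (*-comm _ _) (*-congʳ ([∧] (member true z) (adjacent? x z))))
                                      (*-congʳ ([∧] (member true z) (adjacent? x z))))
                 (+-congˡ (*-assoc (χ true z) (A x z) (A z w))))))) ⟩
      sum (λ z → χ true z * A x z * δ z w + χ true z * (A x z * A z w) + [ rest z ])
        ≈⟨ trans (∑-distrib-+ (λ z → χ true z * A x z * δ z w + χ true z * (A x z * A z w)) (λ z → [ rest z ]))
             (+-congʳ (∑-distrib-+ (λ z → χ true z * A x z * δ z w) (λ z → χ true z * (A x z * A z w)))) ⟩
      sum (λ z → χ true z * A x z * δ z w) + common true x w + sum (λ z → [ rest z ])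
        ≈⟨ +-cong (+-cong (trans (sum-δʳ w (λ z → χ true z * A x z)) (*-cong (χ-hit true w∈) ([]-cong x~w)))
             (trans (common-B true x w x∈ w∈) (+-congʳ (+-cong (*-congˡ ([]-cong x~w)) (-‿cong (*-congˡ (δ-≢ x≢w)))))))
             (sum-[] rest) ⟩
      1# * 1# + (s * 1# - p * 0# + B true) + ι b
        ≈⟨ solve 4 (λ s p t b → :1 :* :1 :+ (s :* :1 :- p :* :0 :+ t) :+ b := s :+ t :+ :1 :+ b) refl s p (B true) (ι b) ⟩
      s + B true + 1# + ι b ∎

    s-qb : s ≈ ι q - 1# - ι b
    s-qb = begin
      s
        ≈⟨ solve 3 (λ s t b → s := (s :+ t :+ :1 :+ b) :- t :- :1 :- b) refl s (B true) (ι b) ⟩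
      s + B true + 1# + ι b - B true - 1# - ι b
        ≈⟨ +-congʳ (+-congʳ (+-cong (trans (sym k-b) k-q) (-‿cong (sym (μ-B true))))) ⟩
      ι (μ true) + ι q - ι (μ true) - 1# - ι b
        ≈⟨ solve 3 (λ m q b → m :+ q :- m :- :1 :- b := q :- :1 :- b) refl (ι (μ true)) (ι q) (ι b) ⟩
      ι q - 1# - ι b ∎

    -- Walks of length two within a class, counted from a fixed vertex.
    walks : ∀ c → ι (k c) * ι (k c) ≈ s * ι (k c) - p + B c * size c
    walks c = begin
      ι (k c) * ι (k c)
        ≈⟨ *-congʳ (sym (valency-count c r)) ⟩
      valency c r * ι (k c)
        ≈⟨ two-step-walks c c r (ι (k c)) (valency-k c) ⟩
      sum (λ w → χ c w * common c r w)
        ≈⟨ sum-cong (λ w → trans (χ-cong c w (common-B c r w (cls-rep c)))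
             (solve 6 (λ x s a p d t → x :* (s :* a :- p :* d :+ t) := s :* (x :* a) :- p :* (d :* x) :+ t :* x) refl (χ c w) s (A r w) p (δ r w) (B c))) ⟩
      sum (λ w → s * (χ c w * A r w) - p * (δ r w * χ c w) + B c * χ c w)
        ≈⟨ trans (∑-distrib-+ (λ w → s * (χ c w * A r w) - p * (δ r w * χ c w)) (λ w → B c * χ c w))
             (+-cong (sum-sub (λ w → s * (χ c w * A r w)) (λ w → p * (δ r w * χ c w))) (sym (*-distribˡ-sum (B c) (χ c)))) ⟩
      sum (λ w → s * (χ c w * A r w)) - sum (λ w → p * (δ r w * χ c w)) + B c * size c
        ≈⟨ +-congʳ (+-cong (trans (sym (*-distribˡ-sum s (λ w → χ c w * A r w))) (*-congˡ (valency-count c r)))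
             (-‿cong (trans (sym (*-distribˡ-sum p (λ w → δ r w * χ c w)))
               (trans (*-congˡ (trans (sum-δ r (χ c)) (χ-hit c (cls-rep c)))) (*-identityʳ p))))) ⟩
      s * ι (k c) - p + B c * size c ∎
      where r = rep c

    products : ∀ c → b ℕ.* (μ c ℕ.+ q) ≡ μ c ℕ.* l c
    products c = ι-injective (b ℕ.* (μ c ℕ.+ q)) (μ c ℕ.* l c) (begin
      ι (b ℕ.* (μ c ℕ.+ q))
        ≈⟨ trans (ι-* b (μ c ℕ.+ q)) (*-congˡ (ι-+ (μ c) q)) ⟩
      ι b * (m + ι q)
        ≈⟨ solve 4 (λ b m q l → b :* (m :+ q) := m :* l :-
             (((q :- :1 :- b) :* (m :+ q) :- (:- q) :+ m :* (:1 :+ (m :+ q) :+ l)) :- (m :+ q) :* (m :+ q)))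
             refl (ι b) m (ι q) (ι (l c)) ⟩
      m * ι (l c) - (((ι q - 1# - ι b) * (m + ι q) - - ι q + m * (1# + (m + ι q) + ι (l c))) - (m + ι q) * (m + ι q))
        ≈⟨ +-congˡ (-‿cong (x≈y⇒x-y≈0 (sym (begin
             (m + ι q) * (m + ι q)
               ≈⟨ *-cong (sym (k-μ c)) (sym (k-μ c)) ⟩
             ι (k c) * ι (k c)
               ≈⟨ walks c ⟩
             s * ι (k c) - p + B c * size c
               ≈⟨ +-cong (+-cong (*-cong s-qb (k-μ c)) (-‿cong p-q)) (*-cong (sym (μ-B c)) (trans (size-k c) (+-congʳ (+-congˡ (k-μ c))))) ⟩
             (ι q - 1# - ι b) * (m + ι q) - - ι q + m * (1# + (m + ι q) + ι (l c)) ∎)))) ⟩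
      m * ι (l c) - 0#
        ≈⟨ solve 1 (λ x → x :- :0 := x) refl (m * ι (l c)) ⟩
      m * ι (l c)
        ≈⟨ sym (ι-* (μ c) (l c)) ⟩
      ι (μ c ℕ.* l c) ∎)
      where m = ι (μ c)

    t : ℕ
    t = 1 ℕ.+ (μ true ℕ.+ μ false ℕ.+ q)

    ι-t : ι t ≈ 1# + (ι (μ true) + ι (μ false) + ι q)
    ι-t = trans (ι-suc (μ true ℕ.+ μ false ℕ.+ q)) (+-congˡ (trans (ι-+ (μ true ℕ.+ μ false) q) (+-congʳ (ι-+ (μ true) (μ false)))))

    cross : ι (t ℕ.+ b) ≈ κ * (Y true * Y false)
    cross = begin
      ι (t ℕ.+ b)
        ≈⟨ trans (ι-+ t b) (+-congʳ ι-t) ⟩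
      1# + (ι (μ true) + ι (μ false) + ι q) + ι b
        ≈⟨ solve 5 (λ m m′ q b p → :1 :+ (m :+ m′ :+ q) :+ b
             := ((m :+ q) :+ (m′ :+ q)) :- (q :- :1 :- b) :* :1 :+ p :* :0) refl (ι (μ true)) (ι (μ false)) (ι q) (ι b) p ⟩
      (ι (μ true) + ι q) + (ι (μ false) + ι q) - (ι q - 1# - ι b) * 1# + p * 0#
        ≈⟨ +-cong (+-cong (+-cong (sym (k-μ true)) (sym (k-μ false)))
             (-‿cong (*-cong (sym s-qb) (reflexive (≡.cong [_] (≡.sym (joined r r′ (cls-rep true) (cls-rep false))))))))
             (*-congˡ (sym (δ-≢ r≢r′))) ⟩
      ι (k true) + ι (k false) - s * A r r′ + p * δ r r′
        ≈⟨ +-congʳ (+-congʳ (sym (trans (common-split true r r′) (+-cong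
             (trans (common-adjacentʳ true r r′ (λ z z∈ → joined z r′ z∈ (cls-rep false))) (valency-k true r (cls-rep true)))
             (trans (common-adjacentˡ false r r′ (λ z z∈ → joined r z (cls-rep true) z∈)) (valency-k false r′ (cls-rep false))))))) ⟩
      sum (λ z → A r z * A z r′) - s * A r r′ + p * δ r r′
        ≈⟨ equation r r′ ⟩
      κ * (Y true * Y false) ∎
      where
      r  = rep true
      r′ = rep false
      r≢r′ : r ≢ r′
      r≢r′ e = case ≡.trans (≡.sym (cls-rep true)) (≡.trans (≡.cong cls e) (cls-rep false)) of λ ()

    diagonal : ∀ c → κ * (Y c * Y c) ≈ ι (μ c) + (1# + ι (k (not c)) + ι (l (not c)))
    diagonal c = begin
      κ * (Y c * Y c)            ≈⟨ solve 2 (λ x y → x := (x :- y) :+ y) refl (κ * (Y c * Y c)) (size (not c)) ⟩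
      B c + size (not c)         ≈⟨ +-cong (sym (μ-B c)) (size-k (not c)) ⟩
      ι (μ c) + (1# + ι (k (not c)) + ι (l (not c))) ∎

    diagonal-true : κ * (Y true * Y true) ≈ ι (t ℕ.+ l false)
    diagonal-true = begin
      κ * (Y true * Y true)
        ≈⟨ trans (diagonal true) (+-congˡ (+-congʳ (+-congˡ (k-μ false)))) ⟩
      ι (μ true) + (1# + (ι (μ false) + ι q) + ι (l false))
        ≈⟨ solve 4 (λ m m′ q l → m :+ (:1 :+ (m′ :+ q) :+ l) := :1 :+ (m :+ m′ :+ q) :+ l) refl (ι (μ true)) (ι (μ false)) (ι q) (ι (l false)) ⟩
      1# + (ι (μ true) + ι (μ false) + ι q) + ι (l false)
        ≈⟨ sym (trans (ι-+ t (l false)) (+-congʳ ι-t)) ⟩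
      ι (t ℕ.+ l false) ∎

    diagonal-false : κ * (Y false * Y false) ≈ ι (t ℕ.+ l true)
    diagonal-false = begin
      κ * (Y false * Y false)
        ≈⟨ trans (diagonal false) (+-congˡ (+-congʳ (+-congˡ (k-μ true)))) ⟩
      ι (μ false) + (1# + (ι (μ true) + ι q) + ι (l true))
        ≈⟨ solve 4 (λ m m′ q l → m′ :+ (:1 :+ (m :+ q) :+ l) := :1 :+ (m :+ m′ :+ q) :+ l) refl (ι (μ true)) (ι (μ false)) (ι q) (ι (l true)) ⟩
      1# + (ι (μ true) + ι (μ false) + ι q) + ι (l true)
        ≈⟨ sym (trans (ι-+ t (l true)) (+-congʳ ι-t)) ⟩
      ι (t ℕ.+ l true) ∎

    squares : (t ℕ.+ b) ℕ.* (t ℕ.+ b) ≡ (t ℕ.+ l false) ℕ.* (t ℕ.+ l true)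
    squares = ι-injective ((t ℕ.+ b) ℕ.* (t ℕ.+ b)) ((t ℕ.+ l false) ℕ.* (t ℕ.+ l true)) (begin
      ι ((t ℕ.+ b) ℕ.* (t ℕ.+ b))
        ≈⟨ trans (ι-* (t ℕ.+ b) (t ℕ.+ b)) (*-cong cross cross) ⟩
      κ * (Y true * Y false) * (κ * (Y true * Y false))
        ≈⟨ solve 3 (λ k u v → k :* (u :* v) :* (k :* (u :* v)) := k :* (u :* u) :* (k :* (v :* v))) refl κ (Y true) (Y false) ⟩
      κ * (Y true * Y true) * (κ * (Y false * Y false))
        ≈⟨ *-cong diagonal-true diagonal-false ⟩
      ι (t ℕ.+ l false) * ι (t ℕ.+ l true)
        ≈⟨ sym (ι-* (t ℕ.+ l false) (t ℕ.+ l true)) ⟩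
      ι ((t ℕ.+ l false) ℕ.* (t ℕ.+ l true)) ∎)

    k-positive : ∀ c → 0 ℕ.< μ c ℕ.+ q
    k-positive c = ℕ.n≢0⇒n>0 λ e → let (x , w , x∈ , w∈ , _ , x~w) = nonuniform c false in
      case ≡.trans (≡.sym (≡.cong₂ _∧_ (is-≡ c w∈) x~w)) (sum-[]≈0 (λ z → member c z ∧ adjacent? x z) (begin
        sum (λ z → [ member c z ∧ adjacent? x z ])  ≈⟨ sym (valency-[] c x) ⟩
        valency c x                                 ≈⟨ trans (valency-k c x x∈) (k-μ c) ⟩
        ι (μ c) + ι q                               ≈⟨ sym (ι-+ (μ c) q) ⟩
        ι (μ c ℕ.+ q)                               ≡⟨ ≡.cong ι e ⟩
        0#                                          ∎) w) of λ ()

    l-equal : l false ≡ l true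
    l-equal = square-factors t b (l false) (l true) (ℕ.s≤s ℕ.z≤n)
      (≤-of-products (μ false) q b (l false) (k-positive false) (products false))
      (≤-of-products (μ true) q b (l true) (k-positive true) (products true))
      squares

    D-k : ∀ c → D c ≈ ι (k c) + size (not c)
    D-k c = trans (degree-split c (rep c)) (+-cong (valency-count c (rep c))
      (valency-adjacent (not c) (rep c) (λ z → join (not c) (rep c) z (not-not c (cls-rep c)))))

  impossible : ⊥
  impossible = degrees-distinct (begin
    D true                                        ≈⟨ trans (D-k true) (+-congˡ (size-k false)) ⟩
    ι (k true) + (1# + ι (k false) + ι (l false)) ≈⟨ +-congˡ (+-congˡ (reflexive (≡.cong ι l-equal))) ⟩
    ι (k true) + (1# + ι (k false) + ι (l true))  ≈⟨ solve 3 (λ p q r → p :+ (:1 :+ q :+ r) := q :+ (:1 :+ p :+ r)) refl (ι (k true)) (ι (k false)) (ι (l true)) ⟩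
    ι (k false) + (1# + ι (k true) + ι (l true))  ≈⟨ sym (trans (D-k false) (+-congˡ (size-k true))) ⟩
    D false                                       ∎)

-- Classes that are not joined

-- Nine types, of which all would occur if class c had adjacent as well as
-- nonadjacent pairs of distinct vertices, the other class had distinct vertices
-- too, and there were edges and non-edges between the classes.
nineTypes : Bool → Bool → Bool → Fin 9 → Type
nineTypes c a a′ 0F = c , c , false , true
nineTypes c a a′ 1F = c , c , a , false
nineTypes c a a′ 2F = c , c , not a , false
nineTypes c a a′ 3F = not c , not c , false , true
nineTypes c a a′ 4F = not c , not c , a′ , false
nineTypes c a a′ 5F = c , not c , true , false
nineTypes c a a′ 6F = c , not c , false , false
nineTypes c a a′ 7F = not c , c , true , false
nineTypes c a a′ 8F = not c , c , false , false

private
  _≟T_ : (s t : Type) → Dec (s ≡ t)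
  _≟T_ = ≡-dec Bool._≟_ (≡-dec Bool._≟_ (≡-dec Bool._≟_ Bool._≟_))

  injective? : ∀ c a a′ → Dec (∀ i j → nineTypes c a a′ i ≡ nineTypes c a a′ j → i ≡ j)
  injective? c a a′ = Fin.all? (λ i → Fin.all? (λ j → (nineTypes c a a′ i ≟T nineTypes c a a′ j) →-dec (i Fin.≟ j)))

nineTypes-injective : ∀ c a a′ i j → nineTypes c a a′ i ≡ nineTypes c a a′ j → i ≡ j
nineTypes-injective true  true  true  = from-yes (injective? true  true  true)
nineTypes-injective true  true  false = from-yes (injective? true  true  false)
nineTypes-injective true  false true  = from-yes (injective? true  false true)
nineTypes-injective true  false false = from-yes (injective? true  false false)
nineTypes-injective false true  true  = from-yes (injective? false true  true)
nineTypes-injective false true  false = from-yes (injective? false true  false)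
nineTypes-injective false false true  = from-yes (injective? false false true)
nineTypes-injective false false false = from-yes (injective? false false false)

-- The case of a division by degree with an edge u v and a non-edge u′ v′ between
-- the classes.
module NotJoined {c ℓ} (F : Field₀ c ℓ) {n} (Γ : Graph n) (E : RankOneEquation F Γ)
  (rank8 : Matrices.HasCoherentRank (CommutativeRing.rawRing (Field₀.commutativeRing F)) Γ 8)
  (Δ : Division F Γ)
  (u v : Fin n) (u∈ : Division.cls Δ u ≡ true) (v∈ : Division.cls Δ v ≡ false) (u~v : Graph.adjacent? Γ u v ≡ true)
  (u′ v′ : Fin n) (u′∈ : Division.cls Δ u′ ≡ true) (v′∈ : Division.cls Δ v′ ≡ false) (u′≁v′ : Graph.adjacent? Γ u′ v′ ≡ false)
  where
  open FieldTools F
  open Graph Γ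
  open RankOneEquation E
  open Division Δ
  open Classes R Γ cls
  open Relation.Binary.Reasoning.Setoid setoid
  open Matrices rawRing using (CoherentClosure; generator; transpose; identity)
  open RankTools F (CoherentClosure A) rank8 using (pigeonhole)

  valency-same : ∀ c x z → cls x ≡ cls z → valency c x ≈ valency c z
  valency-same c x z e = trans (valency-rep c x) (trans (reflexive (≡.cong (λ b → valency c (rep b)) e)) (sym (valency-rep c z)))

  private
    -- An edge or non-edge from class c to the other class.
    CrossPair : Bool → Bool → Set
    CrossPair c a = ∃[ x ] ∃[ w ] (cls x ≡ c × cls w ≡ not c × adjacent? x w ≡ a)

    crossPair : ∀ c a → CrossPair c a
    crossPair true  true  = u , v , u∈ , v∈ , u~v
    crossPair true  false = u′ , v′ , u′∈ , v′∈ , u′≁v′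
    crossPair false true  = v , u , v∈ , u∈ , ≡.trans (symmetric v u) u~v
    crossPair false false = v′ , u′ , v′∈ , u′∈ , ≡.trans (symmetric v′ u′) u′≁v′

    -- Two vertices of class c.
    OwnPair : Bool → Set
    OwnPair c = ∃[ x ] ∃[ z ] (cls x ≡ c × cls z ≡ c × x ≢ z)

    -- A class of one vertex would be adjacent to all or to none of the
    -- vertices of the other class.
    findPair : ∀ c → CrossPair c true → CrossPair c false → OwnPair c
    findPair c (x , w , x∈ , w∈ , x~w) (x′ , w′ , x′∈ , w′∈ , x′≁w′) =
      by-cases (Fin.any? (λ z → (cls z Bool.≟ c) ×-dec (adjacent? w′ z Bool.≟ true)))
      where
      by-cases : Dec (∃[ z ] (cls z ≡ c × adjacent? w′ z ≡ true)) → OwnPair c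
      by-cases (yes (z , z∈ , w′~z)) = x′ , z , x′∈ , z∈ ,
        λ { ≡.refl → case ≡.trans (≡.sym w′~z) (≡.trans (symmetric w′ x′) x′≁w′) of λ () }
      by-cases (no none) = ⊥-elim (case ≡.trans
        (≡.sym (≡.cong₂ _∧_ (is-≡ c x∈) (≡.trans (symmetric w x) x~w)))
        (sum-[]≈0 (λ z → member c z ∧ adjacent? w z) (begin
          sum (λ z → [ member c z ∧ adjacent? w z ])  ≈⟨ sym (valency-[] c w) ⟩
          valency c w                                 ≈⟨ valency-same c w w′ (≡.trans w∈ (≡.sym w′∈)) ⟩
          valency c w′                                ≈⟨ sum-cong (λ z → trans (χ-cong c z (λ z∈ → reflexive (≡.cong [_] (Bool.¬-not (λ a → none (z , z∈ , a)))))) (zeroʳ (χ c z))) ⟩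
          sum {n} (λ z → 0#)                          ≈⟨ sum-≈0 {n} (λ _ → 0#) (λ _ → refl) ⟩
          0#                                          ∎) x) of λ ())

    ownPair : ∀ c → OwnPair c
    ownPair c = findPair c (crossPair c true) (crossPair c false)

  -- Whether distinct vertices of a class are adjacent; by uniformity this does
  -- not depend on their choice.
  α : Bool → Bool
  α c = let (x , z , _) = ownPair c in adjacent? x z

  private
    []-injective : ∀ a b → [ a ] ≈ [ b ] → a ≡ b
    []-injective true  true  _ = ≡.refl
    []-injective true  false e = ⊥-elim (0≉1 (sym e))
    []-injective false true  e = ⊥-elim (0≉1 e)
    []-injective false false _ = ≡.refl

    separated : ∀ x z x′ z′ → (∀ M → CoherentClosure A M → M x z ≈ M x′ z′) → type x z ≡ type x′ z′
    separated x z x′ z′ e = type-cong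
      ([]-injective _ _ (e _ recorded))
      ([]-injective _ _ (e _ (transpose recorded)))
      ([]-injective _ _ (e _ generator))
      ([]-injective _ _ (e _ identity))

    distinct-type : ∀ {x z : Fin n} → x ≢ z → does (x Fin.≟ z) ≡ false
    distinct-type {x} {z} = dec-false (x Fin.≟ z)

    same-type : ∀ (x : Fin n) → does (x Fin.≟ x) ≡ true
    same-type x = dec-true (x Fin.≟ x) ≡.refl

  -- Otherwise the coherent closure tells nine pairs apart.
  uniform : ∀ c x z → cls x ≡ c → cls z ≡ c → x ≢ z → adjacent? x z ≡ α c
  uniform c x z x∈ z∈ x≢z = by-cases (adjacent? x z Bool.≟ α c)
    where
    c′ = not c
    own₁ = ownPair c
    own₂ = ownPair c′
    yes₁ = crossPair c true
    no₁  = crossPair c false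

    collision : ∀ (P : Fin 9 → Fin n × Fin n) →
      (∀ i → type (proj₁ (P i)) (proj₂ (P i)) ≡ nineTypes c (α c) (α c′) i) →
      ∃[ i ] ∃[ j ] i ≢ j × (∀ M → CoherentClosure A M → M (proj₁ (P i)) (proj₂ (P i)) ≈ M (proj₁ (P j)) (proj₂ (P j))) → ⊥
    collision P realised (i , j , i≢j , e) = i≢j (nineTypes-injective c (α c) (α c′) i j
      (≡.trans (≡.sym (realised i)) (≡.trans (separated _ _ _ _ e) (realised j))))

    by-cases : Dec (adjacent? x z ≡ α c) → adjacent? x z ≡ α c
    by-cases (yes a) = a
    by-cases (no ≢a) = ⊥-elim (collision P realised (pigeonhole (ℕ.n<1+n 8) P))
      where
      P : Fin 9 → Fin n × Fin n
      P 0F = x , x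
      P 1F = proj₁ own₁ , proj₁ (proj₂ own₁)
      P 2F = x , z
      P 3F = proj₁ own₂ , proj₁ own₂
      P 4F = proj₁ own₂ , proj₁ (proj₂ own₂)
      P 5F = proj₁ yes₁ , proj₁ (proj₂ yes₁)
      P 6F = proj₁ no₁ , proj₁ (proj₂ no₁)
      P 7F = proj₁ (proj₂ yes₁) , proj₁ yes₁
      P 8F = proj₁ (proj₂ no₁) , proj₁ no₁

      apart : ∀ {x w} → cls x ≡ c → cls w ≡ c′ → x ≢ w
      apart p q ≡.refl = not-≢ c (≡.trans (≡.sym q) p)

      realised : ∀ i → type (proj₁ (P i)) (proj₂ (P i)) ≡ nineTypes c (α c) (α c′) i
      realised 0F = type-cong x∈ x∈ (loopless x) (same-type x)
      realised 1F = let (_ , _ , p , q , ≢) = own₁ in type-cong p q ≡.refl (distinct-type ≢)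
      realised 2F = type-cong x∈ z∈ (Bool.¬-not ≢a) (distinct-type x≢z)
      realised 3F = let (y , _ , p , _) = own₂ in type-cong p p (loopless y) (same-type y)
      realised 4F = let (_ , _ , p , q , ≢) = own₂ in type-cong p q ≡.refl (distinct-type ≢)
      realised 5F = let (_ , _ , p , q , a) = yes₁ in type-cong p q a (distinct-type (apart p q))
      realised 6F = let (_ , _ , p , q , a) = no₁ in type-cong p q a (distinct-type (apart p q))
      realised 7F = let (x , w , p , q , a) = yes₁ in type-cong q p (≡.trans (symmetric w x) a) (distinct-type (λ e → apart p q (≡.sym e)))
      realised 8F = let (x , w , p , q , a) = no₁ in type-cong q p (≡.trans (symmetric w x) a) (distinct-type (λ e → apart p q (≡.sym e)))

  private
    a : Bool → Carrier
    a c = [ α c ]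

    aa≈a : ∀ c → a c * a c ≈ a c
    aa≈a c = []-idem (α c)

    Y N : Bool → Carrier
    Y c = y (rep c)
    N c = κ * (Y c * Y c)

    -- The number of neighbours of a vertex in the other class.
    k : Bool → Carrier
    k c = valency (not c) (rep c)

    y-class : ∀ c x → cls x ≡ c → y x ≈ Y c
    y-class c x ≡.refl = degree⇒y x (rep (cls x)) (degree-rep x)

    valency-class : ∀ b c x → cls x ≡ c → valency b x ≈ valency b (rep c)
    valency-class b c x ≡.refl = valency-rep b x

    class-A : ∀ c x z → cls x ≡ c → cls z ≡ c → A x z ≈ a c * (1# - δ x z)
    class-A c x z x∈ z∈ = by-cases (x Fin.≟ z)
      where
      by-cases : Dec (x ≡ z) → A x z ≈ a c * (1# - δ x z)
      by-cases (yes ≡.refl) = begin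
        A x x               ≡⟨ ≡.cong [_] (loopless x) ⟩
        0#                  ≈⟨ solve 1 (λ t → :0 := t :* (:1 :- :1)) refl (a c) ⟩
        a c * (1# - 1#)     ≈⟨ *-congˡ (+-congˡ (-‿cong (sym (δ-refl x)))) ⟩
        a c * (1# - δ x x)  ∎
      by-cases (no x≢z) = begin
        A x z               ≡⟨ ≡.cong [_] (uniform c x z x∈ z∈ x≢z) ⟩
        a c                 ≈⟨ solve 1 (λ t → t := t :* (:1 :- :0)) refl (a c) ⟩
        a c * (1# - 0#)     ≈⟨ *-congˡ (+-congˡ (-‿cong (sym (δ-≢ x≢z)))) ⟩
        a c * (1# - δ x z)  ∎

    common-own : ∀ c x w → cls x ≡ c → cls w ≡ c → common c x w ≈ a c * (size c - 1# - 1# + δ x w)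
    common-own c x w x∈ w∈ = begin
      sum (λ z → χ c z * (A x z * A z w))
        ≈⟨ sum-cong (λ z → trans
             (χ-cong c z (λ z∈ → *-cong (class-A c x z x∈ z∈) (class-A c z w z∈ w∈)))
             (solve 4 (λ χ a d d′ → χ :* (a :* (:1 :- d) :* (a :* (:1 :- d′)))
                := a :* a :* (χ :- d :* χ :- χ :* d′ :+ d :* (χ :* d′))) refl (χ c z) (a c) (δ x z) (δ z w))) ⟩
      sum (λ z → a c * a c * (χ c z - δ x z * χ c z - χ c z * δ z w + δ x z * (χ c z * δ z w)))
        ≈⟨ trans (sym (*-distribˡ-sum (a c * a c) (λ z → χ c z - δ x z * χ c z - χ c z * δ z w + δ x z * (χ c z * δ z w))))
             (*-cong (aa≈a c) (trans
               (∑-distrib-+ (λ z → χ c z - δ x z * χ c z - χ c z * δ z w) (λ z → δ x z * (χ c z * δ z w)))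
               (+-congʳ (trans (sum-sub (λ z → χ c z - δ x z * χ c z) (λ z → χ c z * δ z w))
                 (+-congʳ (sum-sub (χ c) (λ z → δ x z * χ c z))))))) ⟩
      a c * (size c - sum (λ z → δ x z * χ c z) - sum (λ z → χ c z * δ z w) + sum (λ z → δ x z * (χ c z * δ z w)))
        ≈⟨ *-congˡ (+-cong (+-cong (+-congˡ (-‿cong (trans (sum-δ x (χ c)) (χ-hit c x∈)))) (-‿cong (trans (sum-δʳ w (χ c)) (χ-hit c w∈))))
             (trans (sum-δ x (λ z → χ c z * δ z w)) (trans (*-congʳ (χ-hit c x∈)) (*-identityˡ (δ x w))))) ⟩
      a c * (size c - 1# - 1# + δ x w) ∎

    -- Two vertices of a class have m c common neighbours in the other class,
    -- and t c more if they coincide.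
    m t : Bool → Carrier
    m c = N c - a c * (size c - 1# - 1#) + s * a c
    t c = - (a c + s * a c + p)

    common-other : ∀ c d → d ≡ not c → ∀ x w → cls x ≡ c → cls w ≡ c → common d x w ≈ m c + t c * δ x w
    common-other c d ≡.refl x w x∈ w∈ = begin
      common d x w
        ≈⟨ solve 4 (λ p q r t → q := (p :+ q :- r :+ t) :- p :+ r :- t) refl (common c x w) (common d x w) (s * A x w) (p * δ x w) ⟩
      (common c x w + common d x w - s * A x w + p * δ x w) - common c x w + s * A x w - p * δ x w
        ≈⟨ +-congʳ (+-cong (+-cong (trans (+-congʳ (+-congʳ (sym (common-split c x w)))) (trans (equation x w) (*-congˡ (*-cong (y-class c x x∈) (y-class c w w∈)))))
             (-‿cong (common-own c x w x∈ w∈))) (*-congˡ (class-A c x w x∈ w∈))) ⟩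
      N c - a c * (size c - 1# - 1# + δ x w) + s * (a c * (1# - δ x w)) - p * δ x w
        ≈⟨ solve 6 (λ N a n d s p → N :- a :* (n :- :1 :- :1 :+ d) :+ s :* (a :* (:1 :- d)) :- p :* d
             := N :- a :* (n :- :1 :- :1) :+ s :* a :+ :- (a :+ s :* a :+ p) :* d) refl (N c) (a c) (size c) (δ x w) s p ⟩
      m c + t c * δ x w ∎

    k-m : ∀ c → k c ≈ m c + t c
    k-m c = begin
      valency (not c) r    ≈⟨ sym (common-self (not c) r) ⟩
      common (not c) r r   ≈⟨ common-other c (not c) ≡.refl r r (cls-rep c) (cls-rep c) ⟩
      m c + t c * δ r r    ≈⟨ +-congˡ (trans (*-congˡ (δ-refl r)) (*-identityʳ (t c))) ⟩
      m c + t c            ∎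
      where r = rep c

    -- Walks from a vertex through the other class back to its own class.
    round-trips : ∀ c → k c * valency c (rep (not c)) ≈ size c * m c + t c
    round-trips c = begin
      k c * valency c (rep c′)
        ≈⟨ two-step-walks c c′ r (valency c (rep c′)) (valency-class c c′) ⟩
      sum (λ w → χ c w * common c′ r w)
        ≈⟨ sum-cong (λ w → trans (χ-cong c w (common-other c c′ ≡.refl r w (cls-rep c)))
             (solve 4 (λ x m t d → x :* (m :+ t :* d) := x :* m :+ t :* (d :* x)) refl (χ c w) (m c) (t c) (δ r w))) ⟩
      sum (λ w → χ c w * m c + t c * (δ r w * χ c w))
        ≈⟨ ∑-distrib-+ (λ w → χ c w * m c) (λ w → t c * (δ r w * χ c w)) ⟩
      sum (λ w → χ c w * m c) + sum (λ w → t c * (δ r w * χ c w))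
        ≈⟨ +-cong (sym (*-distribʳ-sum (m c) (χ c))) (trans (sym (*-distribˡ-sum (t c) (λ w → δ r w * χ c w)))
             (trans (*-congˡ (trans (sum-δ r (χ c)) (χ-hit c (cls-rep c)))) (*-identityʳ (t c)))) ⟩
      size c * m c + t c ∎
      where
      r  = rep c
      c′ = not c

    -- Edges between the classes, counted from either side.
    edges : size true * k true ≈ size false * k false
    edges = begin
      size true * k true
        ≈⟨ count-from true false ⟩
      sum (λ x → sum (λ z → χ true x * (χ false z * A x z)))
        ≈⟨ ∑-comm (λ x z → χ true x * (χ false z * A x z)) ⟩
      sum (λ z → sum (λ x → χ true x * (χ false z * A x z)))
        ≈⟨ sum-cong (λ z → sum-cong (λ x → trans
             (solve 3 (λ p q r → p :* (q :* r) := q :* (p :* r)) refl (χ true x) (χ false z) (A x z))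
             (*-congˡ {x = χ false z} (*-congˡ (A-sym x z))))) ⟩
      sum (λ z → sum (λ x → χ false z * (χ true x * A z x)))
        ≈⟨ sym (count-from false true) ⟩
      size false * k false ∎
      where
      count-from : ∀ c d → size c * valency d (rep c) ≈ sum (λ x → sum (λ z → χ c x * (χ d z * A x z)))
      count-from c d = trans (*-distribʳ-sum (valency d (rep c)) (χ c))
        (sum-cong (λ x → trans (χ-cong c x (λ x∈ → sym (valency-class d c x x∈))) (*-distribˡ-sum (χ c x) (λ z → χ d z * A x z))))

    -- The equation at a pair of vertices from either class.
    cross : ∀ x w → cls x ≡ true → cls w ≡ false →
      a true * (k false - A x w) + a false * (k true - A x w) - s * A x w ≈ κ * (Y true * Y false)
    cross x w x∈ w∈ = begin
      a true * (k false - A x w) + a false * (k true - A x w) - s * A x w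
        ≈⟨ +-congʳ (+-cong (sym through-true) (sym through-false)) ⟩
      common true x w + common false x w - s * A x w
        ≈⟨ solve 2 (λ q p → q := q :+ p :* :0) refl (common true x w + common false x w - s * A x w) p ⟩
      common true x w + common false x w - s * A x w + p * 0#
        ≈⟨ +-cong (+-congʳ (sym (common-split true x w))) (*-congˡ (sym (δ-≢ x≢w))) ⟩
      sum (λ z → A x z * A z w) - s * A x w + p * δ x w
        ≈⟨ equation x w ⟩
      κ * (y x * y w)
        ≈⟨ *-congˡ (*-cong (y-class true x x∈) (y-class false w w∈)) ⟩
      κ * (Y true * Y false) ∎
      where
      x≢w : x ≢ w
      x≢w ≡.refl = case ≡.trans (≡.sym x∈) w∈ of λ ()

      through-true : common true x w ≈ a true * (k false - A x w)
      through-true = begin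
        sum (λ z → χ true z * (A x z * A z w))
          ≈⟨ sum-cong (λ z → trans (χ-cong true z (λ z∈ → *-cong (class-A true x z x∈ z∈) (A-sym z w)))
               (solve 4 (λ c a d b → c :* (a :* (:1 :- d) :* b) := a :* (c :* b :- d :* (c :* b))) refl (χ true z) (a true) (δ x z) (A w z))) ⟩
        sum (λ z → a true * (χ true z * A w z - δ x z * (χ true z * A w z)))
          ≈⟨ trans (sym (*-distribˡ-sum (a true) (λ z → χ true z * A w z - δ x z * (χ true z * A w z))))
               (*-congˡ (sum-sub (λ z → χ true z * A w z) (λ z → δ x z * (χ true z * A w z)))) ⟩
        a true * (valency true w - sum (λ z → δ x z * (χ true z * A w z)))
          ≈⟨ *-congˡ (+-cong (valency-class true false w w∈) (-‿cong (trans (sum-δ x (λ z → χ true z * A w z))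
               (trans (*-cong (χ-hit true x∈) (A-sym w x)) (*-identityˡ (A x w)))))) ⟩
        a true * (k false - A x w) ∎

      through-false : common false x w ≈ a false * (k true - A x w)
      through-false = begin
        sum (λ z → χ false z * (A x z * A z w))
          ≈⟨ sum-cong (λ z → trans (χ-cong false z (λ z∈ → *-congˡ (class-A false z w z∈ w∈)))
               (solve 4 (λ c a d b → c :* (b :* (a :* (:1 :- d))) := a :* (c :* b :- c :* b :* d)) refl (χ false z) (a false) (δ z w) (A x z))) ⟩
        sum (λ z → a false * (χ false z * A x z - χ false z * A x z * δ z w))
          ≈⟨ trans (sym (*-distribˡ-sum (a false) (λ z → χ false z * A x z - χ false z * A x z * δ z w)))
               (*-congˡ (sum-sub (λ z → χ false z * A x z) (λ z → χ false z * A x z * δ z w))) ⟩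
        a false * (valency false x - sum (λ z → χ false z * A x z * δ z w))
          ≈⟨ *-congˡ (+-cong (valency-class false true x x∈) (-‿cong (trans (sum-δʳ w (λ z → χ false z * A x z))
               (trans (*-congʳ (χ-hit false w∈)) (*-identityˡ (A x w)))))) ⟩
        a false * (k true - A x w) ∎

    -- The equation at a non-edge evaluates X, and its comparison with an edge
    -- gives s.
    X : Carrier
    X = κ * (Y true * Y false)

    X-eq : a true * k false + a false * k true ≈ X
    X-eq = begin
      a true * k false + a false * k true
        ≈⟨ solve 5 (λ a a′ k k′ s → a :* k′ :+ a′ :* k := a :* (k′ :- :0) :+ a′ :* (k :- :0) :- s :* :0) refl (a true) (a false) (k true) (k false) s ⟩
      a true * (k false - 0#) + a false * (k true - 0#) - s * 0#
        ≈⟨ +-cong (+-cong (*-congˡ (+-congˡ (-‿cong A≈0))) (*-congˡ (+-congˡ (-‿cong A≈0)))) (-‿cong (*-congˡ A≈0)) ⟩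
      a true * (k false - A u′ v′) + a false * (k true - A u′ v′) - s * A u′ v′
        ≈⟨ cross u′ v′ u′∈ v′∈ ⟩
      X ∎
      where
      A≈0 : 0# ≈ A u′ v′
      A≈0 = []-cong (≡.sym u′≁v′)

    s-eq : s ≈ - (a true + a false)
    s-eq = begin
      s
        ≈⟨ solve 5 (λ a a′ k k′ s → s := (a :* k′ :+ a′ :* k) :- (a :* (k′ :- :1) :+ a′ :* (k :- :1) :- s :* :1) :- (a :+ a′)) refl (a true) (a false) (k true) (k false) s ⟩
      (a true * k false + a false * k true) - (a true * (k false - 1#) + a false * (k true - 1#) - s * 1#) - (a true + a false)
        ≈⟨ +-congʳ (+-cong X-eq (-‿cong (trans (+-cong (+-cong (*-congˡ (+-congˡ (-‿cong A≈1))) (*-congˡ (+-congˡ (-‿cong A≈1)))) (-‿cong (*-congˡ A≈1))) (cross u v u∈ v∈)))) ⟩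
      X - X - (a true + a false)
        ≈⟨ solve 2 (λ x y → x :- x :- y := :- y) refl X (a true + a false) ⟩
      - (a true + a false) ∎
      where
      A≈1 : 1# ≈ A u v
      A≈1 = []-cong (≡.sym u~v)

    -- The common value of t for both classes.
    T : Carrier
    T = a true * a false - p

    t-true : t true ≈ T
    t-true = begin
      - (a true + s * a true + p)
        ≈⟨ -‿cong (+-congʳ (+-congˡ (*-congʳ s-eq))) ⟩
      - (a true + - (a true + a false) * a true + p)
        ≈⟨ solve 3 (λ a b p → :- (a :+ :- (a :+ b) :* a :+ p) := (a :* b :- p) :+ (a :* a :- a)) refl (a true) (a false) p ⟩
      T + (a true * a true - a true)
        ≈⟨ trans (+-congˡ (x≈y⇒x-y≈0 (aa≈a true))) (+-identityʳ T) ⟩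
      T ∎

    t-false : t false ≈ T
    t-false = begin
      - (a false + s * a false + p)
        ≈⟨ -‿cong (+-congʳ (+-congˡ (*-congʳ s-eq))) ⟩
      - (a false + - (a true + a false) * a false + p)
        ≈⟨ solve 3 (λ b a p → :- (a :+ :- (b :+ a) :* a :+ p) := (b :* a :- p) :+ (a :* a :- a)) refl (a true) (a false) p ⟩
      T + (a false * a false - a false)
        ≈⟨ trans (+-congˡ (x≈y⇒x-y≈0 (aa≈a false))) (+-identityʳ T) ⟩
      T ∎

    k-true : k true ≈ m true + T
    k-true = trans (k-m true) (+-congˡ t-true)

    k-false : k false ≈ m false + T
    k-false = trans (k-m false) (+-congˡ t-false)

    kk-true : k true * k false ≈ size true * m true + T
    kk-true = trans (round-trips true) (+-congˡ t-true)

    kk-false : k true * k false ≈ size false * m false + T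
    kk-false = trans (*-comm (k true) (k false)) (trans (round-trips false) (+-congˡ t-false))

    -- The adjacency between the classes is neither empty nor complete, which makes
    -- T nonzero.
    k-true≉0 : ¬ (k true ≈ 0#)
    k-true≉0 e = case ≡.trans (≡.sym (≡.cong₂ _∧_ (is-≡ false v∈) u~v))
      (sum-[]≈0 (λ z → member false z ∧ adjacent? u z)
        (trans (sym (valency-[] false u)) (trans (valency-class false true u u∈) e)) v) of λ ()

    size≉k-false : ¬ (size true - k false ≈ 0#)
    size≉k-false e = case ≡.trans (≡.sym (≡.cong₂ _∧_ (is-≡ true u′∈) (≡.cong not (≡.trans (symmetric v′ u′) u′≁v′))))
      (sum-[]≈0 (λ z → member true z ∧ not (adjacent? v′ z)) (begin
        sum (λ z → [ member true z ∧ not (adjacent? v′ z) ])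
          ≈⟨ sum-cong (λ z → trans ([∧] (member true z) (not (adjacent? v′ z))) (trans (*-congˡ ([not] (adjacent? v′ z)))
               (solve 2 (λ c b → c :* (:1 :- b) := c :- c :* b) refl (χ true z) (A v′ z)))) ⟩
        sum (λ z → χ true z - χ true z * A v′ z)
          ≈⟨ sum-sub (χ true) (λ z → χ true z * A v′ z) ⟩
        size true - valency true v′
          ≈⟨ trans (+-congˡ (-‿cong (valency-class true false v′ v′∈))) e ⟩
        0# ∎) u′) of λ ()

    T≉0 : ¬ (T ≈ 0#)
    T≉0 T≈0 = *-≉0 k-true≉0 size≉k-false (begin
      k true * (size true - k false)
        ≈⟨ solve 3 (λ k n k′ → k :* (n :- k′) := n :* k :- k :* k′) refl (k true) (size true) (k false) ⟩
      size true * k true - k true * k false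
        ≈⟨ +-cong (*-congˡ (trans k-true (+-congˡ T≈0))) (-‿cong (trans kk-true (+-congˡ T≈0))) ⟩
      size true * (m true + 0#) - (size true * m true + 0#)
        ≈⟨ solve 2 (λ n m → n :* (m :+ :0) :- (n :* m :+ :0) := :0) refl (size true) (m true) ⟩
      0# ∎)

    sizes-equal : size true ≈ size false
    sizes-equal = x-y≈0⇒x≈y (x*y≈0⇒y≈0 T≉0 (begin
      T * (size true - size false)
        ≈⟨ solve 5 (λ T n n′ m m′ → T :* (n :- n′) := (n :* (m :+ T) :- n′ :* (m′ :+ T)) :- ((n :* m :+ T) :- (n′ :* m′ :+ T)))
             refl T (size true) (size false) (m true) (m false) ⟩
      (size true * (m true + T) - size false * (m false + T)) - ((size true * m true + T) - (size false * m false + T))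
        ≈⟨ +-cong (x≈y⇒x-y≈0 (trans (*-congˡ (sym k-true)) (trans edges (*-congˡ k-false)))) (-‿cong (x≈y⇒x-y≈0 (trans (sym kk-true) kk-false))) ⟩
      0# - 0#
        ≈⟨ -‿inverseʳ 0# ⟩
      0# ∎))

    size≉0 : ∀ c → ¬ (size c ≈ 0#)
    size≉0 c e = case ≡.trans (≡.sym (is-≡ c (cls-rep c))) (sum-[]≈0 (member c) e (rep c)) of λ ()

    k-equal : k true ≈ k false
    k-equal = *-cancelˡ (size≉0 true) (trans edges (*-congʳ (sym sizes-equal)))

    m-equal : m true ≈ m false
    m-equal = begin
      m true         ≈⟨ solve 2 (λ m t → m := (m :+ t) :- t) refl (m true) T ⟩
      m true + T - T ≈⟨ +-congʳ (trans (sym k-true) (trans k-equal k-false)) ⟩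
      m false + T - T ≈⟨ solve 2 (λ m t → (m :+ t) :- t := m) refl (m false) T ⟩
      m false        ∎

    degree-k : ∀ c → sum (A (rep c)) ≈ a c * (size c - 1#) + k c
    degree-k c = trans (degree-split c r) (+-congʳ (begin
      sum (λ z → χ c z * A r z)
        ≈⟨ sum-cong (λ z → trans (χ-cong c z (class-A c r z (cls-rep c)))
             (solve 3 (λ x a d → x :* (a :* (:1 :- d)) := a :* (x :- d :* x)) refl (χ c z) (a c) (δ r z))) ⟩
      sum (λ z → a c * (χ c z - δ r z * χ c z))
        ≈⟨ trans (sym (*-distribˡ-sum (a c) (λ z → χ c z - δ r z * χ c z))) (*-congˡ (sum-sub (χ c) (λ z → δ r z * χ c z))) ⟩
      a c * (size c - sum (λ z → δ r z * χ c z))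
        ≈⟨ *-congˡ (+-congˡ (-‿cong (trans (sum-δ r (χ c)) (χ-hit c (cls-rep c))))) ⟩
      a c * (size c - 1#) ∎))
      where r = rep c

    -- Otherwise all degrees are equal.
    α-distinct : α true ≢ α false
    α-distinct e = degrees-distinct (begin
      sum (A (rep true))              ≈⟨ degree-k true ⟩
      a true * (size true - 1#) + k true     ≈⟨ +-cong (*-cong ([]-cong e) (+-congʳ sizes-equal)) k-equal ⟩
      a false * (size false - 1#) + k false  ≈⟨ sym (degree-k false) ⟩
      sum (A (rep false))             ∎)

  -- The parameters of the design, for the independent class c.
  module Parameters (c : Bool) (α-c : α c ≡ false) (α-c′ : α (not c) ≡ true) where

    private
      n₀ = size c
      k₀ = k c
      m₀ = m c

      a-c : a c ≈ 0#
      a-c = []-cong α-c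

      a-c′ : a (not c) ≈ 1#
      a-c′ = []-cong α-c′

      -- What has been proved, in terms of c.
      record Symmetric : Set ℓ where
        field
          sizes  : size (not c) ≈ size c
          ks     : k (not c) ≈ k c
          ms     : m (not c) ≈ m c
          s-sum  : s ≈ - (a c + a (not c))
          X-sum  : a c * k (not c) + a (not c) * k c ≈ X
          X²     : X * X ≈ N c * N (not c)
          kk     : k c * k (not c) ≈ size c * m c + T
          k-T    : k c ≈ m c + T

      X²-true : X * X ≈ N true * N false
      X²-true = solve 3 (λ k u v → k :* (u :* v) :* (k :* (u :* v)) := k :* (u :* u) :* (k :* (v :* v))) refl κ (Y true) (Y false)

      symmetric-facts : ∀ b → b ≡ c → Symmetric
      symmetric-facts true ≡.refl = record
        { sizes = sym sizes-equal ; ks = sym k-equal ; ms = sym m-equal ; s-sum = s-eq ; X-sum = X-eq ; X² = X²-true ; kk = kk-true ; k-T = k-true }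
      symmetric-facts false ≡.refl = record
        { sizes = sizes-equal ; ks = k-equal ; ms = m-equal ; s-sum = trans s-eq (-‿cong (+-comm _ _)) ; X-sum = trans (+-comm _ _) X-eq
        ; X² = trans X²-true (*-comm _ _) ; kk = trans (*-comm _ _) kk-false ; k-T = k-false }

      open Symmetric (symmetric-facts c ≡.refl)

      s≈-1 : s ≈ - 1#
      s≈-1 = trans s-sum (-‿cong (trans (+-cong a-c a-c′) (+-identityˡ 1#)))

      X≈k : X ≈ k₀
      X≈k = trans (sym X-sum) (trans (+-cong (*-congʳ a-c) (*-congʳ a-c′))
        (solve 2 (λ p q → :0 :* p :+ :1 :* q := q) refl (k (not c)) k₀))

      N-c : N c ≈ m₀
      N-c = sym (trans (+-cong (+-congˡ (-‿cong (*-congʳ a-c))) (*-congˡ a-c))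
        (solve 3 (λ N n s → N :- :0 :* n :+ s :* :0 := N) refl (N c) (n₀ - 1# - 1#) s))

      N-c′ : N (not c) ≈ m₀ + n₀ - 1#
      N-c′ = begin
        N (not c)
          ≈⟨ solve 2 (λ N n → N := (N :- :1 :* (n :- :1 :- :1) :+ :- :1 :* :1) :+ n :- :1) refl (N (not c)) (size (not c)) ⟩
        (N (not c) - 1# * (size (not c) - 1# - 1#) + - 1# * 1#) + size (not c) - 1#
          ≈⟨ +-congʳ (+-cong (trans (+-cong (+-congˡ (-‿cong (*-congʳ (sym a-c′)))) (*-cong (sym s≈-1) (sym a-c′))) ms) sizes) ⟩
        m₀ + n₀ - 1# ∎

      -- The rank one condition on N and the count of round trips.
      k² : k₀ * k₀ ≈ m₀ * (m₀ + n₀ - 1#)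
      k² = trans (*-cong (sym X≈k) (sym X≈k)) (trans X² (*-cong N-c N-c′))

      k²′ : k₀ * k₀ ≈ n₀ * m₀ + (k₀ - m₀)
      k²′ = begin
        k₀ * k₀             ≈⟨ *-congˡ (sym ks) ⟩
        k₀ * k (not c)      ≈⟨ kk ⟩
        n₀ * m₀ + T         ≈⟨ +-congˡ (solve 2 (λ m t → t := (m :+ t) :- m) refl m₀ T) ⟩
        n₀ * m₀ + (m₀ + T - m₀) ≈⟨ +-congˡ (+-congʳ (sym k-T)) ⟩
        n₀ * m₀ + (k₀ - m₀) ∎

      k≈m² : k₀ ≈ m₀ * m₀
      k≈m² = begin
        k₀
          ≈⟨ solve 3 (λ k n m → k := (n :* m :+ (k :- m)) :- n :* m :+ m) refl k₀ n₀ m₀ ⟩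
        (n₀ * m₀ + (k₀ - m₀)) - n₀ * m₀ + m₀
          ≈⟨ +-congʳ (+-congʳ (trans (sym k²′) k²)) ⟩
        m₀ * (m₀ + n₀ - 1#) - n₀ * m₀ + m₀
          ≈⟨ solve 2 (λ n m → m :* (m :+ n :- :1) :- n :* m :+ m := m :* m) refl n₀ m₀ ⟩
        m₀ * m₀ ∎

      m≉0 : ¬ (m₀ ≈ 0#)
      m≉0 e = *-≉0 κ≉0 (*-≉0 (y≉0 (rep c)) (y≉0 (rep c))) (trans N-c e)

      n≈ : n₀ + m₀ ≈ m₀ * (m₀ * m₀) + 1#
      n≈ = *-cancelˡ m≉0 (begin
        m₀ * (n₀ + m₀)
          ≈⟨ solve 2 (λ n m → m :* (n :+ m) := m :* (m :+ n :- :1) :+ m) refl n₀ m₀ ⟩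
        m₀ * (m₀ + n₀ - 1#) + m₀
          ≈⟨ +-congʳ (trans (sym k²) (*-cong k≈m² k≈m²)) ⟩
        m₀ * m₀ * (m₀ * m₀) + m₀
          ≈⟨ solve 1 (λ m → m :* m :* (m :* m) :+ m := m :* (m :* (m :* m) :+ :1)) refl m₀ ⟩
        m₀ * (m₀ * (m₀ * m₀) + 1#) ∎)

    -- Numbers of common neighbours outside their class, for distinct vertices
    -- of a class.
    shared : ∀ b d → d ≡ not b → ∀ x z → cls x ≡ b → cls z ≡ b → x ≢ z → m b ≈ m₀ →
      ι (count (λ w → member d w ∧ (adjacent? x w ∧ adjacent? w z))) ≈ m₀
    shared b d d≡ x z x∈ z∈ x≢z mb = begin
      ι (count (λ w → member d w ∧ (adjacent? x w ∧ adjacent? w z)))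
        ≈⟨ sym (common-count d x z) ⟩
      common d x z
        ≈⟨ common-other b d d≡ x z x∈ z∈ ⟩
      m b + t b * δ x z
        ≈⟨ trans (+-cong mb (trans (*-congˡ (δ-≢ x≢z)) (zeroʳ (t b)))) (+-identityʳ m₀) ⟩
      m₀ ∎

    -- The number λ of the design.
    lam : ℕ
    lam = let (x , z , _) = ownPair c in count (λ w → member (not c) w ∧ (adjacent? x w ∧ adjacent? w z))

    ι-lam : ι lam ≈ m₀
    ι-lam = let (x , z , x∈ , z∈ , x≢z) = ownPair c in shared c (not c) ≡.refl x z x∈ z∈ x≢z refl

    1≤lam : 1 ℕ.≤ lam
    1≤lam = ℕ.n≢0⇒n>0 λ e → m≉0 (trans (sym ι-lam) (reflexive (≡.cong ι e)))

    pairs : ∀ x z → cls x ≡ c → cls z ≡ c → x ≢ z →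
      count (λ w → member (not c) w ∧ (adjacent? x w ∧ adjacent? w z)) ≡ lam
    pairs x z x∈ z∈ x≢z = ι-injective _ lam (trans (shared c (not c) ≡.refl x z x∈ z∈ x≢z refl) (sym ι-lam))

    intersections : ∀ w v → cls w ≡ not c → cls v ≡ not c → w ≢ v →
      count (λ z → member c z ∧ (adjacent? w z ∧ adjacent? z v)) ≡ lam
    intersections w v w∈ v∈ w≢v = ι-injective _ lam (trans
      (shared (not c) c (≡.sym (Bool.not-involutive c)) w v w∈ v∈ w≢v ms) (sym ι-lam))

    blocks : ∀ w → cls w ≡ not c → count (λ z → member c z ∧ adjacent? w z) ≡ lam ℕ.^ 2
    blocks w w∈ = ι-injective _ (lam ℕ.^ 2) (begin
      ι (count (λ z → member c z ∧ adjacent? w z))  ≈⟨ sym (valency-count c w) ⟩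
      valency c w                                   ≈⟨ valency-class c (not c) w w∈ ⟩
      valency c (rep (not c))                       ≈⟨ reflexive (≡.cong (λ b → valency b (rep (not c))) (≡.sym (Bool.not-involutive c))) ⟩
      k (not c)                                     ≈⟨ trans ks k≈m² ⟩
      m₀ * m₀                                       ≈⟨ *-cong (sym ι-lam) (sym ι-lam) ⟩
      ι lam * ι lam                                 ≈⟨ sym (trans (ι-* lam (lam ℕ.^ 1)) (*-congˡ (reflexive (≡.cong ι (ℕ.*-identityʳ lam))))) ⟩
      ι (lam ℕ.^ 2)                                 ∎)

    private
      sizeℕ : Bool → ℕ
      sizeℕ b = count (member b)

      points-sum : sizeℕ c ℕ.+ lam ≡ lam ℕ.^ 3 ℕ.+ 1
      points-sum = ι-injective (sizeℕ c ℕ.+ lam) (lam ℕ.^ 3 ℕ.+ 1) (begin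
        ι (sizeℕ c ℕ.+ lam)                ≈⟨ trans (ι-+ (sizeℕ c) lam) (+-cong (sym (sum-[] (member c))) ι-lam) ⟩
        n₀ + m₀                            ≈⟨ n≈ ⟩
        m₀ * (m₀ * m₀) + 1#                ≈⟨ +-congʳ (*-cong (sym ι-lam) (*-cong (sym ι-lam) (sym ι-lam))) ⟩
        ι lam * (ι lam * ι lam) + 1#       ≈⟨ +-congʳ (sym (trans (ι-* lam (lam ℕ.^ 2)) (*-congˡ (trans (ι-* lam (lam ℕ.^ 1)) (*-congˡ (reflexive (≡.cong ι (ℕ.*-identityʳ lam)))))))) ⟩
        ι (lam ℕ.^ 3) + ι 1                ≈⟨ sym (ι-+ (lam ℕ.^ 3) 1) ⟩
        ι (lam ℕ.^ 3 ℕ.+ 1)                ∎)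

      solve-size : ∀ p q r → p ≢ 0 → p ℕ.+ q ≡ r ℕ.+ 1 → p ≡ r ℕ.∸ q ℕ.+ 1
      solve-size ℕ.zero    q r p≢0 e = ⊥-elim (p≢0 ≡.refl)
      solve-size (ℕ.suc p) q r p≢0 e = ≡.trans (ℕ.+-comm 1 p) (≡.cong (ℕ._+ 1)
        (≡.trans (≡.sym (ℕ.m+n∸n≡m p q)) (≡.cong (ℕ._∸ q) (ℕ.suc-injective (≡.trans e (ℕ.+-comm r 1))))))

    points : sizeℕ c ≡ lam ℕ.^ 3 ℕ.∸ lam ℕ.+ 1
    points = solve-size (sizeℕ c) lam (lam ℕ.^ 3)
      (λ e → size≉0 c (trans (sum-[] (member c)) (reflexive (≡.cong ι e)))) points-sum

    blocks-number : sizeℕ (not c) ≡ lam ℕ.^ 3 ℕ.∸ lam ℕ.+ 1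
    blocks-number = ≡.trans (ι-injective _ _ (trans (sym (sum-[] (member (not c)))) (trans sizes (sum-[] (member c))))) points

  independentClass : ∃[ c ] (α c ≡ false × α (not c) ≡ true)
  independentClass = choose (α true) (α false) ≡.refl ≡.refl
    where
    choose : ∀ a b → α true ≡ a → α false ≡ b → ∃[ c ] (α c ≡ false × α (not c) ≡ true)
    choose true  true  p q = ⊥-elim (α-distinct (≡.trans p (≡.sym q)))
    choose true  false p q = false , q , p
    choose false true  p q = true , p , q
    choose false false p q = ⊥-elim (α-distinct (≡.trans p (≡.sym q)))

-- The design

count-cong : ∀ {n} {f g : Fin n → Bool} → (∀ i → f i ≡ g i) → count f ≡ count g
count-cong {ℕ.zero}  e = ≡.refl
count-cong {ℕ.suc n} e = ≡.cong₂ (λ b k → (if b then 1 else 0) ℕ.+ k) (e zero) (count-cong (λ i → e (suc i)))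

count-true : ∀ n → count {n} (λ _ → true) ≡ n
count-true ℕ.zero    = ≡.refl
count-true (ℕ.suc n) = ≡.cong ℕ.suc (count-true n)

-- A bijection that sorts the elements of a finite set into the p members of a
-- subset, given by its characteristic function b, and the q others.
record Sorting {n} (b : Fin n → Bool) : Set where
  field
    {p q}     : ℕ
    to        : Fin p ⊎ Fin q → Fin n
    from      : Fin n → Fin p ⊎ Fin q
    to-from   : ∀ x → to (from x) ≡ x
    from-to   : ∀ i → from (to i) ≡ i
    members   : ∀ i → b (to (inj₁ i)) ≡ true
    others    : ∀ j → b (to (inj₂ j)) ≡ false
    countˡ    : ∀ (f : Fin n → Bool) → count (λ i → f (to (inj₁ i))) ≡ count (λ x → b x ∧ f x)
    countʳ    : ∀ (f : Fin n → Bool) → count (λ j → f (to (inj₂ j))) ≡ count (λ x → not (b x) ∧ f x)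

sort : ∀ {n} (b : Fin n → Bool) → Sorting b
sort {ℕ.zero} b = record
  { p = 0 ; q = 0 ; to = λ { (inj₁ ()) ; (inj₂ ()) } ; from = λ () ; to-from = λ () ; from-to = λ { (inj₁ ()) ; (inj₂ ()) }
  ; members = λ () ; others = λ () ; countˡ = λ _ → ≡.refl ; countʳ = λ _ → ≡.refl }
sort {ℕ.suc n} b = extend (b zero) ≡.refl
  where
  open Sorting (sort (λ x → b (suc x)))

  extend : ∀ b₀ → b zero ≡ b₀ → Sorting b
  extend true e = record
    { to      = to′
    ; from    = from′
    ; to-from = λ { zero → ≡.refl ; (suc x) → to-from′ (from x) x (to-from x) }
    ; from-to = λ { (inj₁ zero) → ≡.refl ; (inj₁ (suc i)) → ≡.cong (Sum.map₁ suc) (from-to (inj₁ i)) ; (inj₂ j) → ≡.cong (Sum.map₁ suc) (from-to (inj₂ j)) }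
    ; members = λ { zero → e ; (suc i) → members i }
    ; others  = others
    ; countˡ  = λ f → ≡.cong₂ (λ b k → (if b then 1 else 0) ℕ.+ k) (≡.sym (≡.cong (_∧ f zero) e)) (countˡ (λ x → f (suc x)))
    ; countʳ  = λ f → ≡.trans (countʳ (λ x → f (suc x)))
                  (≡.cong (λ b → (if not b ∧ f zero then 1 else 0) ℕ.+ count (λ x → not (b′ x) ∧ f (suc x))) (≡.sym e))
    }
    where
    b′ = λ x → b (suc x)
    to′ : Fin (ℕ.suc p) ⊎ Fin q → Fin (ℕ.suc n)
    to′ (inj₁ zero)    = zero
    to′ (inj₁ (suc i)) = suc (to (inj₁ i))
    to′ (inj₂ j)       = suc (to (inj₂ j))
    from′ : Fin (ℕ.suc n) → Fin (ℕ.suc p) ⊎ Fin q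
    from′ zero    = inj₁ zero
    from′ (suc x) = Sum.map₁ suc (from x)
    to-from′ : ∀ i x → to i ≡ x → to′ (Sum.map₁ suc i) ≡ suc x
    to-from′ (inj₁ i) x e = ≡.cong suc e
    to-from′ (inj₂ j) x e = ≡.cong suc e
  extend false e = record
    { to      = to′
    ; from    = from′
    ; to-from = λ { zero → ≡.refl ; (suc x) → to-from′ (from x) x (to-from x) }
    ; from-to = λ { (inj₂ zero) → ≡.refl ; (inj₂ (suc j)) → ≡.cong (Sum.map₂ suc) (from-to (inj₂ j)) ; (inj₁ i) → ≡.cong (Sum.map₂ suc) (from-to (inj₁ i)) }
    ; members = members
    ; others  = λ { zero → e ; (suc j) → others j }
    ; countˡ  = λ f → ≡.trans (countˡ (λ x → f (suc x)))
                  (≡.cong (λ b → (if b ∧ f zero then 1 else 0) ℕ.+ count (λ x → b′ x ∧ f (suc x))) (≡.sym e))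
    ; countʳ  = λ f → ≡.cong₂ (λ b k → (if b then 1 else 0) ℕ.+ k) (≡.sym (≡.cong (λ b → not b ∧ f zero) e)) (countʳ (λ x → f (suc x)))
    }
    where
    b′ = λ x → b (suc x)
    to′ : Fin p ⊎ Fin (ℕ.suc q) → Fin (ℕ.suc n)
    to′ (inj₂ zero)    = zero
    to′ (inj₂ (suc j)) = suc (to (inj₂ j))
    to′ (inj₁ i)       = suc (to (inj₁ i))
    from′ : Fin (ℕ.suc n) → Fin p ⊎ Fin (ℕ.suc q)
    from′ zero    = inj₂ zero
    from′ (suc x) = Sum.map₂ suc (from x)
    to-from′ : ∀ i x → to i ≡ x → to′ (Sum.map₂ suc i) ≡ suc x
    to-from′ (inj₁ i) x e = ≡.cong suc e
    to-from′ (inj₂ j) x e = ≡.cong suc e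

∣tabulate∣ : ∀ {n} (f : Fin n → Bool) → ∣ tabulate f ∣ ≡ count f
∣tabulate∣ {ℕ.zero}  f = ≡.refl
∣tabulate∣ {ℕ.suc n} f with f zero
... | true  = ≡.cong ℕ.suc (∣tabulate∣ (λ i → f (suc i)))
... | false = ∣tabulate∣ (λ i → f (suc i))

∣tabulate∩tabulate∣ : ∀ {n} (f g : Fin n → Bool) → ∣ tabulate f ∩ tabulate g ∣ ≡ count (λ i → f i ∧ g i)
∣tabulate∩tabulate∣ {ℕ.zero}  f g = ≡.refl
∣tabulate∩tabulate∣ {ℕ.suc n} f g with f zero ∧ g zero
... | true  = ≡.cong ℕ.suc (∣tabulate∩tabulate∣ (λ i → f (suc i)) (λ i → g (suc i)))
... | false = ∣tabulate∩tabulate∣ (λ i → f (suc i)) (λ i → g (suc i))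

∈?-tabulate : ∀ {n} (f : Fin n → Bool) i → does (i ∈? tabulate f) ≡ f i
∈?-tabulate f zero with f zero
... | true  = ≡.refl
... | false = ≡.refl
∈?-tabulate f (suc i) = ∈?-tabulate (λ i → f (suc i)) i

module Assembly {c ℓ} (F : Field₀ c ℓ) {n} (Γ : Graph n) where
  open FieldTools F
  open Graph Γ
  open Matrices rawRing

  -- If the vertices fall into an independent set and a clique and the adjacency
  -- between them is a symmetric design, then the graph has the required form.
  assemble : ∀ {p q} (l : ℕ) (to : Fin p ⊎ Fin q → Fin n) (from : Fin n → Fin p ⊎ Fin q) →
    (∀ x → to (from x) ≡ x) → (∀ i → from (to i) ≡ i) →
    let N : Fin p → Fin q → Bool
        N i j = adjacent? (to (inj₁ i)) (to (inj₂ j)) in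
    (∀ i i′ → adjacent? (to (inj₁ i)) (to (inj₁ i′)) ≡ false) →
    (∀ j j′ → j ≢ j′ → adjacent? (to (inj₂ j)) (to (inj₂ j′)) ≡ true) →
    (∀ j → count (λ i → N i j) ≡ l ℕ.^ 2) →
    (∀ i i′ → i ≢ i′ → count (λ j → N i j ∧ N i′ j) ≡ l) →
    (∀ j j′ → j ≢ j′ → count (λ i → N i j ∧ N i j′) ≡ l) →
    p ≡ l ℕ.^ 3 ℕ.∸ l ℕ.+ 1 → q ≡ l ℕ.^ 3 ℕ.∸ l ℕ.+ 1 →
    ∃[ b ] Σ[ D ∈ Design (l ℕ.^ 3 ℕ.∸ l ℕ.+ 1) b (l ℕ.^ 2) l ]
      Design.Symmetric D × HasFormUpToOrdering Γ (blockMatrix O (incidenceMatrix D) (incidenceMatrix D ᵀ) (J -ᴹ I))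
  assemble {p} {q} l to from to-from from-to independent clique blocks pairs intersections ≡.refl q≡ =
    q , D , (q≡ , l , λ j j′ j≢j′ → ≡.trans (∣tabulate∩tabulate∣ (λ i → N i j) (λ i → N i j′)) (intersections j j′ j≢j′)) ,
    σ , entries
    where
    N : Fin p → Fin q → Bool
    N i j = adjacent? (to (inj₁ i)) (to (inj₂ j))

    D : Design p q (l ℕ.^ 2) l
    D = record
      { block     = λ j → tabulate (λ i → N i j)
      ; blockSize = λ j → ≡.trans (∣tabulate∣ (λ i → N i j)) (blocks j)
      ; balanced  = λ i i′ i≢i′ → ≡.trans
          (∣tabulate∩tabulate∣ (λ j → does (i ∈? tabulate (λ i → N i j))) (λ j → does (i′ ∈? tabulate (λ i → N i j))))
          (≡.trans (count-cong (λ j → ≡.cong₂ _∧_ (∈?-tabulate (λ i → N i j) i) (∈?-tabulate (λ i → N i j) i′)))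
            (pairs i i′ i≢i′))
      }

    σ : Fin (p ℕ.+ q) ↔ Fin n
    σ = mk↔ₛ′ to from to-from from-to ↔-∘ Fin.+↔⊎

    entries : (λ i j → adjacencyMatrix Γ (Inverse.to σ i) (Inverse.to σ j)) ≈ᴹ
      blockMatrix O (incidenceMatrix D) (incidenceMatrix D ᵀ) (J -ᴹ I)
    entries i j with splitAt p i | splitAt p j
    ... | inj₁ x | inj₁ x′ = []-cong (independent x x′)
    ... | inj₁ x | inj₂ y  = reflexive (≡.cong [_] (≡.sym (∈?-tabulate (λ i → N i y) x)))
    ... | inj₂ y | inj₁ x  = reflexive (≡.cong [_] (≡.trans (symmetric _ _) (≡.sym (∈?-tabulate (λ i → N i y) x))))
    ... | inj₂ y | inj₂ y′ with y Fin.≟ y′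
    ...   | yes ≡.refl = trans (reflexive (≡.cong [_] (loopless (to (inj₂ y))))) (sym (-‿inverseʳ 1#))
    ...   | no y≢y′    = trans ([]-cong (clique y y′ y≢y′)) (sym (trans (+-congˡ -0#≈0#) (+-identityʳ 1#)))

  module _ (connected : Connected) (E : RankOneEquation F Γ) (rank8 : HasCoherentRank Γ 8) where

    private
      Δ : Division F Γ
      Δ = DivisionByDegree.division F Γ E rank8

      open Division Δ using (cls; rep; cls-rep)

      -- An edge or non-edge between the classes.
      CrossPair : Bool → Set
      CrossPair a = ∃[ u ] ∃[ v ] (cls u ≡ true × cls v ≡ false × adjacent? u v ≡ a)

      -- A path from one class to the other crosses over along some edge.
      crossing : ∀ {x z} → Star Adjacent x z → cls x ≡ true → cls z ≡ false → CrossPair true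
      crossing ε p q = case ≡.trans (≡.sym p) q of λ ()
      crossing {x} (_◅_ {j = w} x~w path) p q = step (cls w) ≡.refl
        where
        step : ∀ b → cls w ≡ b → CrossPair true
        step true  e = crossing path e q
        step false e = x , w , p , e , x~w

      notJoined : CrossPair false
      notJoined = by-cases (Fin.any? (λ u → Fin.any? (λ v → (cls u Bool.≟ true) ×-dec (cls v Bool.≟ false) ×-dec (adjacent? u v Bool.≟ false))))
        where
        by-cases : Dec (CrossPair false) → CrossPair false
        by-cases (yes found) = found
        by-cases (no  none)  = ⊥-elim (JoinExcluded.impossible F Γ E rank8 Δ
          (λ u v u∈ v∈ → Bool.¬-not (λ e → none (u , v , u∈ , v∈ , e))))

      Conclusion : Set _
      Conclusion = ∃[ l ] (1 ℕ.≤ l) × (∃[ b ] Σ[ D ∈ Design (l ℕ.^ 3 ℕ.∸ l ℕ.+ 1) b (l ℕ.^ 2) l ]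
        Design.Symmetric D × HasFormUpToOrdering Γ (blockMatrix O (incidenceMatrix D) (incidenceMatrix D ᵀ) (J -ᴹ I)))

    symmetricDesign : Conclusion
    symmetricDesign =
      let (u , v , u∈ , v∈ , u~v) = crossing (connected (rep true) (rep false)) (cls-rep true) (cls-rep false)
          (u′ , v′ , u′∈ , v′∈ , u′≁v′) = notJoined
      in conclude u v u∈ v∈ u~v u′ v′ u′∈ v′∈ u′≁v′
      where
      module _ (u v : Fin n) (u∈ : cls u ≡ true) (v∈ : cls v ≡ false) (u~v : adjacent? u v ≡ true)
        (u′ v′ : Fin n) (u′∈ : cls u′ ≡ true) (v′∈ : cls v′ ≡ false) (u′≁v′ : adjacent? u′ v′ ≡ false) where
        open NotJoined F Γ E rank8 Δ u v u∈ v∈ u~v u′ v′ u′∈ v′∈ u′≁v′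

        -- The members of the independent class c are the points and the other
        -- vertices are the blocks.
        fromClass : ∀ c → α c ≡ false → α (not c) ≡ true → Conclusion
        fromClass c α-c α-c′ = lam , 1≤lam , assemble lam to from to-from from-to
            (λ i i′ → adjacent-members i i′)
            (λ j j′ j≢j′ → ≡.trans (uniform (not c) _ _ (other j) (other j′) (λ e → j≢j′ (to-injective₂ e))) α-c′)
            (λ j → ≡.trans (countˡ (λ z → adjacent? z (to (inj₂ j))))
              (≡.trans (count-cong (λ z → ≡.cong (is c (cls z) ∧_) (symmetric z _))) (blocks (to (inj₂ j)) (other j))))
            (λ i i′ i≢i′ → ≡.trans (countʳ (λ z → adjacent? (to (inj₁ i)) z ∧ adjacent? (to (inj₁ i′)) z))
              (≡.trans (count-cong (λ z → ≡.cong₂ _∧_ (not-is c (cls z)) (≡.cong (adjacent? (to (inj₁ i)) z ∧_) (symmetric _ z))))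
                (pairs _ _ (member₁ i) (member₁ i′) (λ e → i≢i′ (to-injective₁ e)))))
            (λ j j′ j≢j′ → ≡.trans (countˡ (λ z → adjacent? z (to (inj₂ j)) ∧ adjacent? z (to (inj₂ j′))))
              (≡.trans (count-cong (λ z → ≡.cong (λ b → is c (cls z) ∧ (b ∧ adjacent? z (to (inj₂ j′)))) (symmetric z _)))
                (intersections _ _ (other j) (other j′) (λ e → j≢j′ (to-injective₂ e)))))
            (≡.trans (≡.sym (count-true p)) (≡.trans (countˡ (λ _ → true))
              (≡.trans (count-cong (λ z → Bool.∧-identityʳ (is c (cls z)))) points)))
            (≡.trans (≡.sym (count-true q)) (≡.trans (countʳ (λ _ → true))
              (≡.trans (count-cong (λ z → ≡.trans (Bool.∧-identityʳ (not (is c (cls z)))) (not-is c (cls z)))) blocks-number)))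
          where
          open Parameters c α-c α-c′
          open Sorting (sort (λ z → is c (cls z)))

          not-is : ∀ c b → not (is c b) ≡ is (not c) b
          not-is true  b = ≡.refl
          not-is false b = Bool.not-involutive b

          is-true : ∀ c b → is c b ≡ true → b ≡ c
          is-true true  b e = e
          is-true false true  ()
          is-true false false e = ≡.refl

          is-false : ∀ c b → is c b ≡ false → b ≡ not c
          is-false true  b e = e
          is-false false true  e = ≡.refl
          is-false false false ()

          member₁ : ∀ i → cls (to (inj₁ i)) ≡ c
          member₁ i = is-true c _ (members i)

          other : ∀ j → cls (to (inj₂ j)) ≡ not c
          other j = is-false c _ (others j)

          to-injective : ∀ {i j} → to i ≡ to j → i ≡ j
          to-injective {i} {j} e = ≡.trans (≡.sym (from-to i)) (≡.trans (≡.cong from e) (from-to j))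

          to-injective₁ : ∀ {i j} → to (inj₁ i) ≡ to (inj₁ j) → i ≡ j
          to-injective₁ e with to-injective e
          ... | ≡.refl = ≡.refl

          to-injective₂ : ∀ {i j} → to (inj₂ i) ≡ to (inj₂ j) → i ≡ j
          to-injective₂ e with to-injective e
          ... | ≡.refl = ≡.refl

          adjacent-members : ∀ i i′ → adjacent? (to (inj₁ i)) (to (inj₁ i′)) ≡ false
          adjacent-members i i′ = by-cases (i Fin.≟ i′)
            where
            by-cases : Dec (i ≡ i′) → adjacent? (to (inj₁ i)) (to (inj₁ i′)) ≡ false
            by-cases (yes ≡.refl) = loopless (to (inj₁ i))
            by-cases (no i≢i′)    = ≡.trans (uniform c _ _ (member₁ i) (member₁ i′) (λ e → i≢i′ (to-injective₁ e))) α-c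

        conclude : Conclusion
        conclude = let (c , α-c , α-c′) = independentClass in fromClass c α-c α-c′

open import Data.Nat.Base using (_+_; _∸_; _^_; _≤_)

theorem4p3 : ∀ {c ℓ₁ ℓ₂} (ℝ : RealClosedField c ℓ₁ ℓ₂) →
    let open Matrices (RealClosedField.ℂ ℝ) in
    ∀ {n} (Γ : Graph n) → 𝒢₃ Γ → HasCoherentRank Γ 8 →
    ∃[ l ] (1 ≤ l) × (∃[ b ]
    Σ[ D ∈ Design (l ^ 3 ∸ l + 1) b (l ^ 2) l ]
    Design.Symmetric D ×
    (let M = incidenceMatrix D in
    HasFormUpToOrdering Γ (blockMatrix O M (M ᵀ) (J -ᴹ I))))
theorem4p3 ℝ Γ (connected , spectrum) =
  Assembly.symmetricDesign (Complexification.ℂ-field (RealClosedField.orderedField ℝ)) Γ connected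
    (Spectral.rankOneEquation ℝ Γ connected spectrum)
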